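{- Suppose that $M$ and $N$ are $3$-connected matroids such that $|E(N)| \geq 4$, and $C^{*}$ is a cocircuit of $M$ with the property that $M / x_{0}$ has an $N$-minor for some $x_{0} \in C^{*}$. Then at least one of the following holds: (i) there is an element $x \in C^{*}$ such that $\operatorname{si}(M / x)$ is $3$-connected and has an $N$-minor; (ii) there is an element $x \in C^{*}$ such that $\operatorname{co}(\operatorname{si}(M / x))$ is $3$-connected and has an $N$-minor; or (iii) there is a sequence of elements $(x_{1}, x_{2}, x_{3}, x_{4})$ from $E(M)$ such that $\{x_{1}, x_{2}, x_{3}\}$ is a circuit of $M$, $\{x_{2}, x_{3}, x_{4}\}$ is a cocircuit of $M$, $x_{1}, x_{3} \in C^{*}$, and $\operatorname{si}(M / x_{2})$ is $3$-connected with an $N$-minor.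
   Context: All matroids are finite. For a matroid $M$ with ground set $E$ and rank function $r$, the connectivity function is $\lambda_M(X) = r(X) + r(E - X) - r(M)$ for $X \subseteq E$. A $k$-separation of $M$ is a partition $(X, E-X)$ of $E$ with $\lambda_M(X) < k$ and $|X|, |E-X| \geq k$. $M$ is $n$-connected if it has no $k$-separation for any $k < n$ ($k$ a positive integer). $\operatorname{si}(M)$ is the simple matroid associated with $M$ (delete all loops and all but one element of each parallel class), and $\operatorname{co}(M) = (\operatorname{si}(M^*))^*$ is the cosimple matroid associated with $M$. A matroid has an $N$-minor if it has a minor isomorphic to $N$. -}

module Defs where

open import Data.Bool.Base using (true; false)
open import Data.Fin.Base using (Fin) renaming (_<_ to _<ᶠ_)
open import Data.Fin.Properties using (any?) renaming (_<?_ to _<ᶠ?_; _≟_ to _≟ᶠ_)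
open import Data.Fin.Subset using (Subset; ⁅_⁆; _∈_; _⊆_; _⊂_; _∪_; _∩_; _─_; ∣_∣; Empty)
open import Data.Fin.Subset.Properties
  using (_⊆?_; _⊂?_; _∈?_; anySubset?; p─q⊆p; ⊆-antisym; ⊆-trans; x∈p∪q⁺; x∈p∪q⁻
        ; x∈p∧x∉q⇒x∈p─q; p∩q⊆p)
open import Data.Nat.Base using (ℕ; suc; _+_; _∸_; _≤_; _<_)
open import Data.Nat.Properties as ℕ using (_≟_)
open import Data.Product.Base using (∃-syntax; _×_; _,_; proj₁)
open import Data.Sum.Base using (_⊎_; inj₁; inj₂; [_,_]′)
open import Data.Vec.Base using ([]; _∷_; tabulate; here; there)
open import Function.Base using (_∘_)
open import Function.Bundles using (_↔_; _⇔_; module Inverse)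
open import Relation.Binary.PropositionalEquality
  using (_≡_; _≢_; refl; sym; trans; cong; cong₂)
open import Relation.Nullary.Decidable
  using (Dec; yes; no; does; map′; ¬?; _×-dec_; _⊎-dec_; decidable-stable)
open import Relation.Nullary.Negation using (¬_)

private
  variable
    m n : ℕ

------------------------------------------------------------------------
-- Matroids

-- The ground set is a subset of an ambient `Fin n`, so that a matroid and its
-- minors share one ambient type.  The rank function is total, but only its
-- values on subsets of the ground set carry meaning.

record Matroid (n : ℕ) : Set where
  field
    E            : Subset n
    r            : Subset n → ℕ
    r-bounded    : ∀ X → X ⊆ E → r X ≤ ∣ X ∣
    r-monotone   : ∀ X Y → X ⊆ Y → Y ⊆ E → r X ≤ r Y
    r-submodular : ∀ X Y → X ⊆ E → Y ⊆ E → r (X ∪ Y) + r (X ∩ Y) ≤ r X + r Y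

open Matroid public

Independent : Matroid n → Subset n → Set
Independent M X = X ⊆ E M × r M X ≡ ∣ X ∣

Circuit : Matroid n → Subset n → Set
Circuit M C = C ⊆ E M × ¬ Independent M C × (∀ Y → Y ⊂ C → Independent M Y)

------------------------------------------------------------------------
-- Duality

private

  ∣∪∣+∣∩∣ : (p q : Subset n) → ∣ p ∪ q ∣ + ∣ p ∩ q ∣ ≡ ∣ p ∣ + ∣ q ∣
  ∣∪∣+∣∩∣ []          []          = refl
  ∣∪∣+∣∩∣ (true  ∷ p) (true  ∷ q) = cong suc
    (trans (ℕ.+-suc _ _) (trans (cong suc (∣∪∣+∣∩∣ p q)) (sym (ℕ.+-suc _ _))))
  ∣∪∣+∣∩∣ (true  ∷ p) (false ∷ q) = cong suc (∣∪∣+∣∩∣ p q)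
  ∣∪∣+∣∩∣ (false ∷ p) (true  ∷ q) =
    trans (cong suc (∣∪∣+∣∩∣ p q)) (sym (ℕ.+-suc _ _))
  ∣∪∣+∣∩∣ (false ∷ p) (false ∷ q) = ∣∪∣+∣∩∣ p q

  ∣q∣+∣p─q∣ : (p q : Subset n) → ∣ q ∣ + ∣ p ─ q ∣ ≡ ∣ q ∪ p ∣
  ∣q∣+∣p─q∣ []          []          = refl
  ∣q∣+∣p─q∣ (true  ∷ p) (true  ∷ q) = cong suc (∣q∣+∣p─q∣ p q)
  ∣q∣+∣p─q∣ (true  ∷ p) (false ∷ q) = trans (ℕ.+-suc _ _) (cong suc (∣q∣+∣p─q∣ p q))
  ∣q∣+∣p─q∣ (false ∷ p) (true  ∷ q) = cong suc (∣q∣+∣p─q∣ p q)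
  ∣q∣+∣p─q∣ (false ∷ p) (false ∷ q) = ∣q∣+∣p─q∣ p q

  ─-∪ : (e p q : Subset n) → e ─ (p ∪ q) ≡ (e ─ p) ∩ (e ─ q)
  ─-∪ []          []          []          = refl
  ─-∪ (x     ∷ e) (true  ∷ p) (y     ∷ q) = cong (false ∷_) (─-∪ e p q)
  ─-∪ (true  ∷ e) (false ∷ p) (true  ∷ q) = cong (false ∷_) (─-∪ e p q)
  ─-∪ (false ∷ e) (false ∷ p) (true  ∷ q) = cong (false ∷_) (─-∪ e p q)
  ─-∪ (true  ∷ e) (false ∷ p) (false ∷ q) = cong (true ∷_) (─-∪ e p q)
  ─-∪ (false ∷ e) (false ∷ p) (false ∷ q) = cong (false ∷_) (─-∪ e p q)

  ─-∩ : (e p q : Subset n) → e ─ (p ∩ q) ≡ (e ─ p) ∪ (e ─ q)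
  ─-∩ []          []          []          = refl
  ─-∩ (x     ∷ e) (true  ∷ p) (true  ∷ q) = cong (false ∷_) (─-∩ e p q)
  ─-∩ (x     ∷ e) (true  ∷ p) (false ∷ q) = cong (x ∷_) (─-∩ e p q)
  ─-∩ (true  ∷ e) (false ∷ p) (true  ∷ q) = cong (true ∷_) (─-∩ e p q)
  ─-∩ (false ∷ e) (false ∷ p) (true  ∷ q) = cong (false ∷_) (─-∩ e p q)
  ─-∩ (true  ∷ e) (false ∷ p) (false ∷ q) = cong (true ∷_) (─-∩ e p q)
  ─-∩ (false ∷ e) (false ∷ p) (false ∷ q) = cong (false ∷_) (─-∩ e p q)

  x∈p─q⇒x∉q : (p q : Subset n) {x : Fin n} → x ∈ p ─ q → ¬ (x ∈ q)
  x∈p─q⇒x∉q (_ ∷ p) (_ ∷ q) (there x∈p─q) (there x∈q) = x∈p─q⇒x∉q p q x∈p─q x∈q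

  ∪-⊆ : {p q s : Subset n} → p ⊆ s → q ⊆ s → p ∪ q ⊆ s
  ∪-⊆ {p = p} {q} p⊆s q⊆s = [ p⊆s , q⊆s ]′ ∘ x∈p∪q⁻ p q

  ⊆-─∪ : (p q : Subset n) → p ⊆ (p ─ q) ∪ q
  ⊆-─∪ p q {x} x∈p with x ∈? q
  ... | yes x∈q = x∈p∪q⁺ (inj₂ x∈q)
  ... | no  x∉q = x∈p∪q⁺ (inj₁ (x∈p∧x∉q⇒x∈p─q x∈p x∉q))

  ⊆⇒∪≡ : {p q : Subset n} → p ⊆ q → p ∪ q ≡ q
  ⊆⇒∪≡ {p = p} p⊆q = ⊆-antisym (∪-⊆ p⊆q (λ x → x)) (x∈p∪q⁺ {p = p} ∘ inj₂)

  ∸-+-∸ : ∀ {a b ρ} → ρ ≤ a → ρ ≤ b → (a ∸ ρ) + (b ∸ ρ) ≡ (a + b) ∸ (ρ + ρ)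
  ∸-+-∸ {a} {b} {ρ} ρ≤a ρ≤b =
    trans (sym (ℕ.+-∸-assoc (a ∸ ρ) ρ≤b))
    (trans (cong (_∸ ρ) (sym (ℕ.+-∸-comm b ρ≤a)))
           (ℕ.∸-+-assoc (a + b) ρ ρ))

  +-interchange : ∀ a b c d → (a + b) + (c + d) ≡ (a + c) + (b + d)
  +-interchange a b c d =
    trans (ℕ.+-assoc a b (c + d))
    (trans (cong (a +_) (trans (sym (ℕ.+-assoc b c d))
                        (trans (cong (_+ d) (ℕ.+-comm b c)) (ℕ.+-assoc c b d))))
           (sym (ℕ.+-assoc a c (b + d))))

  module _ (M : Matroid n) where
    open ℕ.≤-Reasoning

    corank : Subset n → ℕ
    corank X = ∣ X ∣ + r M (E M ─ X)

    r-subadditive : ∀ X Y → X ⊆ E M → Y ⊆ E M → r M (X ∪ Y) ≤ r M X + ∣ Y ∣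
    r-subadditive X Y X⊆E Y⊆E = begin
      r M (X ∪ Y)                ≤⟨ ℕ.m≤m+n _ _ ⟩
      r M (X ∪ Y) + r M (X ∩ Y)  ≤⟨ r-submodular M X Y X⊆E Y⊆E ⟩
      r M X + r M Y              ≤⟨ ℕ.+-monoʳ-≤ (r M X) (r-bounded M Y Y⊆E) ⟩
      r M X + ∣ Y ∣              ∎

    E─⊆E : ∀ X → E M ─ X ⊆ E M
    E─⊆E X = p─q⊆p (E M) X

    rE≤corank : ∀ X → X ⊆ E M → r M (E M) ≤ corank X
    rE≤corank X X⊆E = begin
      r M (E M)              ≤⟨ r-monotone M _ _ (⊆-─∪ (E M) X) (∪-⊆ (E─⊆E X) X⊆E) ⟩
      r M ((E M ─ X) ∪ X)    ≤⟨ r-subadditive (E M ─ X) X (E─⊆E X) X⊆E ⟩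
      r M (E M ─ X) + ∣ X ∣  ≡⟨ ℕ.+-comm _ ∣ X ∣ ⟩
      corank X               ∎

    corank-monotone : ∀ X Y → X ⊆ Y → Y ⊆ E M → corank X ≤ corank Y
    corank-monotone X Y X⊆Y Y⊆E = begin
      ∣ X ∣ + r M (E M ─ X)                      ≤⟨ ℕ.+-monoʳ-≤ ∣ X ∣ step ⟩
      ∣ X ∣ + (∣ Y ─ X ∣ + r M (E M ─ Y))        ≡⟨ sym (ℕ.+-assoc ∣ X ∣ _ _) ⟩
      (∣ X ∣ + ∣ Y ─ X ∣) + r M (E M ─ Y)        ≡⟨ cong (_+ r M (E M ─ Y)) (∣q∣+∣p─q∣ Y X) ⟩
      ∣ X ∪ Y ∣ + r M (E M ─ Y)                  ≡⟨ cong (λ Z → ∣ Z ∣ + r M (E M ─ Y)) (⊆⇒∪≡ X⊆Y) ⟩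
      corank Y                                   ∎
      where
      Y─X⊆E : Y ─ X ⊆ E M
      Y─X⊆E = ⊆-trans (p─q⊆p Y X) Y⊆E

      cover : E M ─ X ⊆ (E M ─ Y) ∪ (Y ─ X)
      cover {x} x∈ with x ∈? Y
      ... | no  x∉Y = x∈p∪q⁺ (inj₁ (x∈p∧x∉q⇒x∈p─q (E─⊆E X x∈) x∉Y))
      ... | yes x∈Y = x∈p∪q⁺ (inj₂ (x∈p∧x∉q⇒x∈p─q x∈Y (x∈p─q⇒x∉q (E M) X x∈)))

      step : r M (E M ─ X) ≤ ∣ Y ─ X ∣ + r M (E M ─ Y)
      step = begin
        r M (E M ─ X)                ≤⟨ r-monotone M _ _ cover (∪-⊆ (E─⊆E Y) Y─X⊆E) ⟩
        r M ((E M ─ Y) ∪ (Y ─ X))    ≤⟨ r-subadditive (E M ─ Y) (Y ─ X) (E─⊆E Y) Y─X⊆E ⟩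
        r M (E M ─ Y) + ∣ Y ─ X ∣    ≡⟨ ℕ.+-comm _ ∣ Y ─ X ∣ ⟩
        ∣ Y ─ X ∣ + r M (E M ─ Y)    ∎

    corank-submodular : ∀ X Y → corank (X ∪ Y) + corank (X ∩ Y) ≤ corank X + corank Y
    corank-submodular X Y = begin
      corank (X ∪ Y) + corank (X ∩ Y)
        ≡⟨ +-interchange (∣ X ∪ Y ∣) _ (∣ X ∩ Y ∣) _ ⟩
      (∣ X ∪ Y ∣ + ∣ X ∩ Y ∣) + (r M (E M ─ (X ∪ Y)) + r M (E M ─ (X ∩ Y)))
        ≡⟨ cong₂ _+_ (∣∪∣+∣∩∣ X Y)
             (trans (cong₂ (λ P Q → r M P + r M Q) (─-∪ (E M) X Y) (─-∩ (E M) X Y))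
                    (ℕ.+-comm (r M (E─X ∩ E─Y)) _)) ⟩
      (∣ X ∣ + ∣ Y ∣) + (r M (E─X ∪ E─Y) + r M (E─X ∩ E─Y))
        ≤⟨ ℕ.+-monoʳ-≤ (∣ X ∣ + ∣ Y ∣) (r-submodular M E─X E─Y (E─⊆E X) (E─⊆E Y)) ⟩
      (∣ X ∣ + ∣ Y ∣) + (r M E─X + r M E─Y)
        ≡⟨ +-interchange (∣ X ∣) (∣ Y ∣) _ _ ⟩
      corank X + corank Y ∎
      where
      E─X E─Y : Subset n
      E─X = E M ─ X
      E─Y = E M ─ Y

    r*-bounded : ∀ X → corank X ∸ r M (E M) ≤ ∣ X ∣
    r*-bounded X = begin
      corank X ∸ r M (E M)             ≤⟨ ℕ.∸-monoˡ-≤ (r M (E M)) (ℕ.+-monoʳ-≤ ∣ X ∣ (r-monotone M _ _ (E─⊆E X) (λ x → x))) ⟩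
      (∣ X ∣ + r M (E M)) ∸ r M (E M)  ≡⟨ ℕ.m+n∸n≡m (∣ X ∣) (r M (E M)) ⟩
      ∣ X ∣                            ∎

    r*-submodular : ∀ X Y → X ⊆ E M → Y ⊆ E M →
      (corank (X ∪ Y) ∸ r M (E M)) + (corank (X ∩ Y) ∸ r M (E M)) ≤
      (corank X ∸ r M (E M)) + (corank Y ∸ r M (E M))
    r*-submodular X Y X⊆E Y⊆E = begin
      (corank (X ∪ Y) ∸ r M (E M)) + (corank (X ∩ Y) ∸ r M (E M))
        ≡⟨ ∸-+-∸ (rE≤corank (X ∪ Y) (∪-⊆ X⊆E Y⊆E))
                 (rE≤corank (X ∩ Y) (⊆-trans (p∩q⊆p X Y) X⊆E)) ⟩
      (corank (X ∪ Y) + corank (X ∩ Y)) ∸ (r M (E M) + r M (E M))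
        ≤⟨ ℕ.∸-monoˡ-≤ (r M (E M) + r M (E M)) (corank-submodular X Y) ⟩
      (corank X + corank Y) ∸ (r M (E M) + r M (E M))
        ≡⟨ sym (∸-+-∸ (rE≤corank X X⊆E) (rE≤corank Y Y⊆E)) ⟩
      (corank X ∸ r M (E M)) + (corank Y ∸ r M (E M)) ∎

infix 10 _*

-- The truncated subtraction is exact: r(E) ≤ ∣X∣ + r(E ─ X) for X ⊆ E.

_* : Matroid n → Matroid n
(M *) .E                          = E M
(M *) .r X                        = (∣ X ∣ + r M (E M ─ X)) ∸ r M (E M)
(M *) .r-bounded X _              = r*-bounded M X
(M *) .r-monotone X Y X⊆Y Y⊆E     = ℕ.∸-monoˡ-≤ (r M (E M)) (corank-monotone M X Y X⊆Y Y⊆E)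
(M *) .r-submodular X Y X⊆E Y⊆E   = r*-submodular M X Y X⊆E Y⊆E

Cocircuit : Matroid n → Subset n → Set
Cocircuit M C = Circuit (M *) C

------------------------------------------------------------------------
-- Minors and isomorphism

infixl 9 _∖_ _/_

_∖_ : Matroid n → Subset n → Matroid n
(M ∖ D) .E                        = E M ─ D
(M ∖ D) .r                        = r M
(M ∖ D) .r-bounded X X⊆           = r-bounded M X (⊆-trans X⊆ (p─q⊆p (E M) D))
(M ∖ D) .r-monotone X Y X⊆Y Y⊆    = r-monotone M X Y X⊆Y (⊆-trans Y⊆ (p─q⊆p (E M) D))
(M ∖ D) .r-submodular X Y X⊆ Y⊆   =
  r-submodular M X Y (⊆-trans X⊆ (p─q⊆p (E M) D)) (⊆-trans Y⊆ (p─q⊆p (E M) D))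

_/_ : Matroid n → Subset n → Matroid n
M / C = (M * ∖ C) *

Element : Matroid n → Set
Element M = ∃[ e ] e ∈ E M

-- The hypothesis of `r-preserving` says that Y is the image of X.

record _≅_ (M : Matroid m) (N : Matroid n) : Set where
  field
    bijection    : Element M ↔ Element N
    r-preserving : ∀ X Y → X ⊆ E M → Y ⊆ E N →
                   (∀ e → proj₁ e ∈ X ⇔ proj₁ (Inverse.to bijection e) ∈ Y) →
                   r M X ≡ r N Y

HasMinor : Matroid m → Matroid n → Set
HasMinor M N =
  ∃[ C ] ∃[ D ] C ⊆ E M × D ⊆ E M × Empty (C ∩ D) × ((M / C) ∖ D) ≅ N

------------------------------------------------------------------------
-- Connectivity

-- The truncated subtraction is exact for X ⊆ E, since r is subadditive.

connectivity : Matroid n → Subset n → ℕ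
connectivity M X = (r M X + r M (E M ─ X)) ∸ r M (E M)

Separation : ℕ → Matroid n → Subset n → Set
Separation k M X =
  X ⊆ E M × connectivity M X < k × k ≤ ∣ X ∣ × k ≤ ∣ E M ─ X ∣

Connected : ℕ → Matroid n → Set
Connected n M = ∀ k → 1 ≤ k → k < n → ¬ (∃[ X ] Separation k M X)

------------------------------------------------------------------------
-- Simplification and cosimplification

Loop : Matroid n → Fin n → Set
Loop M e = Circuit M ⁅ e ⁆

Parallel : Matroid n → Fin n → Fin n → Set
Parallel M e f = e ≢ f × Circuit M (⁅ e ⁆ ∪ ⁅ f ⁆)

-- From each parallel class we keep the element that comes first in `Fin n`;
-- any other choice gives an isomorphic matroid.

Redundant : Matroid n → Fin n → Set
Redundant M e = Loop M e ⊎ (∃[ f ] f <ᶠ e × Parallel M f e)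

independent? : (M : Matroid n) (X : Subset n) → Dec (Independent M X)
independent? M X = (X ⊆? E M) ×-dec (r M X ≟ ∣ X ∣)

circuit? : (M : Matroid n) (C : Subset n) → Dec (Circuit M C)
circuit? M C = (C ⊆? E M) ×-dec ¬? (independent? M C) ×-dec
  map′ (λ ¬∃ Y Y⊂C → decidable-stable (independent? M Y) (λ ¬i → ¬∃ (Y , Y⊂C , ¬i)))
       (λ all (Y , Y⊂C , ¬i) → ¬i (all Y Y⊂C))
       (¬? (anySubset? (λ Y → (Y ⊂? C) ×-dec ¬? (independent? M Y))))

redundant? : (M : Matroid n) (e : Fin n) → Dec (Redundant M e)
redundant? M e = circuit? M ⁅ e ⁆ ⊎-dec
  any? (λ f → (f <ᶠ? e) ×-dec ¬? (f ≟ᶠ e) ×-dec circuit? M (⁅ f ⁆ ∪ ⁅ e ⁆))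

si : Matroid n → Matroid n
si M = M ∖ tabulate (λ e → does (redundant? M e))

co : Matroid n → Matroid n
co M = si (M *) *

{-# OPTIONS --safe #-}

-- If si(M/x) is not 3-connected, then M has a vertical 3-partition (X, x, Y): both sides have rank at least 3, both
-- span x, and λ(X) = 2.  When M/x has an N-minor, one side, say X, carries at most one element of it, and every
-- element of X outside cl(Y) can then be contracted instead of x without losing N.  Induct on ∣X∣.  If Y ∪ x is not
-- closed, X can be shrunk.  Otherwise pick c ∈ X ∩ C*; unless si(M/c) is 3-connected, uncrossing a vertical
-- 3-partition (Z, c, W) with (X, x, Y) yields a smaller X, or shows that X ∪ x is covered by two lines through c.  If
-- both lines are long, some element of C* on one of them works.  Otherwise X = (L - x) ∪ b for a line L through x and
-- c.  Take a ∈ L - {x, c}, in C* if possible.  If si(M/a) is 3-connected, outcome (i) or (iii) holds.  If not, the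
-- vertical 3-partitions at c and at a, crossed inside the hyperplane Y ∪ x, force every vertical 3-partition at c to
-- have a side (L - c) ∪ y.  So every 2-separation of si(M/c) comes from a series pair, and co(si(M/c)) is 3-connected.

module Submission where

open import Defs
open import Data.Bool.Base using (Bool; true; false; _∧_; _∨_; not; T; if_then_else_)
open import Data.Bool.Properties using (∧-zeroʳ; ∧-identityʳ; ∨-zeroʳ; ∨-identityʳ)
open import Data.Empty using (⊥-elim) renaming (⊥ to False)
open import Data.Fin.Base using (Fin) renaming (_<_ to _<ᶠ_)
open import Data.Fin.Induction using (<-wellFounded)
open import Data.Fin.Properties using (_≟_; <-cmp; any?)
open import Data.Fin.Subset using (Subset; Nonempty; ∣_∣; inside; outside; _∈_; _∉_; _⊆_; _∪_; _∩_; _─_; ⁅_⁆; ⊥; ⊤)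
open import Data.Fin.Subset.Properties
open import Data.List.Base using (List; []; _∷_; _++_; map; length)
open import Data.List.Membership.Propositional using () renaming (_∈_ to _∈ˡ_)
open import Data.List.Membership.Propositional.Properties using (∈-++⁺ˡ; ∈-++⁺ʳ; ∈-map⁺)
open import Data.List.Relation.Unary.All using (All; []; _∷_)
open import Data.List.Relation.Unary.Any using (here; there)
open import Data.Maybe.Base using (Maybe; just; nothing)
open import Data.Nat.Base using (ℕ; zero; suc; _+_; _∸_; _≤_; _<_; _≤ᵇ_; z≤n; s≤s)
import Data.Nat.Induction as ℕ using (<-wellFounded)
import Data.Nat.Properties as ℕ
open import Algebra.Properties.CommutativeSemigroup ℕ.+-commutativeSemigroup
  using () renaming (interchange to +-interchange; x∙yz≈y∙xz to +-exchange)
open import Data.Nat.Solver using (module +-*-Solver)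
open import Data.Product.Base using (_×_; _,_; proj₁; proj₂; ∃-syntax)
open import Data.Sum.Base as Sum using (_⊎_; inj₁; inj₂; [_,_]′)
open import Data.Unit.Base using (tt)
open import Data.Vec.Base using (lookup; tabulate; []; _∷_)
open import Data.Vec.Properties using (lookup-zipWith; lookup-replicate; lookup∘tabulate; lookup⇒[]=; []=⇒lookup)
open import Data.Vec.Properties.WithK using ([]=-irrelevant)
open import Function.Base using (case_of_)
open import Function.Bundles using (_⇔_; module Inverse; module Equivalence; mk⇔; mk↔ₛ′)
open import Induction.WellFounded using (Acc; acc)
open import Relation.Binary.Definitions using (tri<; tri≈; tri>)
open import Relation.Binary.PropositionalEquality
  using (_≡_; _≢_; refl; sym; trans; cong; cong₂; subst; subst₂; module ≡-Reasoning)
open import Relation.Nullary.Decidable using (Dec; yes; no; does; dec-true; dec-false; _×-dec_)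
open import Relation.Nullary.Negation using (¬_)

-- A decision procedure for rank inequalities

-- A hypothesis e ⊑ f says that e ⊖ f is empty, and `cells` lists the regions of the Venn diagram that survive the
-- hypotheses.  An inequality between sums of ranks follows from given ones if, once these are added up, every set
-- that remains on the left is contained in a set of its own on the right.

-- Relocation keeps `x` contracted together with the new element `c`. One model of `N` then serves
-- both the partition at `x` and the partition at `c`, each with a side that carries at most one
-- element of `N`, and `4 ≤ ∣ E N ∣` leaves two elements of `N` in the opposite corner. That corner
-- therefore has rank at least two, which is exactly what submodular uncrossing asks for. A corner
-- of rank at least three is a smaller side for the induction. The lines arise from the other case,
-- in which a corner together with `x` and `c` has rank at most two. That no element of `X` lies in
-- cl(Y) is used twice over: it makes every element of `X` contractible without losing `N`, and it
-- forces every vertical 3-partition at `c` to split `X`, because a side inside Y ∪ x cannot span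
-- `c`. For the cosimplified outcome, contracting `c` turns the rest of `L` into one parallel class.
-- A side (L - c) ∪ y thus keeps at most two elements in si(M/c), few enough to have rank at most
-- one in the dual.

infixr 12 _⊓_
infixr 11 _⊔_
infixl 10 _⊖_

data Expr : Set where
  var         : ℕ → Expr
  const       : Bool → Expr
  _⊔_ _⊓_ _⊖_ : Expr → Expr → Expr

diff : Bool → Bool → Bool
diff x true  = false
diff x false = x

at : List Bool → ℕ → Bool
at []       i       = false
at (b ∷ bs) zero    = b
at (b ∷ bs) (suc i) = at bs i

eval : List Bool → Expr → Bool
eval bs (var i)   = at bs i
eval bs (const b) = b
eval bs (e ⊔ f)   = eval bs e ∨ eval bs f
eval bs (e ⊓ f)   = eval bs e ∧ eval bs f
eval bs (e ⊖ f)   = diff (eval bs e) (eval bs f)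

constant? : (e : Expr) → Maybe (∃[ b ] e ≡ const b)
constant? (const b) = just (b , refl)
constant? _         = nothing

-- Constant folding lets a hypothesis collapse to `const true` as soon as the variables fixed so far
-- violate it, so that `cells` prunes the branch before enumerating the remaining variables.
_⊔ˢ_ _⊓ˢ_ _⊖ˢ_ : Expr → Expr → Expr
e ⊔ˢ f with constant? e | constant? f
... | just (true  , _) | _                = const true
... | just (false , _) | _                = f
... | nothing          | just (true  , _) = const true
... | nothing          | just (false , _) = e
... | nothing          | nothing          = e ⊔ f
e ⊓ˢ f with constant? e | constant? f
... | just (true  , _) | _                = f
... | just (false , _) | _                = const false
... | nothing          | just (true  , _) = e
... | nothing          | just (false , _) = const false
... | nothing          | nothing          = e ⊓ f
e ⊖ˢ f with constant? e | constant? f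
... | just (false , _) | _                = const false
... | just (true  , _) | just (b , _)     = const (not b)
... | just (true  , _) | nothing          = e ⊖ f
... | nothing          | just (true  , _) = const false
... | nothing          | just (false , _) = e
... | nothing          | nothing          = e ⊖ f

instantiate : Bool → Expr → Expr
instantiate b (var zero)    = const b
instantiate b (var (suc i)) = var i
instantiate b (const c)     = const c
instantiate b (e ⊔ f)       = instantiate b e ⊔ˢ instantiate b f
instantiate b (e ⊓ f)       = instantiate b e ⊓ˢ instantiate b f
instantiate b (e ⊖ f)       = instantiate b e ⊖ˢ instantiate b f

module _ (bs : List Bool) where

  ⊔ˢ-eval : ∀ e f → eval bs (e ⊔ˢ f) ≡ eval bs (e ⊔ f)
  ⊔ˢ-eval e f with constant? e | constant? f
  ... | just (true  , refl) | _                   = refl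
  ... | just (false , refl) | _                   = refl
  ... | nothing             | just (true  , refl) = sym (∨-zeroʳ _)
  ... | nothing             | just (false , refl) = sym (∨-identityʳ _)
  ... | nothing             | nothing             = refl

  ⊓ˢ-eval : ∀ e f → eval bs (e ⊓ˢ f) ≡ eval bs (e ⊓ f)
  ⊓ˢ-eval e f with constant? e | constant? f
  ... | just (true  , refl) | _                   = refl
  ... | just (false , refl) | _                   = refl
  ... | nothing             | just (true  , refl) = sym (∧-identityʳ _)
  ... | nothing             | just (false , refl) = sym (∧-zeroʳ _)
  ... | nothing             | nothing             = refl

  ⊖ˢ-eval : ∀ e f → eval bs (e ⊖ˢ f) ≡ eval bs (e ⊖ f)
  ⊖ˢ-eval e f with constant? e | constant? f
  ... | just (true  , refl) | just (true  , refl) = refl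
  ... | just (true  , refl) | just (false , refl) = refl
  ... | just (true  , refl) | nothing             = refl
  ... | nothing             | just (true  , refl) = refl
  ... | nothing             | just (false , refl) = refl
  ... | nothing             | nothing             = refl
  ... | just (false , refl) | _ with eval bs f
  ...   | true  = refl
  ...   | false = refl

instantiate-eval : ∀ b bs e → eval bs (instantiate b e) ≡ eval (b ∷ bs) e
instantiate-eval b bs (var zero)    = refl
instantiate-eval b bs (var (suc i)) = refl
instantiate-eval b bs (const c)     = refl
instantiate-eval b bs (e ⊔ f) = trans (⊔ˢ-eval bs (instantiate b e) _)
  (cong₂ _∨_ (instantiate-eval b bs e) (instantiate-eval b bs f))
instantiate-eval b bs (e ⊓ f) = trans (⊓ˢ-eval bs (instantiate b e) _)
  (cong₂ _∧_ (instantiate-eval b bs e) (instantiate-eval b bs f))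
instantiate-eval b bs (e ⊖ f) = trans (⊖ˢ-eval bs (instantiate b e) _)
  (cong₂ diff (instantiate-eval b bs e) (instantiate-eval b bs f))

-- Only a literal `const true` counts. A cell without points may therefore survive, but no cell that
-- contains a point is dropped, and this is the direction that soundness needs.
violated : List Expr → Bool
violated []               = false
violated (const true ∷ _) = true
violated (_ ∷ es)         = violated es

cells : ℕ → List Expr → List (List Bool)
cells zero    es = if violated es then [] else [] ∷ []
cells (suc k) es = if violated es then [] else
  map (true  ∷_) (cells k (map (instantiate true) es)) ++
  map (false ∷_) (cells k (map (instantiate false) es))

AllFalse : List Bool → List Expr → Set
AllFalse bs = All (λ e → eval bs e ≡ false)

violated-sound : ∀ {bs} es → AllFalse bs es → violated es ≡ false
violated-sound []                 []         = refl
violated-sound (const false ∷ es) (_ ∷ hs)   = violated-sound es hs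
violated-sound (const true  ∷ es) (() ∷ _)
violated-sound (var _ ∷ es)       (_ ∷ hs)   = violated-sound es hs
violated-sound ((_ ⊔ _) ∷ es)     (_ ∷ hs)   = violated-sound es hs
violated-sound ((_ ⊓ _) ∷ es)     (_ ∷ hs)   = violated-sound es hs
violated-sound ((_ ⊖ _) ∷ es)     (_ ∷ hs)   = violated-sound es hs

AllFalse-instantiate : ∀ b bs es → AllFalse (b ∷ bs) es → AllFalse bs (map (instantiate b) es)
AllFalse-instantiate b bs []       []       = []
AllFalse-instantiate b bs (e ∷ es) (h ∷ hs) =
  trans (instantiate-eval b bs e) h ∷ AllFalse-instantiate b bs es hs

cells-complete : ∀ bs es → AllFalse bs es → bs ∈ˡ cells (length bs) es
cells-complete [] es hs rewrite violated-sound es hs = here refl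
cells-complete (true ∷ bs) es hs rewrite violated-sound es hs =
  ∈-++⁺ˡ (∈-map⁺ (true ∷_) (cells-complete bs _ (AllFalse-instantiate true bs es hs)))
cells-complete (false ∷ bs) es hs rewrite violated-sound es hs =
  ∈-++⁺ʳ _ (∈-map⁺ (false ∷_) (cells-complete bs _ (AllFalse-instantiate false bs es hs)))

_≤ᶜ_ : List Bool → List Bool → Bool
[]           ≤ᶜ cs           = true
(b ∷ bs)     ≤ᶜ []           = false
(false ∷ bs) ≤ᶜ (c ∷ cs)     = bs ≤ᶜ cs
(true ∷ bs)  ≤ᶜ (true ∷ cs)  = bs ≤ᶜ cs
(true ∷ bs)  ≤ᶜ (false ∷ cs) = false

column : List (List Bool) → Expr → List Bool
column css e = map (λ bs → eval bs e) css

≤ᶜ-sound : ∀ css e f → T (column css e ≤ᶜ column css f) →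
           ∀ {bs} → bs ∈ˡ css → eval bs e ≡ true → eval bs f ≡ true
≤ᶜ-sound (bs ∷ css) e f ok bs∈ e≡ with eval bs e in p | eval bs f in q
≤ᶜ-sound (bs ∷ css) e f ok (here refl) e≡ | true  | true  = q
≤ᶜ-sound (bs ∷ css) e f ok (here refl) e≡ | false | _     with () ← trans (sym p) e≡
≤ᶜ-sound (bs ∷ css) e f ok (there bs∈) e≡ | true  | true  = ≤ᶜ-sound css e f ok bs∈ e≡
≤ᶜ-sound (bs ∷ css) e f ok (there bs∈) e≡ | false | true  = ≤ᶜ-sound css e f ok bs∈ e≡
≤ᶜ-sound (bs ∷ css) e f ok (there bs∈) e≡ | false | false = ≤ᶜ-sound css e f ok bs∈ e≡

infixr 9 ρ_ #_
infixr 8 _⊕_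
infix  6 _≼_ _⊑_

data Lin : Set where
  ρ_  : Expr → Lin
  #_  : ℕ → Lin
  _⊕_ : Lin → Lin → Lin

data Ineq : Set where
  _≼_ : Lin → Lin → Ineq

data SetIneq : Set where
  _⊑_ : Expr → Expr → SetIneq

Flat : Set
Flat = List Expr × ℕ

infixr 5 _+ᶠ_

_+ᶠ_ : Flat → Flat → Flat
(es , a) +ᶠ (fs , b) = es ++ fs , a + b

flat : Lin → Flat
flat (ρ e)   = e ∷ [] , 0
flat (# a)   = [] , a
flat (l ⊕ k) = flat l +ᶠ flat k

excess : SetIneq → Expr
excess (e ⊑ f) = e ⊖ f

left right : List Ineq → Flat
left  []             = [] , 0
left  (l ≼ _ ∷ is)   = flat l +ᶠ left is
right []             = [] , 0
right (_ ≼ k ∷ is)   = flat k +ᶠ right is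

Col : Set
Col = Expr × List Bool

remove : (List Bool → Bool) → List Col → Maybe (List Col)
remove p [] = nothing
remove p ((f , c) ∷ fs) with p c
... | true  = just fs
... | false with remove p fs
...   | just gs = just ((f , c) ∷ gs)
...   | nothing = nothing

empty : List Bool → Bool
empty []           = true
empty (true ∷ bs)  = false
empty (false ∷ bs) = empty bs

_≡ᶜ_ : List Bool → List Bool → Bool
bs ≡ᶜ cs = (bs ≤ᶜ cs) ∧ (cs ≤ᶜ bs)

-- Removing equal columns first shortens the backtracking in `match`. By an exchange no matching is
-- lost: whatever was matched to the removed right-hand set can take over the partner of the removed
-- left-hand set.
cancel : List Col → List Col → List Col × List Col
cancel []             fs = [] , fs
cancel ((e , c) ∷ es) fs with remove (c ≡ᶜ_) fs
... | just gs = cancel es gs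
... | nothing with cancel es fs
...   | es₁ , fs₁ = (e , c) ∷ es₁ , fs₁

match : List Col → List Col → Bool
try   : List Bool → List Col → List Col → List Col → Bool
match []             fs = true
-- A set that the hypotheses force to be empty has rank 0 and needs no partner.
match ((e , c) ∷ es) fs = if empty c then match es fs else try c es [] fs
try c es gs []             = false
try c es gs ((f , d) ∷ fs) =
  if (c ≤ᶜ d) ∧ match es (gs ++ fs) then true else try c es ((f , d) ∷ gs) fs

columns : List (List Bool) → List Expr → List Col
columns css = map (λ e → e , column css e)

dominates : ℕ → List SetIneq → Flat → Flat → Bool
dominates k hs (es , a) (fs , b) with cells k (map excess hs)
... | css with cancel (columns css es) (columns css fs)
...   | es₁ , fs₁ = (a ≤ᵇ b) ∧ match es₁ fs₁

-- The given inequalities change sides: if `l` plus all their right sides is at most `r` plus all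
-- their left sides, then their right sides cancel. Each given inequality is used once, with
-- coefficient one.
check : ℕ → List SetIneq → List Ineq → Ineq → Bool
check k hs is (l ≼ r) = dominates k hs (flat l +ᶠ right is) (flat r +ᶠ left is)

includes : ℕ → List SetIneq → SetIneq → Bool
includes k hs (e ⊑ f) with cells k (map excess hs)
... | css = column css e ≤ᶜ column css f

-- Soundness of the procedure for an arbitrary submodular rank function

record RankFunction (m : ℕ) : Set where
  field
    rank      : Subset m → ℕ
    rank-⊥    : rank ⊥ ≡ 0
    rank-mono : ∀ X Y → X ⊆ Y → rank X ≤ rank Y
    rank-sub  : ∀ X Y → rank (X ∪ Y) + rank (X ∩ Y) ≤ rank X + rank Y

module Reasoning {m} (R : RankFunction m) (env : List (Subset m)) where
  open RankFunction R

  nth : List (Subset m) → ℕ → Subset m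
  nth []       i       = ⊥
  nth (X ∷ Xs) zero    = X
  nth (X ∷ Xs) (suc i) = nth Xs i

  ⟦_⟧ : Expr → Subset m
  ⟦ var i ⟧       = nth env i
  ⟦ const true ⟧  = ⊤
  ⟦ const false ⟧ = ⊥
  ⟦ e ⊔ f ⟧       = ⟦ e ⟧ ∪ ⟦ f ⟧
  ⟦ e ⊓ f ⟧       = ⟦ e ⟧ ∩ ⟦ f ⟧
  ⟦ e ⊖ f ⟧       = ⟦ e ⟧ ─ ⟦ f ⟧

  ⟦_⟧ˡ : Lin → ℕ
  ⟦ ρ e ⟧ˡ   = rank ⟦ e ⟧
  ⟦ # a ⟧ˡ   = a
  ⟦ l ⊕ k ⟧ˡ = ⟦ l ⟧ˡ + ⟦ k ⟧ˡ

  Holds : Ineq → Set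
  Holds (l ≼ k) = ⟦ l ⟧ˡ ≤ ⟦ k ⟧ˡ

  Included : SetIneq → Set
  Included (e ⊑ f) = ⟦ e ⟧ ⊆ ⟦ f ⟧

  infix  3 ⊢_ ⊨_
  infixr 5 _∷_

  -- `Holds i` computes to an inequality of numbers, from which `i` cannot be recovered by
  -- unification. The index of a record can, so lists of facts determine their own syntax.
  record ⊢_ (i : Ineq) : Set where
    constructor rank-fact
    field holds : Holds i
  open ⊢_ public

  record ⊨_ (h : SetIneq) : Set where
    constructor set-fact
    field included : Included h
  open ⊨_ public

  data Facts : List Ineq → Set where
    []  : Facts []
    _∷_ : ∀ {i is} → ⊢ i → Facts is → Facts (i ∷ is)

  data SetFacts : List SetIneq → Set where
    []  : SetFacts []
    _∷_ : ∀ {h hs} → ⊨ h → SetFacts hs → SetFacts (h ∷ hs)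

  private
    bits : Fin m → List Bool
    bits p = map (λ X → lookup X p) env

    at-bits : ∀ p Xs i → lookup (nth Xs i) p ≡ at (map (λ X → lookup X p) Xs) i
    at-bits p []       i       = lookup-replicate p false
    at-bits p (X ∷ Xs) zero    = refl
    at-bits p (X ∷ Xs) (suc i) = at-bits p Xs i

    ∪-at : ∀ (X Y : Subset m) p → lookup (X ∪ Y) p ≡ lookup X p ∨ lookup Y p
    ∪-at X Y p = lookup-zipWith _∨_ p X Y

    ─-at : ∀ {n} (X Y : Subset n) p → lookup (X ─ Y) p ≡ diff (lookup X p) (lookup Y p)
    ─-at (x ∷ X) (true ∷ Y)  Fin.zero    = refl
    ─-at (x ∷ X) (false ∷ Y) Fin.zero    = refl
    ─-at (x ∷ X) (y ∷ Y)     (Fin.suc p) = ─-at X Y p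

    eval-bits : ∀ p e → lookup ⟦ e ⟧ p ≡ eval (bits p) e
    eval-bits p (var i)       = at-bits p env i
    eval-bits p (const true)  = lookup-replicate p true
    eval-bits p (const false) = lookup-replicate p false
    eval-bits p (e ⊔ f) = trans (∪-at ⟦ e ⟧ ⟦ f ⟧ p) (cong₂ _∨_ (eval-bits p e) (eval-bits p f))
    eval-bits p (e ⊓ f) = trans (lookup-zipWith _∧_ p ⟦ e ⟧ ⟦ f ⟧)
                                (cong₂ _∧_ (eval-bits p e) (eval-bits p f))
    eval-bits p (e ⊖ f) = trans (─-at ⟦ e ⟧ ⟦ f ⟧ p) (cong₂ diff (eval-bits p e) (eval-bits p f))

    excess-false : ∀ p {hs} → SetFacts hs → AllFalse (bits p) (map excess hs)
    excess-false p [] = []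
    excess-false p (_∷_ {h = e ⊑ f} h hs) = go ∷ excess-false p hs
      where
      go : eval (bits p) (e ⊖ f) ≡ false
      go with eval (bits p) f in q | eval (bits p) e in r
      ... | true  | _     = refl
      ... | false | false = refl
      ... | false | true
        with () ← trans (sym q) (trans (sym (eval-bits p f))
                    ([]=⇒lookup (included h (lookup⇒[]= p _ (trans (eval-bits p e) r)))))

    allCells : List SetIneq → List (List Bool)
    allCells hs = cells (length env) (map excess hs)

    bits∈cells : ∀ p {hs} → SetFacts hs → bits p ∈ˡ allCells hs
    bits∈cells p {hs} Hs = subst (λ k → bits p ∈ˡ cells k (map excess hs)) (length-map env)
      (cells-complete (bits p) _ (excess-false p Hs))
      where
      length-map : ∀ Xs → length (map (λ X → lookup X p) Xs) ≡ length Xs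
      length-map []       = refl
      length-map (X ∷ Xs) = cong suc (length-map Xs)

    ≤ᶜ⇒⊆ : ∀ {hs} → SetFacts hs → ∀ e f →
           T (column (allCells hs) e ≤ᶜ column (allCells hs) f) → ⟦ e ⟧ ⊆ ⟦ f ⟧
    ≤ᶜ⇒⊆ Hs e f ok {p} p∈ = lookup⇒[]= p _ (trans (eval-bits p f)
      (≤ᶜ-sound _ e f ok (bits∈cells p Hs) (trans (sym (eval-bits p e)) ([]=⇒lookup p∈))))

  by-sets : ∀ {hs} → SetFacts hs → ∀ {h} → {T (includes (length env) hs h)} → ⊨ h
  by-sets Hs {e ⊑ f} {ok} = set-fact (≤ᶜ⇒⊆ Hs e f ok)

  private
    sum : List Expr → ℕ
    sum []       = 0
    sum (e ∷ es) = rank ⟦ e ⟧ + sum es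

    value : Flat → ℕ
    value (es , a) = sum es + a

    sum-++ : ∀ es fs → sum (es ++ fs) ≡ sum es + sum fs
    sum-++ []       fs = refl
    sum-++ (e ∷ es) fs = trans (cong (rank ⟦ e ⟧ +_) (sum-++ es fs)) (sym (ℕ.+-assoc (rank ⟦ e ⟧) _ _))

    value-+ : ∀ a b → value (a +ᶠ b) ≡ value a + value b
    value-+ (es , a) (fs , b) = trans (cong (_+ (a + b)) (sum-++ es fs)) (+-interchange (sum es) _ _ _)

    value-flat : ∀ l → value (flat l) ≡ ⟦ l ⟧ˡ
    value-flat (ρ e)   = trans (ℕ.+-identityʳ _) (ℕ.+-identityʳ _)
    value-flat (# a)   = refl
    value-flat (l ⊕ k) = trans (value-+ (flat l) (flat k)) (cong₂ _+_ (value-flat l) (value-flat k))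

    facts-sound : ∀ {is} → Facts is → value (left is) ≤ value (right is)
    facts-sound []       = z≤n
    facts-sound (_∷_ {i = l ≼ k} {is} i is′)
      rewrite value-+ (flat l) (left is) | value-+ (flat k) (right is)
            | value-flat l | value-flat k = ℕ.+-mono-≤ (holds i) (facts-sound is′)

    sumᶜ : List Col → ℕ
    sumᶜ []             = 0
    sumᶜ ((e , _) ∷ es) = rank ⟦ e ⟧ + sumᶜ es

    sumᶜ-columns : ∀ css es → sumᶜ (columns css es) ≡ sum es
    sumᶜ-columns css []       = refl
    sumᶜ-columns css (e ∷ es) = cong (rank ⟦ e ⟧ +_) (sumᶜ-columns css es)

    sumᶜ-++ : ∀ es fs → sumᶜ (es ++ fs) ≡ sumᶜ es + sumᶜ fs
    sumᶜ-++ []             fs = refl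
    sumᶜ-++ ((e , _) ∷ es) fs =
      trans (cong (rank ⟦ e ⟧ +_) (sumᶜ-++ es fs)) (sym (ℕ.+-assoc (rank ⟦ e ⟧) _ _))

    module _ {hs} (Hs : SetFacts hs) where

      css : List (List Bool)
      css = allCells hs

      Valid : List Col → Set
      Valid = All λ (e , c) → c ≡ column css e

      valid-columns : ∀ es → Valid (columns css es)
      valid-columns []       = []
      valid-columns (e ∷ es) = refl ∷ valid-columns es

      valid-++ : ∀ {es fs} → Valid es → Valid fs → Valid (es ++ fs)
      valid-++ []       w = w
      valid-++ (x ∷ v) w = x ∷ valid-++ v w

      ∧-left : ∀ {a b} → T (a ∧ b) → T a
      ∧-left {true} _ = tt

      ∧-right : ∀ {a b} → T (a ∧ b) → T b
      ∧-right {true} t = t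

      remove-sound : ∀ {e c} → c ≡ column css e → ∀ fs → Valid fs → ∀ {gs} →
        remove (c ≡ᶜ_) fs ≡ just gs → Valid gs × rank ⟦ e ⟧ + sumᶜ gs ≤ sumᶜ fs
      remove-sound {e} {c} refl ((f , d) ∷ fs) (refl ∷ v) eq with c ≡ᶜ d in same
      remove-sound {e} {c} refl ((f , d) ∷ fs) (refl ∷ v) refl | true =
        v , ℕ.+-monoˡ-≤ (sumᶜ fs) (rank-mono _ _ (≤ᶜ⇒⊆ Hs e f (∧-left (subst T (sym same) tt))))
      ... | false with remove (c ≡ᶜ_) fs in more
      remove-sound {e} {c} refl ((f , d) ∷ fs) (refl ∷ v) refl | false | just gs
        with remove-sound {e} refl fs v more
      ... | w , h = refl ∷ w , ℕ.≤-trans (ℕ.≤-reflexive (+-exchange (rank ⟦ e ⟧) (rank ⟦ f ⟧) (sumᶜ gs)))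
                                         (ℕ.+-monoʳ-≤ (rank ⟦ f ⟧) h)

      -- The remainder `fs₁` is added on the left so that no ranks are subtracted. A cancelled pair
      -- contributes only rank e ≤ rank f, by inclusion.
      cancel-sound : ∀ es fs → Valid es → Valid fs → let (es₁ , fs₁) = cancel es fs in
        Valid es₁ × Valid fs₁ × sumᶜ es + sumᶜ fs₁ ≤ sumᶜ es₁ + sumᶜ fs
      cancel-sound [] fs v w = v , w , ℕ.≤-refl
      cancel-sound ((e , c) ∷ es) fs (x ∷ v) w with remove (c ≡ᶜ_) fs in eq
      ... | just gs with remove-sound {e} x fs w eq
      ...   | w₁ , h₁ with cancel es gs | cancel-sound es gs v w₁
      ...     | es₁ , fs₁ | v₂ , w₂ , h₂ = v₂ , w₂ , (begin
        rank ⟦ e ⟧ + sumᶜ es + sumᶜ fs₁    ≡⟨ ℕ.+-assoc (rank ⟦ e ⟧) _ _ ⟩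
        rank ⟦ e ⟧ + (sumᶜ es + sumᶜ fs₁)  ≤⟨ ℕ.+-monoʳ-≤ (rank ⟦ e ⟧) h₂ ⟩
        rank ⟦ e ⟧ + (sumᶜ es₁ + sumᶜ gs)  ≡⟨ +-exchange (rank ⟦ e ⟧) (sumᶜ es₁) _ ⟩
        sumᶜ es₁ + (rank ⟦ e ⟧ + sumᶜ gs)  ≤⟨ ℕ.+-monoʳ-≤ (sumᶜ es₁) h₁ ⟩
        sumᶜ es₁ + sumᶜ fs                 ∎)
        where open ℕ.≤-Reasoning
      cancel-sound ((e , c) ∷ es) fs (x ∷ v) w | nothing with cancel es fs | cancel-sound es fs v w
      ... | es₁ , fs₁ | v₂ , w₂ , h₂ = x ∷ v₂ , w₂ , (begin
        rank ⟦ e ⟧ + sumᶜ es + sumᶜ fs₁    ≡⟨ ℕ.+-assoc (rank ⟦ e ⟧) _ _ ⟩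
        rank ⟦ e ⟧ + (sumᶜ es + sumᶜ fs₁)  ≤⟨ ℕ.+-monoʳ-≤ (rank ⟦ e ⟧) h₂ ⟩
        rank ⟦ e ⟧ + (sumᶜ es₁ + sumᶜ fs)  ≡⟨ sym (ℕ.+-assoc (rank ⟦ e ⟧) _ _) ⟩
        rank ⟦ e ⟧ + sumᶜ es₁ + sumᶜ fs    ∎)
        where open ℕ.≤-Reasoning

      empty-sound : ∀ e css → T (empty (column css e)) → ∀ {bs} → bs ∈ˡ css → eval bs e ≡ false
      empty-sound e (bs ∷ css) ok bs∈ with eval bs e in p
      empty-sound e (bs ∷ css) ok (here refl) | false = p
      empty-sound e (bs ∷ css) ok (there bs∈) | false = empty-sound e css ok bs∈

      rank-empty : ∀ e → T (empty (column css e)) → rank ⟦ e ⟧ ≤ 0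
      rank-empty e ok = ℕ.≤-trans (rank-mono ⟦ e ⟧ ⊥ none) (ℕ.≤-reflexive rank-⊥)
        where
        none : ⟦ e ⟧ ⊆ ⊥
        none {p} p∈ with () ← trans (sym (empty-sound e css ok (bits∈cells p Hs)))
                                    (trans (sym (eval-bits p e)) ([]=⇒lookup p∈))

      match-sound : ∀ es fs → Valid es → Valid fs → T (match es fs) → sumᶜ es ≤ sumᶜ fs
      try-sound : ∀ {e c} → c ≡ column css e → ∀ es gs fs → Valid es → Valid gs → Valid fs →
        T (try c es gs fs) → rank ⟦ e ⟧ + sumᶜ es ≤ sumᶜ gs + sumᶜ fs
      match-sound [] fs v w ok = z≤n
      match-sound ((e , c) ∷ es) fs (refl ∷ v) w ok with empty c in none
      ... | true  = ℕ.+-mono-≤ (rank-empty e (subst T (sym none) tt)) (match-sound es fs v w ok)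
      ... | false = try-sound {e} refl es [] fs v [] w ok
      try-sound {e} {c} refl es gs ((f , d) ∷ fs) v u (refl ∷ w) ok
        with (c ≤ᶜ d) ∧ match es (gs ++ fs) in found
      ... | true = begin
        rank ⟦ e ⟧ + sumᶜ es                ≤⟨ ℕ.+-mono-≤ (rank-mono _ _ (≤ᶜ⇒⊆ Hs e f (∧-left both)))
                                                (match-sound es (gs ++ fs) v (valid-++ u w) (∧-right {c ≤ᶜ d} both)) ⟩
        rank ⟦ f ⟧ + sumᶜ (gs ++ fs)        ≡⟨ cong (rank ⟦ f ⟧ +_) (sumᶜ-++ gs fs) ⟩
        rank ⟦ f ⟧ + (sumᶜ gs + sumᶜ fs)    ≡⟨ +-exchange (rank ⟦ f ⟧) (sumᶜ gs) _ ⟩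
        sumᶜ gs + (rank ⟦ f ⟧ + sumᶜ fs)    ∎
        where
        open ℕ.≤-Reasoning
        both : T ((c ≤ᶜ d) ∧ match es (gs ++ fs))
        both = subst T (sym found) tt
      ... | false = ℕ.≤-trans (try-sound {e} refl es ((f , d) ∷ gs) fs v (refl ∷ u) w ok)
        (ℕ.≤-reflexive (trans (ℕ.+-assoc (rank ⟦ f ⟧) _ _) (+-exchange (rank ⟦ f ⟧) (sumᶜ gs) _)))

      dominates-sound : ∀ p q → T (dominates (length env) hs p q) → value p ≤ value q
      dominates-sound (es , a) (fs , b) ok
        with cancel (columns css es) (columns css fs)
           | cancel-sound (columns css es) (columns css fs) (valid-columns es) (valid-columns fs)
      ... | es₁ , fs₁ | v , w , h =
        ℕ.+-mono-≤ (ℕ.+-cancelʳ-≤ (sumᶜ fs₁) _ _ es≤fs) (ℕ.≤ᵇ⇒≤ a b (∧-left ok))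
        where
        open ℕ.≤-Reasoning
        es≤fs : sum es + sumᶜ fs₁ ≤ sum fs + sumᶜ fs₁
        es≤fs = begin
          sum es + sumᶜ fs₁                 ≡⟨ cong (_+ sumᶜ fs₁) (sym (sumᶜ-columns css es)) ⟩
          sumᶜ (columns css es) + sumᶜ fs₁  ≤⟨ h ⟩
          sumᶜ es₁ + sumᶜ (columns css fs)  ≤⟨ ℕ.+-monoˡ-≤ _ (match-sound es₁ fs₁ v w (∧-right {a ≤ᵇ b} ok)) ⟩
          sumᶜ fs₁ + sumᶜ (columns css fs)  ≡⟨ cong (sumᶜ fs₁ +_) (sumᶜ-columns css fs) ⟩
          sumᶜ fs₁ + sum fs                 ≡⟨ ℕ.+-comm (sumᶜ fs₁) _ ⟩
          sum fs + sumᶜ fs₁                 ∎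

      check-sound : ∀ is l k → Facts is → T (check (length env) hs is (l ≼ k)) → ⟦ l ⟧ˡ ≤ ⟦ k ⟧ˡ
      check-sound is l k Is ok = ℕ.+-cancelʳ-≤ (value (right is)) _ _ (begin
        ⟦ l ⟧ˡ + value (right is)          ≡⟨ cong (_+ value (right is)) (sym (value-flat l)) ⟩
        value (flat l) + value (right is)  ≡⟨ sym (value-+ (flat l) (right is)) ⟩
        value (flat l +ᶠ right is)         ≤⟨ dominates-sound (flat l +ᶠ right is) (flat k +ᶠ left is) ok ⟩
        value (flat k +ᶠ left is)          ≡⟨ value-+ (flat k) (left is) ⟩
        value (flat k) + value (left is)   ≡⟨ cong (_+ value (left is)) (value-flat k) ⟩
        ⟦ k ⟧ˡ + value (left is)           ≤⟨ ℕ.+-monoʳ-≤ ⟦ k ⟧ˡ (facts-sound Is) ⟩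
        ⟦ k ⟧ˡ + value (right is)          ∎)
        where open ℕ.≤-Reasoning

  -- The last hidden argument reduces to the unit type exactly when the test succeeds, and is then
  -- filled in automatically.
  by-ranks : ∀ {hs is} → SetFacts hs → Facts is →
             ∀ {i} → {T (check (length env) hs is i)} → ⊢ i
  by-ranks Hs Is {l ≼ k} {ok} = rank-fact (check-sound Hs _ l k Is ok)

  sub : ∀ e f → ⊢ ρ (e ⊔ f) ⊕ ρ (e ⊓ f) ≼ ρ e ⊕ ρ f
  sub e f = rank-fact (rank-sub ⟦ e ⟧ ⟦ f ⟧)

  absurd : ∀ {hs is} {A : Set} → SetFacts hs → Facts is →
           {T (check (length env) hs is (# 1 ≼ # 0))} → A
  absurd Hs Is {ok} with () ← holds (by-ranks Hs Is {# 1 ≼ # 0} {ok})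

  compare : ∀ l k → (⊢ l ≼ k) ⊎ (⊢ k ⊕ # 1 ≼ l)
  compare l k with ℕ.≤-<-connex ⟦ l ⟧ˡ ⟦ k ⟧ˡ
  ... | inj₁ l≤k = inj₁ (rank-fact l≤k)
  ... | inj₂ k<l = inj₂ (rank-fact (ℕ.≤-trans (ℕ.≤-reflexive (ℕ.+-comm ⟦ k ⟧ˡ 1)) k<l))

  fact : ∀ i → Holds i → ⊢ i
  fact i = rank-fact

  incl : ∀ h → Included h → ⊨ h
  incl h p = set-fact p

  infixr 5 _++ˢ_

  _++ˢ_ : ∀ {hs ks} → SetFacts hs → SetFacts ks → SetFacts (hs ++ ks)
  []       ++ˢ Ks = Ks
  (h ∷ Hs) ++ˢ Ks = h ∷ (Hs ++ˢ Ks)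

-- Vertical 3-partitions

-- The rank consequences of 3-connectivity for a matroid with at least four elements.  The sets X and Y may overlap.

record ThreeConnected (m : ℕ) : Set where
  field
    ground       : Subset m
    rank-fun     : RankFunction m
  open RankFunction rank-fun public
  field
    rank-single  : ∀ x → rank ⁅ x ⁆ ≤ 1
    rank-nonloop : ∀ {x} → x ∈ ground → 1 ≤ rank ⁅ x ⁆
    rank-pair    : ∀ {x y} → x ∈ ground → y ∈ ground → x ≢ y → 2 ≤ rank (⁅ x ⁆ ∪ ⁅ y ⁆)
    connected₁   : ∀ X Y → ground ⊆ X ∪ Y → rank Y ≤ 1 → rank ground ≤ rank X
    connected₂   : ∀ X Y → ground ⊆ X ∪ Y → 2 ≤ rank X → 2 ≤ rank Y → rank ground + 2 ≤ rank X + rank Y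

module _ {m} (M : ThreeConnected m) where
  open ThreeConnected M

  -- The middle part x of a vertical 3-partition (X, x, Y) is a set here, a singleton in every use.

  record Vertical (x X Y : Subset m) : Set where
    field
      X⊆E    : X ⊆ ground
      Y⊆E    : Y ⊆ ground
      x⊆E    : x ⊆ ground
      cover  : ground ⊆ X ∪ Y ∪ x
      X∩Y    : X ∩ Y ⊆ ⊥
      X∩x    : X ∩ x ⊆ ⊥
      Y∩x    : Y ∩ x ⊆ ⊥
      3≤X    : 3 ≤ rank X
      3≤Y    : 3 ≤ rank Y
      X+Y    : rank X + rank Y ≤ rank ground + 2
      x∈clX  : rank (X ∪ x) ≤ rank X
      x∈clY  : rank (Y ∪ x) ≤ rank Y

  module Reasoning₃ (env : List (Subset m)) where
    open Reasoning rank-fun (ground ∷ env) public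

    𝐄 ∅ : Expr
    𝐄 = var 0
    ∅ = const false

    connect₁ : ∀ {hs} → SetFacts hs → ∀ e f → {T (includes (suc (length env)) hs (𝐄 ⊑ e ⊔ f))} →
               ⊢ ρ f ≼ # 1 → ⊢ ρ 𝐄 ≼ ρ e
    connect₁ Hs e f {ok} h =
      rank-fact (connected₁ _ _ (included (by-sets Hs {𝐄 ⊑ e ⊔ f} {ok})) (holds h))

    connect₂ : ∀ {hs} → SetFacts hs → ∀ e f → {T (includes (suc (length env)) hs (𝐄 ⊑ e ⊔ f))} →
               ⊢ # 2 ≼ ρ e → ⊢ # 2 ≼ ρ f → ⊢ ρ 𝐄 ⊕ # 2 ≼ ρ e ⊕ ρ f
    connect₂ Hs e f {ok} h k =
      rank-fact (connected₂ _ _ (included (by-sets Hs {𝐄 ⊑ e ⊔ f} {ok})) (holds h) (holds k))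

    module VerticalFacts x X Y (v : Vertical ⟦ x ⟧ ⟦ X ⟧ ⟦ Y ⟧) where
      private module V = Vertical v

      sets : SetFacts (X ⊑ 𝐄 ∷ Y ⊑ 𝐄 ∷ x ⊑ 𝐄 ∷ 𝐄 ⊑ X ⊔ Y ⊔ x ∷
                       X ⊓ Y ⊑ ∅ ∷ X ⊓ x ⊑ ∅ ∷ Y ⊓ x ⊑ ∅ ∷ [])
      sets = set-fact V.X⊆E ∷ set-fact V.Y⊆E ∷ set-fact V.x⊆E ∷ set-fact V.cover ∷
             set-fact V.X∩Y ∷ set-fact V.X∩x ∷ set-fact V.Y∩x ∷ []

      3≤X : ⊢ # 3 ≼ ρ X
      3≤X = rank-fact V.3≤X

      3≤Y : ⊢ # 3 ≼ ρ Y
      3≤Y = rank-fact V.3≤Y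

      X+Y : ⊢ ρ X ⊕ ρ Y ≼ ρ 𝐄 ⊕ # 2
      X+Y = rank-fact V.X+Y

      x∈clX : ⊢ ρ X ⊔ x ≼ ρ X
      x∈clX = rank-fact V.x∈clX

      x∈clY : ⊢ ρ Y ⊔ x ≼ ρ Y
      x∈clY = rank-fact V.x∈clY

  swap : ∀ {x X Y} → Vertical x X Y → Vertical x Y X
  swap {x} {X} {Y} v = record
    { X⊆E = V.Y⊆E ; Y⊆E = V.X⊆E ; x⊆E = V.x⊆E
    ; cover = included (by-sets F.sets {𝐄 ⊑ 𝐘 ⊔ 𝐗 ⊔ 𝐱})
    ; X∩Y = included (by-sets F.sets {𝐘 ⊓ 𝐗 ⊑ ∅})
    ; X∩x = V.Y∩x ; Y∩x = V.X∩x ; 3≤X = V.3≤Y ; 3≤Y = V.3≤X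
    ; X+Y = holds (by-ranks [] (F.X+Y ∷ []) {ρ 𝐘 ⊕ ρ 𝐗 ≼ ρ 𝐄 ⊕ # 2})
    ; x∈clX = V.x∈clY ; x∈clY = V.x∈clX }
    where
    open Reasoning₃ (x ∷ X ∷ Y ∷ [])
    𝐱 = var 1
    𝐗 = var 2
    𝐘 = var 3
    module V = Vertical v
    module F = VerticalFacts 𝐱 𝐗 𝐘 v

  -- That both sides span `x` comes for free. Comparing (X, Y ∪ x) with the bound on rank (X ∪ x) +
  -- rank (Y ∪ x), 3-connectivity leaves no room for `x` to raise the rank of `X`; the same holds
  -- for `Y`.
  vertical : ∀ {x X Y} → X ⊆ ground → Y ⊆ ground → x ⊆ ground → ground ⊆ X ∪ Y ∪ x →
    X ∩ Y ⊆ ⊥ → X ∩ x ⊆ ⊥ → Y ∩ x ⊆ ⊥ → rank x ≤ 1 →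
    3 ≤ rank (X ∪ x) → 3 ≤ rank (Y ∪ x) → rank (X ∪ x) + rank (Y ∪ x) ≤ rank ground + 2 →
    Vertical x X Y
  vertical {x} {X} {Y} X⊆E Y⊆E x⊆E cover X∩Y X∩x Y∩x x≤1 3≤Xx 3≤Yx sum = record
    { X⊆E = X⊆E ; Y⊆E = Y⊆E ; x⊆E = x⊆E ; cover = cover
    ; X∩Y = X∩Y ; X∩x = X∩x ; Y∩x = Y∩x
    ; 3≤X = holds (by-ranks [] (clX ∷ h₃ ∷ []) {# 3 ≼ ρ 𝐗})
    ; 3≤Y = holds (by-ranks [] (clY ∷ h₄ ∷ []) {# 3 ≼ ρ 𝐘})
    ; X+Y = holds (by-ranks [] (h₅ ∷ []) {ρ 𝐗 ⊕ ρ 𝐘 ≼ ρ 𝐄 ⊕ # 2})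
    ; x∈clX = holds clX ; x∈clY = holds clY }
    where
    open Reasoning₃ (x ∷ X ∷ Y ∷ [])
    𝐱 = var 1
    𝐗 = var 2
    𝐘 = var 3
    H : SetFacts _
    H = incl (𝐄 ⊑ 𝐗 ⊔ 𝐘 ⊔ 𝐱) cover ∷ []
    h₁ = fact (ρ 𝐱 ≼ # 1) x≤1
    h₃ = fact (# 3 ≼ ρ 𝐗 ⊔ 𝐱) 3≤Xx
    h₄ = fact (# 3 ≼ ρ 𝐘 ⊔ 𝐱) 3≤Yx
    h₅ = fact (ρ 𝐗 ⊔ 𝐱 ⊕ ρ 𝐘 ⊔ 𝐱 ≼ ρ 𝐄 ⊕ # 2) sum
    2≤X : ⊢ # 2 ≼ ρ 𝐗
    2≤X = by-ranks [] (h₁ ∷ h₃ ∷ sub 𝐗 𝐱 ∷ [])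
    2≤Y : ⊢ # 2 ≼ ρ 𝐘
    2≤Y = by-ranks [] (h₁ ∷ h₄ ∷ sub 𝐘 𝐱 ∷ [])
    clX : ⊢ ρ 𝐗 ⊔ 𝐱 ≼ ρ 𝐗
    clX = by-ranks [] (connect₂ H 𝐗 (𝐘 ⊔ 𝐱) 2≤X (by-ranks [] (h₄ ∷ [])) ∷ h₅ ∷ [])
    clY : ⊢ ρ 𝐘 ⊔ 𝐱 ≼ ρ 𝐘
    clY = by-ranks [] (connect₂ H (𝐗 ⊔ 𝐱) 𝐘 (by-ranks [] (h₃ ∷ [])) 2≤Y ∷ h₅ ∷ [])

module _ {n : ℕ} where

  ⁅⁆-⊆ : ∀ {x} {X : Subset n} → x ∈ X → ⁅ x ⁆ ⊆ X
  ⁅⁆-⊆ {x} {X} x∈X y∈ = subst (_∈ X) (sym (x∈⁅y⁆⇒x≡y x y∈)) x∈X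

  ⁅⁆-∉ : ∀ {x} {X : Subset n} → x ∉ X → ⁅ x ⁆ ∩ X ⊆ ⊥
  ⁅⁆-∉ {x} {X} x∉X y∈ with x∈p∩q⁻ ⁅ x ⁆ X y∈
  ... | y∈x , y∈X = ⊥-elim (x∉X (subst (_∈ X) (x∈⁅y⁆⇒x≡y x y∈x) y∈X))

  ∪-⊆ : {X Y Z : Subset n} → X ⊆ Z → Y ⊆ Z → X ∪ Y ⊆ Z
  ∪-⊆ {X} {Y} X⊆Z Y⊆Z z∈ with x∈p∪q⁻ X Y z∈
  ... | inj₁ z∈X = X⊆Z z∈X
  ... | inj₂ z∈Y = Y⊆Z z∈Y

  ⁅⁆-≢ : ∀ {x y : Fin n} → x ≢ y → ⁅ x ⁆ ∩ ⁅ y ⁆ ⊆ ⊥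
  ⁅⁆-≢ {x} {y} x≢y = ⁅⁆-∉ λ x∈ → x≢y (x∈⁅y⁆⇒x≡y y x∈)

-- Two vertical 3-partitions at points of one line

module _ {m} (M : ThreeConnected m) where
  open ThreeConnected M

  thin : ∀ {s S} → S ⊆ ground → s ∈ S → rank S ≤ 1 → S ⊆ ⁅ s ⁆
  thin {s} {S} S⊆E s∈S S≤1 {t} t∈S with t ≟ s
  ... | yes refl = x∈⁅x⁆ s
  ... | no  t≢s  = ⊥-elim (ℕ.<⇒≱ (ℕ.≤-trans (rank-pair (S⊆E t∈S) (S⊆E s∈S) t≢s)
                              (rank-mono _ S (∪-⊆ (⁅⁆-⊆ t∈S) (⁅⁆-⊆ s∈S)))) S≤1)

  -- X is the line L, with x replaced by b off the line.

  module Fan {x b : Fin m} {X Y L : Subset m} (vX : Vertical M ⁅ x ⁆ X Y)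
    (closed : ∀ {e} → e ∈ X → rank Y + 1 ≤ rank (Y ∪ ⁅ e ⁆))
    (L⊆Xx : L ⊆ X ∪ ⁅ x ⁆) (X⊆Lb : X ⊆ L ∪ ⁅ b ⁆) (x∈L : x ∈ L) (b∈X : b ∈ X) (b∉L : b ∉ L)
    (L≤2 : rank L ≤ 2) (2≤L : 2 ≤ rank L) where

    module Base (env : List (Subset m)) where
      open Reasoning₃ M (X ∷ Y ∷ L ∷ ⁅ x ⁆ ∷ ⁅ b ⁆ ∷ env) public
      𝐗 = var 1
      𝐘 = var 2
      𝐋 = var 3
      𝐱 = var 4
      𝐛 = var 5
      open VerticalFacts 𝐱 𝐗 𝐘 vX public

      fan : SetFacts _
      fan = incl (𝐋 ⊑ 𝐗 ⊔ 𝐱) L⊆Xx ∷ incl (𝐗 ⊑ 𝐋 ⊔ 𝐛) X⊆Lb ∷ incl (𝐱 ⊑ 𝐋) (⁅⁆-⊆ x∈L) ∷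
            incl (𝐛 ⊑ 𝐗) (⁅⁆-⊆ b∈X) ∷ incl (𝐛 ⊓ 𝐋 ⊑ ∅) (⁅⁆-∉ b∉L) ∷ sets

      line : ⊢ ρ 𝐋 ≼ # 2
      line = fact (ρ 𝐋 ≼ # 2) L≤2
      line₂ : ⊢ # 2 ≼ ρ 𝐋
      line₂ = fact (# 2 ≼ ρ 𝐋) 2≤L
      x≤1 : ⊢ ρ 𝐱 ≼ # 1
      x≤1 = fact (ρ 𝐱 ≼ # 1) (rank-single x)
      1≤x : ⊢ # 1 ≼ ρ 𝐱
      1≤x = fact (# 1 ≼ ρ 𝐱) (rank-nonloop (Vertical.x⊆E vX (x∈⁅x⁆ x)))
      b≤1 : ⊢ ρ 𝐛 ≼ # 1
      b≤1 = fact (ρ 𝐛 ≼ # 1) (rank-single b)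
      b∉clY : ⊢ ρ 𝐘 ⊕ # 1 ≼ ρ 𝐘 ⊔ 𝐛
      b∉clY = fact (ρ 𝐘 ⊕ # 1 ≼ ρ 𝐘 ⊔ 𝐛) (closed b∈X)

    X⊆E : X ⊆ ground
    X⊆E = Vertical.X⊆E vX
    x∈E : x ∈ ground
    x∈E = Vertical.x⊆E vX (x∈⁅x⁆ x)

    x∉X : x ∉ X
    x∉X x∈X = ∉⊥ (Vertical.X∩x vX (x∈p∩q⁺ (x∈X , x∈⁅x⁆ x)))


    L∖x⊆X : ∀ {e} → e ∈ L → e ≢ x → e ∈ X
    L∖x⊆X e∈L e≢x with x∈p∪q⁻ X ⁅ x ⁆ (L⊆Xx e∈L)
    ... | inj₁ e∈X = e∈X
    ... | inj₂ e∈x = ⊥-elim (e≢x (x∈⁅y⁆⇒x≡y x e∈x))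

    -- X has rank 3, so Y ∪ x is a hyperplane.
    hyperplane : rank ground ≤ rank Y + 1
    hyperplane = holds (by-ranks fan
      (connect₂ fan 𝐗 (𝐘 ⊔ 𝐱) (by-ranks [] (3≤X ∷ [])) (by-ranks fan (3≤Y ∷ [])) ∷
       x∈clY ∷ line ∷ b≤1 ∷ sub 𝐋 𝐛 ∷ []) {ρ 𝐄 ≼ ρ 𝐘 ⊕ # 1})
      where open Base []

    module _ {T t} (T⊆Y : T ⊆ Y) (t∈T : t ∈ T) where
      private
        open Base (T ∷ ⁅ t ⁆ ∷ [])
        𝐓 = var 6
        𝐭 = var 7
        𝐔 = (𝐘 ⊔ 𝐱) ⊖ 𝐓
        t∈E : t ∈ ground
        t∈E = Vertical.Y⊆E vX (T⊆Y t∈T)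
        t≢b : t ≢ b
        t≢b refl = ∉⊥ (Vertical.X∩Y vX (x∈p∩q⁺ (b∈X , T⊆Y t∈T)))
        tb : ⊢ # 2 ≼ ρ 𝐭 ⊔ 𝐛
        tb = fact (# 2 ≼ ρ 𝐭 ⊔ 𝐛) (rank-pair t∈E (X⊆E b∈X) t≢b)
        H : SetFacts _
        H = incl (𝐓 ⊑ 𝐘) T⊆Y ∷ incl (𝐭 ⊑ 𝐓) (⁅⁆-⊆ t∈T) ∷ fan

      -- The restriction of M to the hyperplane Y ∪ x is connected. A split into T and the rest U
      -- would extend to M with connectivity below two: since x ∈ U, adding X to U costs rank at
      -- most two. If T is a single element, `b` joins it to make a side of rank two, and only the
      -- line L is added to U.
      hyperplane-connected : rank Y + 1 ≤ rank T + rank ((Y ∪ ⁅ x ⁆) ─ T)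
      hyperplane-connected with compare (ρ 𝐘 ⊕ # 1) (ρ 𝐓 ⊕ ρ 𝐔) | compare (ρ 𝐓) (# 1)
      ... | inj₁ h | _ = holds h
      ... | inj₂ h | inj₂ 2≤T = absurd H
          (connect₂ H 𝐓 (𝐔 ⊔ 𝐗) (by-ranks [] (2≤T ∷ [])) (by-ranks H (3≤X ∷ [])) ∷
           h ∷ sub 𝐔 (𝐋 ⊔ 𝐛) ∷ sub 𝐋 𝐛 ∷ line ∷ b≤1 ∷ 1≤x ∷ X+Y ∷ 3≤X ∷ [])
      ... | inj₂ h | inj₁ T≤1 = absurd K
          (connect₂ K (𝐭 ⊔ 𝐛) (𝐔 ⊔ 𝐋) tb (by-ranks K (line₂ ∷ [])) ∷
           h ∷ sub 𝐔 𝐋 ∷ sub 𝐭 𝐛 ∷ line ∷ b≤1 ∷ 1≤x ∷ X+Y ∷ 3≤X ∷ [])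
        where
        K : SetFacts _
        K = incl (𝐓 ⊑ 𝐭) (thin (⊆-trans T⊆Y (Vertical.Y⊆E vX)) t∈T (holds T≤1)) ∷ H

    -- The normal form produced by `shift`. As X ⊆ L ∪ b, it fixes how the partition divides X ∪ x:
    -- all of L - l goes to `Z`, only `b` to `W`. What remains free is the trace on Y.
    record Side (l : Fin m) (Z W : Subset m) : Set where
      field
        side : Vertical M ⁅ l ⁆ Z W
        L⊆Zl : L ⊆ Z ∪ ⁅ l ⁆
        b∈W  : b ∈ W

    module _ {l k : Fin m} (l∈L : l ∈ L) (k∈L : k ∈ L) (l≢x : l ≢ x) (k≢x : k ≢ x) (l≢k : l ≢ k)
             {Z W : Subset m} (s : Side l Z W) where
      private
        open Base (Z ∷ W ∷ ⁅ l ⁆ ∷ ⁅ k ⁆ ∷ [])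
        𝐙 = var 6
        𝐖 = var 7
        𝐥 = var 8
        𝐤 = var 9
        module S = VerticalFacts 𝐥 𝐙 𝐖 (Side.side s)
        H : SetFacts _
        H = incl (𝐥 ⊑ 𝐋) (⁅⁆-⊆ l∈L) ∷ incl (𝐤 ⊑ 𝐋) (⁅⁆-⊆ k∈L) ∷ incl (𝐥 ⊓ 𝐱 ⊑ ∅) (⁅⁆-≢ l≢x) ∷
            incl (𝐤 ⊓ 𝐱 ⊑ ∅) (⁅⁆-≢ k≢x) ∷ incl (𝐥 ⊓ 𝐤 ⊑ ∅) (⁅⁆-≢ l≢k) ∷
            incl (𝐋 ⊑ 𝐙 ⊔ 𝐥) (Side.L⊆Zl s) ∷ incl (𝐛 ⊑ 𝐖) (⁅⁆-⊆ (Side.b∈W s)) ∷ fan ++ˢ S.sets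

        l∉clY : ⊢ ρ 𝐘 ⊕ # 1 ≼ ρ 𝐘 ⊔ 𝐥
        l∉clY = fact (ρ 𝐘 ⊕ # 1 ≼ ρ 𝐘 ⊔ 𝐥) (closed (L∖x⊆X l∈L l≢x))
        k∉clY : ⊢ ρ 𝐘 ⊕ # 1 ≼ ρ 𝐘 ⊔ 𝐤
        k∉clY = fact (ρ 𝐘 ⊕ # 1 ≼ ρ 𝐘 ⊔ 𝐤) (closed (L∖x⊆X k∈L k≢x))
        W≤ : ⊢ ρ 𝐖 ≼ ρ (𝐖 ⊓ 𝐘) ⊕ # 1
        W≤ = by-ranks H (sub (𝐖 ⊓ 𝐘) 𝐛 ∷ b≤1 ∷ [])

      -- The point k of L lies in Z but not in cl(Y), which contains (Z ∩ Y) ∪ x.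
      side-Z : rank ((Z ∩ Y) ∪ ⁅ x ⁆) + 1 ≤ rank Z
      side-Z = holds (by-ranks H (sub (𝐙 ⊓ 𝐘 ⊔ 𝐱 ⊔ 𝐤) (𝐘 ⊔ 𝐱) ∷ k∉clY ∷ x∈clY ∷ [])
                      {ρ 𝐙 ⊓ 𝐘 ⊔ 𝐱 ⊕ # 1 ≼ ρ 𝐙})

      side-W : rank (W ∩ Y) + 1 ≤ rank W
      side-W = holds (by-ranks H (sub (𝐖 ⊓ 𝐘 ⊔ 𝐛) 𝐘 ∷ b∉clY ∷ []) {ρ 𝐖 ⊓ 𝐘 ⊕ # 1 ≼ ρ 𝐖})

      side-W≤ : rank W ≤ rank (W ∩ Y) + 1
      side-W≤ = holds W≤

      -- Exchange over W ∩ Y: the set (W ∩ Y) ∪ b is all of W and spans `l`, and `l` is not in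
      -- cl(Y), so `l` and `b` span each other over W ∩ Y. The next lemma is the other direction.
      b∈cl : rank ((W ∩ Y) ∪ ⁅ l ⁆ ∪ ⁅ b ⁆) ≤ rank ((W ∩ Y) ∪ ⁅ l ⁆)
      b∈cl = holds (by-ranks H (sub (𝐖 ⊓ 𝐘 ⊔ 𝐥) 𝐘 ∷ l∉clY ∷ S.x∈clY ∷ W≤ ∷ [])
                    {ρ 𝐖 ⊓ 𝐘 ⊔ 𝐥 ⊔ 𝐛 ≼ ρ 𝐖 ⊓ 𝐘 ⊔ 𝐥})

      l∈cl : rank ((W ∩ Y) ∪ ⁅ l ⁆ ∪ ⁅ b ⁆) ≤ rank ((W ∩ Y) ∪ ⁅ b ⁆)
      l∈cl = holds (by-ranks H (sub (𝐖 ⊓ 𝐘 ⊔ 𝐛) 𝐘 ∷ b∉clY ∷ S.x∈clY ∷ W≤ ∷ [])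
                    {ρ 𝐖 ⊓ 𝐘 ⊔ 𝐥 ⊔ 𝐛 ≼ ρ 𝐖 ⊓ 𝐘 ⊔ 𝐛})

    module _ {c a : Fin m} (c∈L : c ∈ L) (a∈L : a ∈ L) (c≢x : c ≢ x) (a≢x : a ≢ x) (c≢a : c ≢ a)
             {Z W Z′ W′ : Subset m} (s : Side c Z W) (s′ : Side a Z′ W′) where
      private
        open Base (Z ∷ W ∷ Z′ ∷ W′ ∷ ⁅ c ⁆ ∷ ⁅ a ⁆ ∷ [])
        𝐙 = var 6
        𝐖 = var 7
        𝐙′ = var 8
        𝐖′ = var 9
        𝐜 = var 10
        𝐚 = var 11
        a≢c : a ≢ c
        a≢c a≡c = c≢a (sym a≡c)
        module S = VerticalFacts 𝐜 𝐙 𝐖 (Side.side s)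
        module S′ = VerticalFacts 𝐚 𝐙′ 𝐖′ (Side.side s′)
        H : SetFacts _
        H = incl (𝐜 ⊑ 𝐋) (⁅⁆-⊆ c∈L) ∷ incl (𝐚 ⊑ 𝐋) (⁅⁆-⊆ a∈L) ∷ incl (𝐜 ⊓ 𝐱 ⊑ ∅) (⁅⁆-≢ c≢x) ∷
            incl (𝐚 ⊓ 𝐱 ⊑ ∅) (⁅⁆-≢ a≢x) ∷ incl (𝐜 ⊓ 𝐚 ⊑ ∅) (⁅⁆-≢ c≢a) ∷
            incl (𝐋 ⊑ 𝐙 ⊔ 𝐜) (Side.L⊆Zl s) ∷ incl (𝐛 ⊑ 𝐖) (⁅⁆-⊆ (Side.b∈W s)) ∷
            incl (𝐋 ⊑ 𝐙′ ⊔ 𝐚) (Side.L⊆Zl s′) ∷ incl (𝐛 ⊑ 𝐖′) (⁅⁆-⊆ (Side.b∈W s′)) ∷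
            fan ++ˢ S.sets ++ˢ S′.sets
        ca : ⊢ # 2 ≼ ρ 𝐜 ⊔ 𝐚
        ca = fact (# 2 ≼ ρ 𝐜 ⊔ 𝐚) (rank-pair c∈E a∈E c≢a)
          where
          c∈E : c ∈ ground
          c∈E = Vertical.x⊆E (Side.side s) (x∈⁅x⁆ c)
          a∈E : a ∈ ground
          a∈E = Vertical.x⊆E (Side.side s′) (x∈⁅x⁆ a)
        ax : ⊢ # 2 ≼ ρ 𝐚 ⊔ 𝐱
        ax = fact (# 2 ≼ ρ 𝐚 ⊔ 𝐱) (rank-pair (Vertical.x⊆E (Side.side s′) (x∈⁅x⁆ a)) x∈E a≢x)
        Z≥ : ⊢ ρ 𝐙 ⊓ 𝐘 ⊔ 𝐱 ⊕ # 1 ≼ ρ 𝐙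
        Z≥ = rank-fact (side-Z c∈L a∈L c≢x a≢x c≢a s)
        Z′≥ : ⊢ ρ 𝐙′ ⊓ 𝐘 ⊔ 𝐱 ⊕ # 1 ≼ ρ 𝐙′
        Z′≥ = rank-fact (side-Z a∈L c∈L a≢x c≢x a≢c s′)
        W≥ : ⊢ ρ 𝐖 ⊓ 𝐘 ⊕ # 1 ≼ ρ 𝐖
        W≥ = rank-fact (side-W c∈L a∈L c≢x a≢x c≢a s)
        W′≥ : ⊢ ρ 𝐖′ ⊓ 𝐘 ⊕ # 1 ≼ ρ 𝐖′
        W′≥ = rank-fact (side-W a∈L c∈L a≢x c≢x a≢c s′)
        W′≤ : ⊢ ρ 𝐖′ ≼ ρ 𝐖′ ⊓ 𝐘 ⊕ # 1
        W′≤ = rank-fact (side-W≤ a∈L c∈L a≢x c≢x a≢c s′)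
        b∈cl₁ : ⊢ ρ 𝐖 ⊓ 𝐘 ⊔ 𝐜 ⊔ 𝐛 ≼ ρ 𝐖 ⊓ 𝐘 ⊔ 𝐜
        b∈cl₁ = rank-fact (b∈cl c∈L a∈L c≢x a≢x c≢a s)
        c∈cl : ⊢ ρ 𝐖 ⊓ 𝐘 ⊔ 𝐜 ⊔ 𝐛 ≼ ρ 𝐖 ⊓ 𝐘 ⊔ 𝐛
        c∈cl = rank-fact (l∈cl c∈L a∈L c≢x a≢x c≢a s)
        a∈cl : ⊢ ρ 𝐖′ ⊓ 𝐘 ⊔ 𝐚 ⊔ 𝐛 ≼ ρ 𝐖′ ⊓ 𝐘 ⊔ 𝐛
        a∈cl = rank-fact (l∈cl a∈L c∈L a≢x c≢x a≢c s′)
        R≤Y+1 : ⊢ ρ 𝐄 ≼ ρ 𝐘 ⊕ # 1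
        R≤Y+1 = rank-fact hyperplane

      -- Otherwise W ∩ Y ⊆ Z′. Since also c ∈ Z′, the exchange puts `b` into cl(Z′), and moving `b`
      -- from W′ to Z′ lowers the connectivity below two.
      far-sides-meet : Nonempty (W ∩ W′ ∩ Y)
      far-sides-meet with nonempty? (W ∩ W′ ∩ Y)
      ... | yes ne = ne
      ... | no  e  = absurd K
        (connect₂ K (𝐙′ ⊔ 𝐚 ⊔ 𝐛) (𝐖′ ⊓ 𝐘) (by-ranks K (S′.3≤X ∷ []))
                    (by-ranks [] (W′≤ ∷ S′.3≤Y ∷ [])) ∷
         W′≥ ∷ S′.X+Y ∷ b∈Z′ ∷ S′.x∈clX ∷ sub (𝐙′ ⊔ 𝐛) (𝐙′ ⊔ 𝐚) ∷ [])
        where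
        none : W ∩ W′ ∩ Y ⊆ ⊥
        none x∈ = ⊥-elim (e (_ , x∈))
        K : SetFacts _
        K = incl (𝐖 ⊓ 𝐖′ ⊓ 𝐘 ⊑ ∅) none ∷ H
        b∈Z′ : ⊢ ρ 𝐙′ ⊔ 𝐛 ≼ ρ 𝐙′
        b∈Z′ = by-ranks K (sub 𝐙′ (𝐖 ⊓ 𝐘 ⊔ 𝐜 ⊔ 𝐛) ∷ b∈cl₁ ∷ [])


      private
        -- On the hyperplane Y ∪ x each of the two partitions loses one from the rank of either
        -- side, so both have connectivity at most one there. Uncrossing them leaves at most two for
        -- two opposite corners. The far corner takes one by `hyperplane-connected`. A near corner
        -- of rank two would then lift to M with connectivity at most one, because by `span` adding
        -- X back on the far side costs only one.
        near∪x≤1 : rank ((Z ∩ Z′ ∩ Y) ∪ ⁅ x ⁆) ≤ 1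
        near∪x≤1 with compare (ρ 𝐙 ⊓ 𝐙′ ⊓ 𝐘 ⊔ 𝐱) (# 1)
        ... | inj₁ h = holds h
        ... | inj₂ h = absurd H
          (connect₂ H (𝐙 ⊓ 𝐙′ ⊓ 𝐘 ⊔ 𝐱) (𝐖𝐖 ⊔ 𝐗) (by-ranks [] (h ∷ [])) (by-ranks H (3≤X ∷ [])) ∷
           far ∷ span ∷ Z≥ ∷ Z′≥ ∷ W≥ ∷ W′≥ ∷ S.X+Y ∷ S′.X+Y ∷
           sub (𝐙 ⊓ 𝐘 ⊔ 𝐱) (𝐙′ ⊓ 𝐘 ⊔ 𝐱) ∷ sub (𝐖 ⊓ 𝐘) (𝐖′ ⊓ 𝐘) ∷ R≤Y+1 ∷ [])
          where
          𝐖𝐖 = 𝐖 ⊓ 𝐘 ⊔ 𝐖′ ⊓ 𝐘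
          far : ⊢ ρ 𝐘 ⊕ # 1 ≼ ρ 𝐖 ⊓ 𝐖′ ⊓ 𝐘 ⊕ ρ 𝐙 ⊓ 𝐘 ⊔ 𝐙′ ⊓ 𝐘 ⊔ 𝐱
          far = by-ranks H (fact (ρ 𝐘 ⊕ # 1 ≼ ρ 𝐖 ⊓ 𝐖′ ⊓ 𝐘 ⊕ ρ ((𝐘 ⊔ 𝐱) ⊖ 𝐖 ⊓ 𝐖′ ⊓ 𝐘))
            (hyperplane-connected (included (by-sets [] {𝐖 ⊓ 𝐖′ ⊓ 𝐘 ⊑ 𝐘})) (proj₂ far-sides-meet)) ∷ [])
          span : ⊢ ρ 𝐖𝐖 ⊔ 𝐗 ≼ ρ 𝐖𝐖 ⊕ # 1
          -- Only `b` costs rank. The exchange then yields `c` from W ∩ Y and `a` from W′ ∩ Y, and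
          -- these two span L.
          span = by-ranks H (sub 𝐖𝐖 𝐛 ∷ b≤1 ∷
            sub (𝐖𝐖 ⊔ 𝐛) (𝐖 ⊓ 𝐘 ⊔ 𝐜 ⊔ 𝐛) ∷ c∈cl ∷
            sub (𝐖𝐖 ⊔ 𝐛 ⊔ 𝐜) (𝐖′ ⊓ 𝐘 ⊔ 𝐚 ⊔ 𝐛) ∷ a∈cl ∷
            sub (𝐖𝐖 ⊔ 𝐛 ⊔ 𝐜 ⊔ 𝐚) 𝐋 ∷ ca ∷ line ∷ [])

      near-sides-disjoint : Z ∩ Z′ ∩ Y ⊆ ⊥
      near-sides-disjoint = included (by-sets
          (incl (𝐙 ⊓ 𝐙′ ⊓ 𝐘 ⊔ 𝐱 ⊑ 𝐱) (thin S⊆E x∈S near∪x≤1) ∷ H) {𝐙 ⊓ 𝐙′ ⊓ 𝐘 ⊑ ∅})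
        where
        S⊆E : (Z ∩ Z′ ∩ Y) ∪ ⁅ x ⁆ ⊆ ground
        S⊆E = included (by-sets H {𝐙 ⊓ 𝐙′ ⊓ 𝐘 ⊔ 𝐱 ⊑ 𝐄})
        x∈S : x ∈ (Z ∩ Z′ ∩ Y) ∪ ⁅ x ⁆
        x∈S = x∈p∪q⁺ (inj₂ (x∈⁅x⁆ x))

      private
        K : SetFacts _
        K = incl (𝐙 ⊓ 𝐙′ ⊓ 𝐘 ⊑ ∅) near-sides-disjoint ∷ H
        spanned : ⊢ ρ 𝐙 ⊓ 𝐘 ⊔ 𝐱 ≼ ρ 𝐙 ⊓ 𝐘 → ⊢ ρ 𝐖′ ⊔ 𝐋 ≼ ρ 𝐖′
        spanned k = by-ranks K (k ∷ sub 𝐖′ (𝐙 ⊓ 𝐘 ⊔ 𝐱) ∷ sub (𝐖′ ⊔ 𝐱) (𝐖′ ⊔ 𝐚) ∷ S′.x∈clY ∷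
                                sub (𝐖′ ⊔ 𝐱 ⊔ 𝐚) 𝐋 ∷ ax ∷ line ∷ [])

      -- Suppose the rank is at least two. If x is not in cl(Z ∩ Y), then Z ∩ Y has rank at most
      -- rank Z - 2, while adding L to W costs one; the connectivity is below two. If x is in cl(Z ∩
      -- Y), then disjointness gives Z ∩ Y ⊆ W′, so W′ spans x and a, hence L. The complement Z′ ∩ Y
      -- of W′ ∪ L has smaller rank than Z′, a contradiction whether or not that rank reaches two.
      near-side-thin : rank (Z ∩ Y) ≤ 1
      near-side-thin with compare (ρ 𝐙 ⊓ 𝐘) (# 1) | compare (ρ 𝐙 ⊓ 𝐘 ⊔ 𝐱) (ρ 𝐙 ⊓ 𝐘) | compare (ρ 𝐙′ ⊓ 𝐘) (# 1)
      ... | inj₁ h | _ | _ = holds h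
      ... | inj₂ h | inj₂ k | _ = absurd H
        (connect₂ H (𝐙 ⊓ 𝐘) (𝐖 ⊔ 𝐋) (by-ranks [] (h ∷ [])) (by-ranks H (S.3≤Y ∷ [])) ∷
         Z≥ ∷ k ∷ S.X+Y ∷ S.x∈clY ∷ sub (𝐖 ⊔ 𝐜) 𝐋 ∷ line ∷
         fact (# 1 ≼ ρ 𝐜) (rank-nonloop (Vertical.x⊆E (Side.side s) (x∈⁅x⁆ c))) ∷ [])
      ... | inj₂ h | inj₁ k | inj₂ l = absurd K
        (connect₂ K (𝐖′ ⊔ 𝐋) (𝐙′ ⊓ 𝐘) (by-ranks K (S′.3≤Y ∷ [])) (by-ranks [] (l ∷ [])) ∷
         spanned k ∷ Z′≥ ∷ S′.X+Y ∷ [])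
      ... | inj₂ h | inj₁ k | inj₁ l = absurd K
        (connect₁ K (𝐖′ ⊔ 𝐋) (𝐙′ ⊓ 𝐘) l ∷ spanned k ∷ S′.X+Y ∷ S′.3≤X ∷ [])

    -- Z contains x and spans l, hence spans L, so all of L - l may move to Z. If `b` were not in W,
    -- then W - L would lie in Y, and l ∈ cl(W - L) would lie in cl(Y).
    shift : ∀ {l Z W} → l ∈ L → l ≢ x → Vertical M ⁅ l ⁆ Z W → x ∈ Z →
            Side l ((Z ∪ L) ─ ⁅ l ⁆) (W ─ L)
    shift {l} {Z} {W} l∈L l≢x v x∈Z = record
      { side = v′
      ; L⊆Zl = included (by-sets H {𝐋 ⊑ ((𝐙 ⊔ 𝐋) ⊖ 𝐥) ⊔ 𝐥})
      ; b∈W  = x∈p∧x∉q⇒x∈p─q b∈W b∉L }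
      where
      open Base (Z ∷ W ∷ ⁅ l ⁆ ∷ [])
      𝐙 = var 6
      𝐖 = var 7
      𝐥 = var 8
      P = (𝐙 ⊔ 𝐋) ⊖ 𝐥
      Q = 𝐖 ⊖ 𝐋
      module V = VerticalFacts 𝐥 𝐙 𝐖 v
      H : SetFacts _
      H = incl (𝐥 ⊑ 𝐋) (⁅⁆-⊆ l∈L) ∷ incl (𝐥 ⊓ 𝐱 ⊑ ∅) (⁅⁆-≢ l≢x) ∷ incl (𝐱 ⊑ 𝐙) (⁅⁆-⊆ x∈Z) ∷
          fan ++ˢ V.sets
      l∈E : l ∈ ground
      l∈E = Vertical.x⊆E v (x∈⁅x⁆ l)
      lx : ⊢ # 2 ≼ ρ 𝐥 ⊔ 𝐱
      lx = fact (# 2 ≼ ρ 𝐥 ⊔ 𝐱) (rank-pair l∈E x∈E l≢x)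
      ZL≤Z : ⊢ ρ 𝐙 ⊔ 𝐋 ≼ ρ 𝐙
      ZL≤Z = by-ranks H (sub (𝐙 ⊔ 𝐥) 𝐋 ∷ lx ∷ line ∷ V.x∈clX ∷ [])
      3≤Q : ⊢ # 3 ≼ ρ Q
      3≤Q with compare (ρ Q) (# 1)
      ... | inj₁ h = absurd H (connect₁ H (𝐙 ⊔ 𝐋) Q h ∷ ZL≤Z ∷ V.X+Y ∷ V.3≤Y ∷ [])
      ... | inj₂ h = by-ranks H (connect₂ H (𝐙 ⊔ 𝐋) Q (by-ranks H (V.3≤X ∷ [])) (by-ranks [] (h ∷ [])) ∷
                                 ZL≤Z ∷ V.X+Y ∷ V.3≤Y ∷ [])
      v′ : Vertical M ⁅ l ⁆ ((Z ∪ L) ─ ⁅ l ⁆) (W ─ L)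
      v′ = vertical M (included (by-sets H {P ⊑ 𝐄})) (included (by-sets H {Q ⊑ 𝐄}))
        (Vertical.x⊆E v) (included (by-sets H {𝐄 ⊑ P ⊔ Q ⊔ 𝐥})) (included (by-sets H {P ⊓ Q ⊑ ∅}))
        (included (by-sets H {P ⊓ 𝐥 ⊑ ∅})) (included (by-sets H {Q ⊓ 𝐥 ⊑ ∅})) (rank-single l)
        (holds (by-ranks H (V.3≤X ∷ []) {# 3 ≼ ρ P ⊔ 𝐥})) (holds (by-ranks H (3≤Q ∷ []) {# 3 ≼ ρ Q ⊔ 𝐥}))
        (holds (by-ranks H (ZL≤Z ∷ V.X+Y ∷ V.x∈clY ∷ []) {ρ P ⊔ 𝐥 ⊕ ρ Q ⊔ 𝐥 ≼ ρ 𝐄 ⊕ # 2}))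
      b∈W : b ∈ W
      b∈W with b ∈? W
      ... | yes b∈W = b∈W
      ... | no  b∉W = absurd (incl (𝐛 ⊓ 𝐖 ⊑ ∅) (⁅⁆-∉ b∉W) ∷ H)
        (rank-fact {i = ρ Q ⊔ 𝐥 ≼ ρ Q} (Vertical.x∈clY v′) ∷ sub (Q ⊔ 𝐥) 𝐘 ∷
         fact (ρ 𝐘 ⊕ # 1 ≼ ρ 𝐘 ⊔ 𝐥) (closed (L∖x⊆X l∈L l≢x)) ∷ [])

-- Points off a line with three elements

module _ {m} (M : ThreeConnected m) where
  open ThreeConnected M

  module _ {Z W c} (v : Vertical M ⁅ c ⁆ Z W) where

    side-of : ∀ {e} → e ∈ ground → e ≢ c → e ∈ Z ⊎ e ∈ W
    side-of {e} e∈E e≢c with x∈p∪q⁻ Z _ (Vertical.cover v e∈E)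
    ... | inj₁ e∈Z = inj₁ e∈Z
    ... | inj₂ h with x∈p∪q⁻ W ⁅ c ⁆ h
    ...   | inj₁ e∈W = inj₂ e∈W
    ...   | inj₂ e∈c = ⊥-elim (e≢c (x∈⁅y⁆⇒x≡y c e∈c))

  module _ {x c : Fin m} {X Y L : Subset m} (vX : Vertical M ⁅ x ⁆ X Y)
    (closed : ∀ {e} → e ∈ X → rank Y + 1 ≤ rank (Y ∪ ⁅ e ⁆))
    (X≤3 : rank X ≤ 3) (c∈X : c ∈ X) (L⊆Xx : L ⊆ X ∪ ⁅ x ⁆)
    (L≤2 : rank L ≤ 2) (3≤Lc : 3 ≤ rank (L ∪ ⁅ c ⁆)) where

    module _ {Z W} (v : Vertical M ⁅ c ⁆ Z W) where
      private
        open Reasoning₃ M (X ∷ Y ∷ Z ∷ W ∷ L ∷ ⁅ x ⁆ ∷ ⁅ c ⁆ ∷ [])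
        𝐗 = var 1
        𝐘 = var 2
        𝐙 = var 3
        𝐖 = var 4
        𝐋 = var 5
        𝐱 = var 6
        𝐜 = var 7
        module V = VerticalFacts 𝐜 𝐙 𝐖 v
        module VX = VerticalFacts 𝐱 𝐗 𝐘 vX
        H : SetFacts _
        H = incl (𝐜 ⊑ 𝐗) (⁅⁆-⊆ c∈X) ∷ incl (𝐋 ⊑ 𝐗 ⊔ 𝐱) L⊆Xx ∷ V.sets ++ˢ VX.sets

      -- A side that spans L spans X together with c; moving X to that side contradicts c ∉ cl(Y).
      line-not-spanned : ¬ (2 ≤ rank (Z ∩ L))
      line-not-spanned 2≤ZL = contradiction
        where
        spanned : ⊢ ρ 𝐙 ⊔ 𝐗 ⊔ 𝐱 ≼ ρ 𝐙
        spanned = by-ranks H (sub (𝐙 ⊔ 𝐜) (𝐗 ⊔ 𝐱) ∷ V.x∈clX ∷ VX.x∈clX ∷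
          fact (ρ 𝐗 ≼ # 3) X≤3 ∷ sub (𝐙 ⊓ 𝐋 ⊔ 𝐜) 𝐋 ∷ fact (ρ 𝐋 ≼ # 2) L≤2 ∷
          fact (# 3 ≼ ρ 𝐋 ⊔ 𝐜) 3≤Lc ∷ fact (# 2 ≼ ρ 𝐙 ⊓ 𝐋) 2≤ZL ∷ [])
        contradiction : False
        contradiction with compare (ρ 𝐖 ⊓ 𝐘) (# 1)
        ... | inj₁ h = absurd H (connect₁ H (𝐙 ⊔ 𝐗 ⊔ 𝐱) (𝐖 ⊓ 𝐘) h ∷ spanned ∷ V.X+Y ∷ V.3≤Y ∷ [])
        ... | inj₂ h = absurd H
          (connect₂ H (𝐙 ⊔ 𝐗 ⊔ 𝐱) (𝐖 ⊓ 𝐘) (by-ranks H (V.3≤X ∷ [])) (by-ranks [] (h ∷ [])) ∷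
           spanned ∷ V.X+Y ∷ V.x∈clY ∷ sub (𝐖 ⊓ 𝐘 ⊔ 𝐜) 𝐘 ∷
           fact (ρ 𝐘 ⊕ # 1 ≼ ρ 𝐘 ⊔ 𝐜) (closed c∈X) ∷ [])

    -- Two of the three points of L fall on the same side, and two points span the line.
    triangle-blocks : ∀ {p q s} → p ∈ L → q ∈ L → s ∈ L → p ≢ q → p ≢ s → q ≢ s →
      c ∉ L → ∀ {Z W} → ¬ Vertical M ⁅ c ⁆ Z W
    triangle-blocks p∈L q∈L s∈L p≢q p≢s q≢s c∉L v = go (side p∈L) (side q∈L) (side s∈L)
      where
      L⊆E : L ⊆ ground
      L⊆E e∈L with x∈p∪q⁻ X ⁅ x ⁆ (L⊆Xx e∈L)
      ... | inj₁ e∈X = Vertical.X⊆E vX e∈X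
      ... | inj₂ e∈x = Vertical.x⊆E vX e∈x
      side : ∀ {e} → e ∈ L → e ∈ _ ⊎ e ∈ _
      side e∈L = side-of v (L⊆E e∈L) λ { refl → c∉L e∈L }
      two : ∀ {e f S} → e ∈ L → f ∈ L → e ≢ f → e ∈ S → f ∈ S → 2 ≤ rank (S ∩ L)
      two e∈L f∈L e≢f e∈S f∈S = ℕ.≤-trans (rank-pair (L⊆E e∈L) (L⊆E f∈L) e≢f)
        (rank-mono _ _ (∪-⊆ (⁅⁆-⊆ (x∈p∩q⁺ (e∈S , e∈L))) (⁅⁆-⊆ (x∈p∩q⁺ (f∈S , f∈L)))))
      go : _ → _ → _ → False
      go (inj₁ p∈) (inj₁ q∈) _         = line-not-spanned v (two p∈L q∈L p≢q p∈ q∈)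
      go (inj₁ p∈) _         (inj₁ s∈) = line-not-spanned v (two p∈L s∈L p≢s p∈ s∈)
      go _         (inj₁ q∈) (inj₁ s∈) = line-not-spanned v (two q∈L s∈L q≢s q∈ s∈)
      go (inj₂ p∈) (inj₂ q∈) _         = line-not-spanned (swap M v) (two p∈L q∈L p≢q p∈ q∈)
      go (inj₂ p∈) _         (inj₂ s∈) = line-not-spanned (swap M v) (two p∈L s∈L p≢s p∈ s∈)
      go _         (inj₂ q∈) (inj₂ s∈) = line-not-spanned (swap M v) (two q∈L s∈L q≢s q∈ s∈)

-- Uncrossing vertical 3-partitions at x and at c

module _ {m} (M : ThreeConnected m) where
  open ThreeConnected M

  module Crossing {x c : Fin m} {X Y : Subset m} (vX : Vertical M ⁅ x ⁆ X Y)
    (closed : ∀ {e} → e ∈ X → rank Y + 1 ≤ rank (Y ∪ ⁅ e ⁆)) (c∈X : c ∈ X)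
    {P Q : Subset m} (v : Vertical M ⁅ c ⁆ P Q) where
    private
      open Reasoning₃ M (X ∷ Y ∷ P ∷ Q ∷ ⁅ x ⁆ ∷ ⁅ c ⁆ ∷ [])
      𝐗 = var 1
      𝐘 = var 2
      𝐏 = var 3
      𝐐 = var 4
      𝐱 = var 5
      𝐜 = var 6
      module V = VerticalFacts 𝐜 𝐏 𝐐 v
      module VX = VerticalFacts 𝐱 𝐗 𝐘 vX
      H : SetFacts _
      H = incl (𝐜 ⊑ 𝐗) (⁅⁆-⊆ c∈X) ∷ V.sets ++ˢ VX.sets
      A = 𝐗 ⊓ 𝐏
      A⁺ = (𝐗 ⊔ 𝐱) ⊓ (𝐏 ⊔ 𝐜)
      B⁺ = 𝐘 ⊔ 𝐐 ⊔ 𝐱 ⊔ 𝐜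
      D = 𝐄 ⊖ A ⊖ 𝐜

    -- Otherwise P lies in Y ∪ x, and c ∈ cl(P) lies in cl(Y).
    meets : Nonempty (X ∩ P)
    meets with nonempty? (X ∩ P)
    ... | yes ne = ne
    ... | no  e  = absurd (incl (A ⊑ ∅) (λ x∈ → ⊥-elim (e (_ , x∈))) ∷ H)
      (sub (𝐏 ⊔ 𝐜) (𝐘 ⊔ 𝐱) ∷ V.x∈clX ∷ VX.x∈clY ∷ fact (ρ 𝐘 ⊕ # 1 ≼ ρ 𝐘 ⊔ 𝐜) (closed c∈X) ∷ [])

    -- As Y ∩ Q has rank at least two, its connectivity is at least two, so submodularity leaves at
    -- most two for the opposite corner. Adding `x` and `c` to the corner is harmless, both being
    -- spanned by either side of their partitions.
    uncross : 2 ≤ rank (Y ∩ Q) →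
      rank ((X ∪ ⁅ x ⁆) ∩ (P ∪ ⁅ c ⁆)) ≤ 2 ⊎ Vertical M ⁅ c ⁆ (X ∩ P) (ground ─ (X ∩ P) ─ ⁅ c ⁆)
    uncross 2≤YQ = go (compare (ρ A) (# 2)) (compare (ρ A) (# 1)) (compare (ρ A ⊔ 𝐜) (# 1))
      where
      λ≤2 : ⊢ ρ A⁺ ⊕ ρ B⁺ ≼ ρ 𝐄 ⊕ # 2
      λ≤2 = by-ranks H
        (connect₂ H (𝐘 ⊓ 𝐐) (𝐗 ⊔ 𝐱 ⊔ 𝐏 ⊔ 𝐜) (fact (# 2 ≼ ρ 𝐘 ⊓ 𝐐) 2≤YQ) (by-ranks [] (VX.3≤X ∷ [])) ∷
         sub (𝐗 ⊔ 𝐱) (𝐏 ⊔ 𝐜) ∷ sub (𝐘 ⊔ 𝐱) (𝐐 ⊔ 𝐜) ∷ V.X+Y ∷ VX.X+Y ∷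
         V.x∈clX ∷ VX.x∈clX ∷ V.x∈clY ∷ VX.x∈clY ∷ [])
      2≤B : ⊢ # 2 ≼ ρ B⁺
      2≤B = by-ranks [] (VX.3≤Y ∷ [])
      go : (⊢ ρ A ≼ # 2) ⊎ (⊢ # 2 ⊕ # 1 ≼ ρ A) → (⊢ ρ A ≼ # 1) ⊎ (⊢ # 1 ⊕ # 1 ≼ ρ A) →
           (⊢ ρ A ⊔ 𝐜 ≼ # 1) ⊎ (⊢ # 1 ⊕ # 1 ≼ ρ A ⊔ 𝐜) → _
      go (inj₂ h) _ _ = inj₂ (vertical M (included (by-sets H {A ⊑ 𝐄})) (included (by-sets H {D ⊑ 𝐄}))
        (Vertical.x⊆E v) (included (by-sets H {𝐄 ⊑ A ⊔ D ⊔ 𝐜})) (included (by-sets H {A ⊓ D ⊑ ∅}))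
        (included (by-sets H {A ⊓ 𝐜 ⊑ ∅})) (included (by-sets H {D ⊓ 𝐜 ⊑ ∅})) (rank-single c)
        (holds (by-ranks H (h ∷ []) {# 3 ≼ ρ A ⊔ 𝐜})) (holds (by-ranks H (VX.3≤Y ∷ []) {# 3 ≼ ρ D ⊔ 𝐜}))
        (holds (by-ranks H (λ≤2 ∷ []) {ρ A ⊔ 𝐜 ⊕ ρ D ⊔ 𝐜 ≼ ρ 𝐄 ⊕ # 2})))
      -- For a corner of small rank, 3-connectivity is applied against `B⁺` to `A`, or to `A ⊔ 𝐜` if
      -- `A` itself is too thin. It shows that the enlarged corner `A⁺` has no larger rank than that
      -- set. If `A ⊔ 𝐜` is thin as well, only `x` can add to its rank.
      go (inj₁ h) (inj₂ k) _ = inj₁ (holds (by-ranks H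
        (connect₂ H A B⁺ (by-ranks [] (k ∷ [])) 2≤B ∷ λ≤2 ∷ h ∷ []) {ρ A⁺ ≼ # 2}))
      go (inj₁ h) (inj₁ k) (inj₂ l) = inj₁ (holds (by-ranks H
        (connect₂ H (A ⊔ 𝐜) B⁺ (by-ranks [] (l ∷ [])) 2≤B ∷ λ≤2 ∷ sub A 𝐜 ∷ k ∷
         fact (ρ 𝐜 ≼ # 1) (rank-single c) ∷ []) {ρ A⁺ ≼ # 2}))
      go (inj₁ h) (inj₁ k) (inj₁ l) = inj₁ (holds (by-ranks H
        (sub (A ⊔ 𝐜) 𝐱 ∷ l ∷ fact (ρ 𝐱 ≼ # 1) (rank-single x) ∷ []) {ρ A⁺ ≼ # 2}))

module _ {n : ℕ} where

  ∣∪∣≤ : ∀ (X Y : Subset n) → ∣ X ∪ Y ∣ ≤ ∣ X ∣ + ∣ Y ∣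
  ∣∪∣≤ = go
    where
    go : ∀ {n} (X Y : Subset n) → ∣ X ∪ Y ∣ ≤ ∣ X ∣ + ∣ Y ∣
    go []            []            = z≤n
    go (inside  ∷ X) (inside  ∷ Y) = s≤s (ℕ.≤-trans (go X Y) (ℕ.+-monoʳ-≤ ∣ X ∣ (ℕ.n≤1+n ∣ Y ∣)))
    go (inside  ∷ X) (outside ∷ Y) = s≤s (go X Y)
    go (outside ∷ X) (inside  ∷ Y) = ℕ.≤-trans (s≤s (go X Y)) (ℕ.≤-reflexive (sym (ℕ.+-suc ∣ X ∣ ∣ Y ∣)))
    go (outside ∷ X) (outside ∷ Y) = go X Y

  ∣∪⁅⁆∣> : ∀ {X : Subset n} {x} → x ∉ X → suc ∣ X ∣ ≤ ∣ X ∪ ⁅ x ⁆ ∣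
  ∣∪⁅⁆∣> {X} {x} x∉X = p⊂q⇒∣p∣<∣q∣ (p⊆p∪q ⁅ x ⁆ , x , x∈p∪q⁺ (inj₂ (x∈⁅x⁆ x)) , x∉X)

module _ {m} (M : ThreeConnected m) where
  open ThreeConnected M

  ∣thin∣≤1 : ∀ {S} → S ⊆ ground → rank S ≤ 1 → ∣ S ∣ ≤ 1
  ∣thin∣≤1 {S} S⊆E S≤1 with nonempty? S
  ... | yes (s , s∈S) = ℕ.≤-trans (p⊆q⇒∣p∣≤∣q∣ (thin M S⊆E s∈S S≤1)) (ℕ.≤-reflexive (∣⁅x⁆∣≡1 s))
  ... | no  e = ℕ.≤-trans (ℕ.≤-reflexive (trans (cong ∣_∣ (Empty-unique e)) (∣⊥∣≡0 m))) z≤n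

  thick : ∀ {S} → 2 ≤ rank S → ∃[ s ] ∃[ t ] s ∈ S × t ∈ S × s ≢ t
  thick {S} 2≤S with nonempty? S
  ... | no  e = ⊥-elim (ℕ.<⇒≱ 2≤S (ℕ.≤-trans (ℕ.≤-reflexive (trans (cong rank (Empty-unique e)) rank-⊥)) z≤n))
  ... | yes (s , s∈S) with nonempty? (S ─ ⁅ s ⁆)
  ...   | yes (t , t∈) = s , t , s∈S , p─q⊆p S ⁅ s ⁆ t∈ , λ { refl → ∉⊥ (disjoint (x∈p∩q⁺ (t∈ , x∈⁅x⁆ t))) }
    where
    open Reasoning₃ M (S ∷ ⁅ s ⁆ ∷ [])
    disjoint : (S ─ ⁅ s ⁆) ∩ ⁅ s ⁆ ⊆ ⊥
    disjoint = included (by-sets [] {(var 1 ⊖ var 2) ⊓ var 2 ⊑ ∅})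
  ...   | no  e = ⊥-elim (ℕ.<⇒≱ 2≤S (ℕ.≤-trans (rank-mono S ⁅ s ⁆ S⊆s) (rank-single s)))
    where
    open Reasoning₃ M (S ∷ ⁅ s ⁆ ∷ [])
    S⊆s : S ⊆ ⁅ s ⁆
    S⊆s = included (by-sets (incl (var 1 ⊖ var 2 ⊑ ∅) (λ t∈ → ⊥-elim (e (_ , t∈))) ∷ []) {var 1 ⊑ var 2})

  module _ {x c : Fin m} {X Y : Subset m} (vX : Vertical M ⁅ x ⁆ X Y)
    (closed : ∀ {e} → e ∈ X → rank Y + 1 ≤ rank (Y ∪ ⁅ e ⁆)) (c∈X : c ∈ X)
    {Z W : Subset m} (v : Vertical M ⁅ c ⁆ Z W) where

    -- In `smaller` the inclusion in `X` or in `Z` is what hands on the bound of one element of N.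
    -- In the other two cases `x` sits on a side whose intersection with `X`, together with `x` and
    -- `c`, lies on a line.
    data Crossed : Set where
      smaller   : ∀ {P Q} → Vertical M ⁅ c ⁆ P Q → ∣ P ∣ < ∣ X ∣ → P ⊆ X ⊎ P ⊆ Z → Crossed
      two-lines : ∀ {P Q} → Vertical M ⁅ c ⁆ P Q → x ∈ P → 2 ≤ rank (X ∩ Q) →
                  rank ((X ∪ ⁅ x ⁆) ∩ (P ∪ ⁅ c ⁆)) ≤ 2 → rank ((X ∪ ⁅ x ⁆) ∩ (Q ∪ ⁅ c ⁆)) ≤ 2 → Crossed
      one-line  : ∀ {P Q b} → Vertical M ⁅ c ⁆ P Q → x ∈ P → b ∈ X ∩ Q → X ∩ Q ⊆ ⁅ b ⁆ →
                  rank ((X ∪ ⁅ x ⁆) ∩ (P ∪ ⁅ c ⁆)) ≤ 2 → Crossed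

    private
      x∈E : x ∈ ground
      x∈E = Vertical.x⊆E vX (x∈⁅x⁆ x)

      ∉-singleton : ∀ {S : Subset m} {e} → S ∩ ⁅ e ⁆ ⊆ ⊥ → e ∉ S
      ∉-singleton {e = e} S∩e e∈S = ∉⊥ (S∩e (x∈p∩q⁺ (e∈S , x∈⁅x⁆ e)))

      x≢c : x ≢ c
      x≢c refl = ∉-singleton (Vertical.X∩x vX) c∈X

    module _ {P Q} (v′ : Vertical M ⁅ c ⁆ P Q) where
      X∩P<X : ∣ X ∩ P ∣ < ∣ X ∣
      X∩P<X = p⊂q⇒∣p∣<∣q∣ (p∩q⊆p X P , c , c∈X ,
        λ c∈ → ∉-singleton (Vertical.X∩x v′) (proj₂ (x∈p∩q⁻ X P c∈)))

      on-side : rank ((X ∪ ⁅ x ⁆) ∩ (P ∪ ⁅ c ⁆)) ≤ 2 → x ∈ P →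
        (2 ≤ rank (X ∩ Q) → Crossed) → Crossed
      on-side P⁺≤2 x∈P k with ℕ.≤-<-connex (rank (X ∩ Q)) 1
      ... | inj₂ 2≤XQ = k 2≤XQ
      ... | inj₁ XQ≤1 with Crossing.meets M vX closed c∈X (swap M v′)
      ...   | b , b∈XQ = one-line v′ x∈P b∈XQ (thin M X∩Q⊆E b∈XQ XQ≤1) P⁺≤2
        where
        X∩Q⊆E : X ∩ Q ⊆ ground
        X∩Q⊆E e∈ = Vertical.X⊆E vX (p∩q⊆p X Q e∈)

    private
      Y∩Z⊆E : Y ∩ Z ⊆ ground
      Y∩Z⊆E e∈ = Vertical.Y⊆E vX (p∩q⊆p Y Z e∈)

      c∉X∩Z : c ∉ X ∩ Z
      c∉X∩Z c∈ = ∉-singleton (Vertical.X∩x v) (proj₂ (x∈p∩q⁻ X Z c∈))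

      outer : ∀ {w} → w ∈ X ∩ W → w ∉ (X ∩ Z) ∪ ⁅ c ⁆
      outer {w} w∈ w∈′ = ∉⊥ (included (by-sets V.sets {(𝐗 ⊓ 𝐖) ⊓ (𝐗 ⊓ 𝐙 ⊔ 𝐜) ⊑ ∅}) (x∈p∩q⁺ (w∈ , w∈′)))
        where
        open Reasoning₃ M (X ∷ Z ∷ W ∷ ⁅ c ⁆ ∷ [])
        𝐗 = var 1
        𝐙 = var 2
        𝐖 = var 3
        𝐜 = var 4
        module V = VerticalFacts 𝐜 𝐙 𝐖 v

      Xcw⊆X : ∀ {w} → w ∈ X ∩ W → ((X ∩ Z) ∪ ⁅ c ⁆) ∪ ⁅ w ⁆ ⊆ X
      Xcw⊆X w∈ = ∪-⊆ (∪-⊆ (p∩q⊆p X Z) (⁅⁆-⊆ c∈X)) (⁅⁆-⊆ (p∩q⊆p X W w∈))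

      module _ (YZ≤1 : rank (Y ∩ Z) ≤ 1) where
        open Reasoning₃ M (X ∷ Y ∷ Z ∷ W ∷ ⁅ x ⁆ ∷ ⁅ c ⁆ ∷ [])
        𝐗 = var 1
        𝐘 = var 2
        𝐙 = var 3
        𝐖 = var 4
        𝐱 = var 5
        𝐜 = var 6
        module V = VerticalFacts 𝐜 𝐙 𝐖 v
        module VX = VerticalFacts 𝐱 𝐗 𝐘 vX

        -- Outside X the side Z has at most one element. Outside Z the set X has at least two: c and
        -- an element of X ∩ W.
        Z<X-far : x ∈ W → ∣ Z ∣ < ∣ X ∣
        Z<X-far x∈W with Crossing.meets M vX closed c∈X (swap M v)
        ... | w , w∈ = begin-strict
          ∣ Z ∣                               ≤⟨ p⊆q⇒∣p∣≤∣q∣ Z⊆ ⟩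
          ∣ X ∩ Z ∪ Y ∩ Z ∣                   ≤⟨ ∣∪∣≤ (X ∩ Z) (Y ∩ Z) ⟩
          ∣ X ∩ Z ∣ + ∣ Y ∩ Z ∣               ≤⟨ ℕ.+-monoʳ-≤ ∣ X ∩ Z ∣ (∣thin∣≤1 Y∩Z⊆E YZ≤1) ⟩
          ∣ X ∩ Z ∣ + 1                       ≡⟨ ℕ.+-comm ∣ X ∩ Z ∣ 1 ⟩
          suc ∣ X ∩ Z ∣                       ≤⟨ ∣∪⁅⁆∣> c∉X∩Z ⟩
          ∣ (X ∩ Z) ∪ ⁅ c ⁆ ∣                 <⟨ ∣∪⁅⁆∣> (outer w∈) ⟩
          ∣ ((X ∩ Z) ∪ ⁅ c ⁆) ∪ ⁅ w ⁆ ∣       ≤⟨ p⊆q⇒∣p∣≤∣q∣ (Xcw⊆X w∈) ⟩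
          ∣ X ∣                               ∎
          where
          open ℕ.≤-Reasoning
          Z⊆ : Z ⊆ X ∩ Z ∪ Y ∩ Z
          Z⊆ = included (by-sets (incl (𝐱 ⊑ 𝐖) (⁅⁆-⊆ x∈W) ∷ V.sets ++ˢ VX.sets) {𝐙 ⊑ 𝐗 ⊓ 𝐙 ⊔ 𝐘 ⊓ 𝐙})

        -- Now Z also contains x, so it has up to two elements outside X. Two elements of X ∩ W,
        -- besides c, make up for them.
        Z<X-near : 2 ≤ rank (X ∩ W) → ∣ Z ∣ < ∣ X ∣
        Z<X-near 2≤XW with thick 2≤XW
        ... | s , t , s∈ , t∈ , s≢t = begin-strict
          ∣ Z ∣                                    ≤⟨ p⊆q⇒∣p∣≤∣q∣ Z⊆ ⟩
          ∣ X ∩ Z ∪ Y ∩ Z ∪ ⁅ x ⁆ ∣                ≤⟨ ∣∪∣≤ (X ∩ Z) (Y ∩ Z ∪ ⁅ x ⁆) ⟩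
          ∣ X ∩ Z ∣ + ∣ Y ∩ Z ∪ ⁅ x ⁆ ∣            ≤⟨ ℕ.+-monoʳ-≤ ∣ X ∩ Z ∣ (∣∪∣≤ (Y ∩ Z) ⁅ x ⁆) ⟩
          ∣ X ∩ Z ∣ + (∣ Y ∩ Z ∣ + ∣ ⁅ x ⁆ ∣)      ≤⟨ ℕ.+-monoʳ-≤ ∣ X ∩ Z ∣ (ℕ.+-mono-≤ (∣thin∣≤1 Y∩Z⊆E YZ≤1) (ℕ.≤-reflexive (∣⁅x⁆∣≡1 x))) ⟩
          ∣ X ∩ Z ∣ + 2                            ≡⟨ ℕ.+-comm ∣ X ∩ Z ∣ 2 ⟩
          suc (suc ∣ X ∩ Z ∣)                      ≤⟨ s≤s (∣∪⁅⁆∣> c∉X∩Z) ⟩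
          suc ∣ (X ∩ Z) ∪ ⁅ c ⁆ ∣                  ≤⟨ ∣∪⁅⁆∣> (outer s∈) ⟩
          ∣ ((X ∩ Z) ∪ ⁅ c ⁆) ∪ ⁅ s ⁆ ∣            <⟨ ∣∪⁅⁆∣> t∉ ⟩
          ∣ (((X ∩ Z) ∪ ⁅ c ⁆) ∪ ⁅ s ⁆) ∪ ⁅ t ⁆ ∣  ≤⟨ p⊆q⇒∣p∣≤∣q∣ (∪-⊆ (Xcw⊆X s∈) (⁅⁆-⊆ (p∩q⊆p X W t∈))) ⟩
          ∣ X ∣                                    ∎
          where
          open ℕ.≤-Reasoning
          t∉ : t ∉ ((X ∩ Z) ∪ ⁅ c ⁆) ∪ ⁅ s ⁆
          t∉ h with x∈p∪q⁻ _ ⁅ s ⁆ h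
          ... | inj₁ h₁ = outer t∈ h₁
          ... | inj₂ h₂ = s≢t (sym (x∈⁅y⁆⇒x≡y s h₂))
          Z⊆ : Z ⊆ X ∩ Z ∪ Y ∩ Z ∪ ⁅ x ⁆
          Z⊆ = included (by-sets (V.sets ++ˢ VX.sets) {𝐙 ⊑ 𝐗 ⊓ 𝐙 ⊔ 𝐘 ⊓ 𝐙 ⊔ 𝐱})

    -- If Y ∩ Z has rank at least two as well, both corners in X can be uncrossed, giving the two
    -- lines. Otherwise Z is nearly contained in X, and counting elements replaces the second
    -- uncrossing.
    crossed : 2 ≤ rank (Y ∩ W) → Crossed
    crossed 2≤YW with Crossing.uncross M vX closed c∈X v 2≤YW
    ... | inj₂ v₁ = smaller v₁ (X∩P<X v) (inj₁ (p∩q⊆p X Z))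
    ... | inj₁ Z⁺≤2 with ℕ.≤-<-connex (rank (Y ∩ Z)) 1
    ...   | inj₂ 2≤YZ with Crossing.uncross M vX closed c∈X (swap M v) 2≤YZ
    ...     | inj₂ v₁ = smaller v₁ (X∩P<X (swap M v)) (inj₁ (p∩q⊆p X W))
    ...     | inj₁ W⁺≤2 with side-of M v x∈E x≢c
    ...       | inj₁ x∈Z = on-side v Z⁺≤2 x∈Z λ 2≤XW → two-lines v x∈Z 2≤XW Z⁺≤2 W⁺≤2
    ...       | inj₂ x∈W = on-side (swap M v) W⁺≤2 x∈W λ 2≤XZ → two-lines (swap M v) x∈W 2≤XZ W⁺≤2 Z⁺≤2
    crossed 2≤YW | inj₁ Z⁺≤2 | inj₁ YZ≤1 with side-of M v x∈E x≢c
    ...     | inj₁ x∈Z = on-side v Z⁺≤2 x∈Z λ 2≤XW → smaller v (Z<X-near YZ≤1 2≤XW) (inj₂ λ z → z)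
    ...     | inj₂ x∈W = smaller v (Z<X-far YZ≤1 x∈W) (inj₂ λ z → z)

-- Duality and contraction

-- Plain set identities are decided with the zero rank function.

zero-rank : ∀ {m} → RankFunction m
zero-rank = record { rank = λ _ → 0 ; rank-⊥ = refl ; rank-mono = λ _ _ _ → z≤n ; rank-sub = λ _ _ → z≤n }

module Sets {m} (env : List (Subset m)) where
  open Reasoning (zero-rank {m}) env public
    using (⟦_⟧; SetFacts; []; _∷_; ⊨_; set-fact; included; by-sets; incl; _++ˢ_)

  contained : ∀ {hs} → SetFacts hs → ∀ e f → {T (includes (length env) hs (e ⊑ f))} → ⟦ e ⟧ ⊆ ⟦ f ⟧
  contained Hs e f {p} = included (by-sets Hs {e ⊑ f} {p})

  equal : ∀ {hs} → SetFacts hs → ∀ e f → {T (includes (length env) hs (e ⊑ f))} →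
          {T (includes (length env) hs (f ⊑ e))} → ⟦ e ⟧ ≡ ⟦ f ⟧
  equal Hs e f {p} {q} = ⊆-antisym (contained Hs e f {p}) (contained Hs f e {q})

module _ {n : ℕ} where

  ∣∩∣+∣─∣ : ∀ (X Y : Subset n) → ∣ X ∩ Y ∣ + ∣ X ─ Y ∣ ≡ ∣ X ∣
  ∣∩∣+∣─∣ = go
    where
    go : ∀ {n} (X Y : Subset n) → ∣ X ∩ Y ∣ + ∣ X ─ Y ∣ ≡ ∣ X ∣
    go []            []            = refl
    go (inside  ∷ X) (inside  ∷ Y) = cong suc (go X Y)
    go (inside  ∷ X) (outside ∷ Y) = trans (ℕ.+-suc ∣ X ∩ Y ∣ _) (cong suc (go X Y))
    go (outside ∷ X) (inside  ∷ Y) = go X Y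
    go (outside ∷ X) (outside ∷ Y) = go X Y

  ∣∣-split : ∀ {X Y : Subset n} → Y ⊆ X → ∣ Y ∣ + ∣ X ─ Y ∣ ≡ ∣ X ∣
  ∣∣-split {X} {Y} Y⊆X = trans (cong (λ Z → ∣ Z ∣ + ∣ X ─ Y ∣) Y≡) (∣∩∣+∣─∣ X Y)
    where
    open Sets (X ∷ Y ∷ [])
    Y≡ : Y ≡ X ∩ Y
    Y≡ = equal (incl (var 1 ⊑ var 0) Y⊆X ∷ []) (var 1) (var 0 ⊓ var 1)

  ∉─ : ∀ {X Y : Subset n} {x} → x ∈ X ─ Y → x ∉ Y
  ∉─ {X} {Y} x∈ x∈Y = ∉⊥ (contained [] ((var 0 ⊖ var 1) ⊓ var 1) (const false) (x∈p∩q⁺ (x∈ , x∈Y)))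
    where open Sets (X ∷ Y ∷ [])

  ∣∣≥1⇒∈ : ∀ {S : Subset n} → 1 ≤ ∣ S ∣ → Nonempty S
  ∣∣≥1⇒∈ {S} 1≤S with nonempty? S
  ... | yes ne = ne
  ... | no  e  = ⊥-elim (ℕ.<⇒≱ 1≤S (ℕ.≤-reflexive (trans (cong ∣_∣ (Empty-unique e)) (∣⊥∣≡0 n))))

  ∈⇒∣∣≥1 : ∀ {S : Subset n} {x} → x ∈ S → 1 ≤ ∣ S ∣
  ∈⇒∣∣≥1 {S} {x} x∈S = ℕ.≤-trans (ℕ.≤-reflexive (sym (∣⁅x⁆∣≡1 x))) (p⊆q⇒∣p∣≤∣q∣ (⁅⁆-⊆ x∈S))

  ∣─⁅⁆∣ : ∀ {S : Subset n} {x} → x ∈ S → suc ∣ S ─ ⁅ x ⁆ ∣ ≡ ∣ S ∣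
  ∣─⁅⁆∣ {S} {x} x∈S = trans (cong (_+ ∣ S ─ ⁅ x ⁆ ∣) (sym (∣⁅x⁆∣≡1 x))) (∣∣-split (⁅⁆-⊆ x∈S))

  ∣∣≥2⇒≢ : ∀ {S : Subset n} → 2 ≤ ∣ S ∣ → ∃[ s ] ∃[ t ] s ∈ S × t ∈ S × s ≢ t
  ∣∣≥2⇒≢ {S} 2≤S with ∣∣≥1⇒∈ (ℕ.≤-trans (s≤s z≤n) 2≤S)
  ... | s , s∈S with ∣∣≥1⇒∈ (ℕ.≤-pred (ℕ.≤-trans 2≤S (ℕ.≤-reflexive (sym (∣─⁅⁆∣ s∈S)))))
  ...   | t , t∈ = s , t , s∈S , p─q⊆p S ⁅ s ⁆ t∈ , λ { refl → ∉─ t∈ (x∈⁅x⁆ t) }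

  ∣pair∣ : ∀ {x y : Fin n} → x ≢ y → ∣ ⁅ x ⁆ ∪ ⁅ y ⁆ ∣ ≡ 2
  ∣pair∣ {x} {y} x≢y = trans (sym (∣─⁅⁆∣ x∈)) (cong suc (trans (cong ∣_∣ y≡) (∣⁅x⁆∣≡1 y)))
    where
    open Sets (⁅ x ⁆ ∷ ⁅ y ⁆ ∷ [])
    x∈ : x ∈ ⁅ x ⁆ ∪ ⁅ y ⁆
    x∈ = x∈p∪q⁺ (inj₁ (x∈⁅x⁆ x))
    y≡ : (⁅ x ⁆ ∪ ⁅ y ⁆) ─ ⁅ x ⁆ ≡ ⁅ y ⁆
    y≡ = equal (incl (var 0 ⊓ var 1 ⊑ const false) (⁅⁆-≢ x≢y) ∷ []) ((var 0 ⊔ var 1) ⊖ var 0) (var 1)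

module _ {m} (P : Matroid m) where

  total-rank : RankFunction m
  total-rank = record
    { rank      = λ X → r P (X ∩ E P)
    ; rank-⊥    = ℕ.n≤0⇒n≡0 (ℕ.≤-trans (r-bounded P _ (p∩q⊆q ⊥ (E P)))
                    (ℕ.≤-trans (p⊆q⇒∣p∣≤∣q∣ (p∩q⊆p ⊥ (E P))) (ℕ.≤-reflexive (∣⊥∣≡0 m))))
    ; rank-mono = λ X Y X⊆Y → r-monotone P _ _ (∩-mono X⊆Y) (p∩q⊆q Y (E P))
    ; rank-sub  = ∩-sub }
    where
    ∩-mono : ∀ {X Y} → X ⊆ Y → X ∩ E P ⊆ Y ∩ E P
    ∩-mono {X} {Y} X⊆Y = contained (incl (var 0 ⊑ var 1) X⊆Y ∷ []) (var 0 ⊓ var 2) (var 1 ⊓ var 2)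
      where open Sets (X ∷ Y ∷ E P ∷ [])

    ∩-sub : ∀ X Y → r P ((X ∪ Y) ∩ E P) + r P ((X ∩ Y) ∩ E P) ≤ r P (X ∩ E P) + r P (Y ∩ E P)
    ∩-sub X Y = subst (_≤ r P (X ∩ E P) + r P (Y ∩ E P))
      (cong₂ (λ U V → r P U + r P V)
        (equal [] (var 0 ⊓ var 2 ⊔ var 1 ⊓ var 2) ((var 0 ⊔ var 1) ⊓ var 2))
        (equal [] ((var 0 ⊓ var 2) ⊓ (var 1 ⊓ var 2)) ((var 0 ⊓ var 1) ⊓ var 2)))
      (r-submodular P _ _ (p∩q⊆q X (E P)) (p∩q⊆q Y (E P)))
      where open Sets (X ∷ Y ∷ E P ∷ [])

  total-rank-⊆ : ∀ {X} → X ⊆ E P → RankFunction.rank total-rank X ≡ r P X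
  total-rank-⊆ {X} X⊆E = cong (r P) (⊆-antisym (p∩q⊆p X (E P)) λ x∈ → x∈p∩q⁺ (x∈ , X⊆E x∈))

  r-∪ : ∀ X Y → X ⊆ E P → Y ⊆ E P → r P (X ∪ Y) ≤ r P X + r P Y
  r-∪ X Y X⊆E Y⊆E = ℕ.≤-trans (ℕ.m≤m+n _ _) (r-submodular P X Y X⊆E Y⊆E)

  dual-rank : ∀ {X} → X ⊆ E P → r (P *) X + r P (E P) ≡ ∣ X ∣ + r P (E P ─ X)
  dual-rank {X} X⊆E = ℕ.m∸n+n≡m (begin
    r P (E P)                ≡⟨ cong (r P) E≡ ⟩
    r P (X ∪ (E P ─ X))      ≤⟨ r-∪ X (E P ─ X) X⊆E (p─q⊆p (E P) X) ⟩
    r P X + r P (E P ─ X)    ≤⟨ ℕ.+-monoˡ-≤ _ (r-bounded P X X⊆E) ⟩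
    ∣ X ∣ + r P (E P ─ X)    ∎)
    where
    open ℕ.≤-Reasoning
    open Sets (X ∷ E P ∷ [])
    E≡ : E P ≡ X ∪ (E P ─ X)
    E≡ = equal (incl (var 0 ⊑ var 1) X⊆E ∷ []) (var 1) (var 0 ⊔ (var 1 ⊖ var 0))

-- Contraction is a dual of a deletion of a dual. Adding ∣ E P ─ C ∣ to both sides lets each dual
-- rank be expanded by `dual-rank`, without truncated subtraction.
contract-rank : ∀ {m} (P : Matroid m) {C X} → C ⊆ E P → X ⊆ E P ─ C → r (P / C) X + r P C ≡ r P (X ∪ C)
contract-rank {m} P {C} {X} C⊆E X⊆ = ℕ.+-cancelˡ-≡ ∣ E P ─ C ∣ _ _ (begin
  ∣ E P ─ C ∣ + (r (P / C) X + r P C)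
    ≡⟨ +-exchange ∣ E P ─ C ∣ (r (P / C) X) (r P C) ⟩
  r (P / C) X + (∣ E P ─ C ∣ + r P C)
    ≡⟨ cong (λ Y → r (P / C) X + (∣ E P ─ C ∣ + r P Y)) C≡ ⟩
  r (P / C) X + (∣ E P ─ C ∣ + r P (E P ─ (E P ─ C)))
    ≡⟨ cong (r (P / C) X +_) (sym (dual-rank P (p─q⊆p (E P) C))) ⟩
  r (P / C) X + (r (P *) (E P ─ C) + r P (E P))
    ≡⟨ sym (ℕ.+-assoc (r (P / C) X) _ _) ⟩
  r (P / C) X + r (P *) (E P ─ C) + r P (E P)
    ≡⟨ cong (_+ r P (E P)) (dual-rank (P * ∖ C) X⊆) ⟩
  ∣ X ∣ + r (P *) (E P ─ C ─ X) + r P (E P)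
    ≡⟨ ℕ.+-assoc ∣ X ∣ _ _ ⟩
  ∣ X ∣ + (r (P *) (E P ─ C ─ X) + r P (E P))
    ≡⟨ cong (∣ X ∣ +_) (dual-rank P rest⊆) ⟩
  ∣ X ∣ + (∣ E P ─ C ─ X ∣ + r P (E P ─ (E P ─ C ─ X)))
    ≡⟨ sym (ℕ.+-assoc ∣ X ∣ _ _) ⟩
  ∣ X ∣ + ∣ E P ─ C ─ X ∣ + r P (E P ─ (E P ─ C ─ X))
    ≡⟨ cong₂ (λ a Y → a + r P Y) (∣∣-split X⊆) XC≡ ⟩
  ∣ E P ─ C ∣ + r P (X ∪ C) ∎)
  where
  open ≡-Reasoning
  open Sets (X ∷ C ∷ E P ∷ [])
  𝐗 = var 0
  𝐂 = var 1
  𝐄 = var 2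
  H : SetFacts _
  H = incl (𝐂 ⊑ 𝐄) C⊆E ∷ incl (𝐗 ⊑ 𝐄 ⊖ 𝐂) X⊆ ∷ []
  C≡ : C ≡ E P ─ (E P ─ C)
  C≡ = equal H 𝐂 (𝐄 ⊖ (𝐄 ⊖ 𝐂))
  rest⊆ : E P ─ C ─ X ⊆ E P
  rest⊆ = contained H (𝐄 ⊖ 𝐂 ⊖ 𝐗) 𝐄
  XC≡ : E P ─ (E P ─ C ─ X) ≡ X ∪ C
  XC≡ = equal H (𝐄 ⊖ (𝐄 ⊖ 𝐂 ⊖ 𝐗)) (𝐗 ⊔ 𝐂)

r-∪-⊆ : ∀ {m} (P : Matroid m) {X Y Z} → X ⊆ E P → Y ⊆ E P → Z ⊆ X ∪ Y → r P Z ≤ r P X + r P Y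
r-∪-⊆ P {X} {Y} X⊆E Y⊆E Z⊆ = ℕ.≤-trans (r-monotone P _ _ Z⊆ (∪-⊆ X⊆E Y⊆E)) (r-∪ P X Y X⊆E Y⊆E)

unseparated : ∀ {m n k} (P : Matroid m) → Connected n P → 1 ≤ k → k < n → ∀ {X} → X ⊆ E P →
              k ≤ ∣ X ∣ → k ≤ ∣ E P ─ X ∣ → r P (E P) + k ≤ r P X + r P (E P ─ X)
unseparated {k = k} P conn 1≤k k<n {X} X⊆E k≤X k≤Y
  with ℕ.≤-<-connex (r P (E P) + k) (r P X + r P (E P ─ X))
... | inj₁ h = h
... | inj₂ h = ⊥-elim (conn k 1≤k k<n (X , X⊆E , small , k≤X , k≤Y))
  where
  small : connectivity P X < k
  small = ℕ.+-cancelˡ-< (r P (E P)) _ _ (subst (_< r P (E P) + k) (sym (ℕ.m+[n∸m]≡n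
    (r-∪-⊆ P X⊆E (p─q⊆p (E P) X) (contained [] (var 1) (var 0 ⊔ (var 1 ⊖ var 0)))))) h)
    where open Sets (X ∷ E P ∷ [])

record Simple {m} (P : Matroid m) : Set where
  field
    nonloop : ∀ {x} → x ∈ E P → 1 ≤ r P ⁅ x ⁆
    pair    : ∀ {x y} → x ∈ E P → y ∈ E P → x ≢ y → 2 ≤ r P (⁅ x ⁆ ∪ ⁅ y ⁆)

module _ {m} (P : Matroid m) (conn : Connected 3 P) (4≤E : 4 ≤ ∣ E P ∣) where
  private
    open RankFunction (total-rank P)

    1≤2 : 1 ≤ 2
    1≤2 = s≤s z≤n

    E─-card : ∀ {X k j} → X ⊆ E P → ∣ X ∣ ≤ k → k + j ≤ ∣ E P ∣ → j ≤ ∣ E P ─ X ∣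
    E─-card {X} {k} {j} X⊆E X≤k h = ℕ.+-cancelˡ-≤ k _ _ (ℕ.≤-trans h
      (ℕ.≤-trans (ℕ.≤-reflexive (sym (∣∣-split X⊆E))) (ℕ.+-monoˡ-≤ _ X≤k)))

    rank-≤∣∩∣ : ∀ X → rank X ≤ ∣ X ∩ E P ∣
    rank-≤∣∩∣ X = r-bounded P _ (p∩q⊆q X (E P))

    -- A set of size at most two leaves at least two elements of the ground set outside, as
    -- `4 ≤ ∣ E P ∣`. A rank below k would make it one side of a k-separation.
    r≥ : ∀ {X k} → 1 ≤ k → k < 3 → k ≤ ∣ X ∣ → ∣ X ∣ ≤ 2 → X ⊆ E P → k ≤ r P X
    r≥ {X} {k} 1≤k k<3 k≤X X≤2 X⊆E = ℕ.+-cancelʳ-≤ (r P (E P)) _ _ (ℕ.≤-trans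
      (ℕ.≤-trans (ℕ.≤-reflexive (ℕ.+-comm k _))
        (unseparated P conn 1≤k k<3 X⊆E k≤X
          (ℕ.≤-trans (ℕ.≤-pred k<3) (E─-card X⊆E X≤2 4≤E))))
      (ℕ.+-monoʳ-≤ (r P X) (r-monotone P _ _ (p─q⊆p (E P) X) ⊆-refl)))

  r-nonloop : ∀ {x} → x ∈ E P → 1 ≤ r P ⁅ x ⁆
  r-nonloop {x} x∈E = r≥ ℕ.≤-refl 1<3 (ℕ.≤-reflexive (sym (∣⁅x⁆∣≡1 x)))
    (ℕ.≤-trans (ℕ.≤-reflexive (∣⁅x⁆∣≡1 x)) 1≤2) (⁅⁆-⊆ x∈E)
    where
    1<3 : 1 < 3
    1<3 = s≤s 1≤2

  r-pair : ∀ {x y} → x ∈ E P → y ∈ E P → x ≢ y → 2 ≤ r P (⁅ x ⁆ ∪ ⁅ y ⁆)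
  r-pair x∈E y∈E x≢y = r≥ 1≤2 ℕ.≤-refl (ℕ.≤-reflexive (sym (∣pair∣ x≢y)))
    (ℕ.≤-reflexive (∣pair∣ x≢y)) (∪-⊆ (⁅⁆-⊆ x∈E) (⁅⁆-⊆ y∈E))

  connected⇒simple : Simple P
  connected⇒simple = record { nonloop = r-nonloop ; pair = r-pair }

  private
    -- By simplicity Y meets the ground set in at most one element, and deleting one element
    -- preserves the rank because there is no 1-separation.
    cover-rank : ∀ X Y → E P ⊆ X ∪ Y → rank Y ≤ 1 → rank (E P) ≤ rank X
    cover-rank X Y E⊆ Y≤1 with nonempty? (Y ∩ E P)
    ... | no  e = rank-mono _ _ λ x∈E → [ (λ x → x) , (λ x∈Y → ⊥-elim (e (_ , x∈p∩q⁺ (x∈Y , x∈E)))) ]′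
                                         (x∈p∪q⁻ X Y (E⊆ x∈E))
    ... | yes (y , y∈) = ℕ.≤-trans (ℕ.≤-reflexive (total-rank-⊆ P ⊆-refl)) (ℕ.+-cancelʳ-≤ 1 _ _ (begin
        r P (E P) + 1                      ≤⟨ unseparated P conn ℕ.≤-refl (s≤s 1≤2) y⊆E
                                                (ℕ.≤-reflexive (sym (∣⁅x⁆∣≡1 y)))
                                                (ℕ.≤-trans (s≤s z≤n) (E─-card {k = 1} y⊆E (ℕ.≤-reflexive (∣⁅x⁆∣≡1 y)) 4≤E)) ⟩
        r P ⁅ y ⁆ + r P (E P ─ ⁅ y ⁆)      ≤⟨ ℕ.+-mono-≤ (ℕ.≤-trans (r-bounded P _ y⊆E) (ℕ.≤-reflexive (∣⁅x⁆∣≡1 y)))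
                                                (r-monotone P _ _ rest⊆ (p∩q⊆q X (E P))) ⟩
        1 + rank X                         ≡⟨ ℕ.+-comm 1 (rank X) ⟩
        rank X + 1                         ∎))
      where
      open ℕ.≤-Reasoning
      y∈E : y ∈ E P
      y∈E = p∩q⊆q Y (E P) y∈
      y⊆E : ⁅ y ⁆ ⊆ E P
      y⊆E = ⁅⁆-⊆ y∈E
      rest⊆ : E P ─ ⁅ y ⁆ ⊆ X ∩ E P
      rest⊆ {z} z∈ with x∈p∪q⁻ X Y (E⊆ (p─q⊆p (E P) ⁅ y ⁆ z∈)) | z ≟ y
      ... | _        | yes refl = ⊥-elim (∉─ z∈ (x∈⁅x⁆ z))
      ... | inj₁ z∈X | no _ = x∈p∩q⁺ (z∈X , p─q⊆p (E P) ⁅ y ⁆ z∈)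
      ... | inj₂ z∈Y | no z≢y = ⊥-elim (ℕ.<⇒≱ (r-pair z∈E y∈E z≢y) (ℕ.≤-trans
              (r-monotone P _ _ (∪-⊆ (⁅⁆-⊆ (x∈p∩q⁺ (z∈Y , z∈E))) (⁅⁆-⊆ y∈)) (p∩q⊆q Y (E P))) Y≤1))
        where
        z∈E : z ∈ E P
        z∈E = p─q⊆p (E P) ⁅ y ⁆ z∈

  three-connected : ThreeConnected m
  three-connected = record
    { ground       = E P
    ; rank-fun     = total-rank P
    ; rank-single  = λ x → ℕ.≤-trans (rank-≤∣∩∣ ⁅ x ⁆)
                       (ℕ.≤-trans (p⊆q⇒∣p∣≤∣q∣ (p∩q⊆p ⁅ x ⁆ (E P))) (ℕ.≤-reflexive (∣⁅x⁆∣≡1 x)))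
    ; rank-nonloop = λ x∈E → ℕ.≤-trans (r-nonloop x∈E) (ℕ.≤-reflexive (sym (total-rank-⊆ P (⁅⁆-⊆ x∈E))))
    ; rank-pair    = λ x∈E y∈E x≢y → ℕ.≤-trans (r-pair x∈E y∈E x≢y)
                       (ℕ.≤-reflexive (sym (total-rank-⊆ P (∪-⊆ (⁅⁆-⊆ x∈E) (⁅⁆-⊆ y∈E)))))
    ; connected₁   = cover-rank
    ; connected₂   = cover-rank₂ }
    where
    cover-rank₂ : ∀ X Y → E P ⊆ X ∪ Y → 2 ≤ rank X → 2 ≤ rank Y → rank (E P) + 2 ≤ rank X + rank Y
    cover-rank₂ X Y E⊆ 2≤X 2≤Y with ℕ.≤-<-connex (rank (E P ─ X)) 1
    -- Here E P ─ X may have fewer than two elements, so the absence of 2-separations says nothing.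
    -- But then X spans, and the 2 comes from Y.
    ... | inj₁ h = ℕ.+-mono-≤ (cover-rank X (E P ─ X) (contained [] (var 1) (var 0 ⊔ (var 1 ⊖ var 0))) h) 2≤Y
      where open Sets (X ∷ E P ∷ [])
    ... | inj₂ h = begin
      rank (E P) + 2                       ≡⟨ cong (_+ 2) (total-rank-⊆ P ⊆-refl) ⟩
      r P (E P) + 2                        ≤⟨ unseparated P conn 1≤2 ℕ.≤-refl (p∩q⊆q X (E P)) (ℕ.≤-trans 2≤X (rank-≤∣∩∣ X))
                                                (ℕ.≤-trans h (ℕ.≤-trans (rank-≤∣∩∣ (E P ─ X)) (p⊆q⇒∣p∣≤∣q∣
                                                  (contained [] ((var 1 ⊖ var 0) ⊓ var 1) (var 1 ⊖ var 0 ⊓ var 1))))) ⟩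
      rank X + r P (E P ─ X ∩ E P)         ≤⟨ ℕ.+-monoʳ-≤ (rank X) (r-monotone P _ _
                                                (contained (incl (var 1 ⊑ var 0 ⊔ var 2) E⊆ ∷ []) (var 1 ⊖ var 0 ⊓ var 1) (var 2 ⊓ var 1))
                                                (p∩q⊆q Y (E P))) ⟩
      rank X + rank Y                      ∎
      where
      open ℕ.≤-Reasoning
      open Sets (X ∷ E P ∷ Y ∷ [])

-- Circuits and simplification

module _ {n : ℕ} {P : Fin n → Set} (P? : ∀ x → Dec (P x)) where

  select : Subset n
  select = tabulate (λ x → does (P? x))

  ∈-select⁺ : ∀ {x} → P x → x ∈ select
  ∈-select⁺ {x} p = lookup⇒[]= x _ (trans (lookup∘tabulate _ x) (dec-true (P? x) p))

  ∈-select⁻ : ∀ {x} → x ∈ select → P x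
  ∈-select⁻ {x} x∈ with P? x in eq
  ... | yes p = p
  ... | no  _ with () ← trans (sym ([]=⇒lookup x∈)) (trans (lookup∘tabulate _ x) (cong does eq))

module _ {m} (P : Matroid m) where

  private
    p─∪ : ∀ {X Y : Subset m} → X ⊆ Y → Y ⊆ X ∪ (Y ─ X)
    p─∪ {X} {Y} X⊆Y = contained [] (var 1) (var 0 ⊔ (var 1 ⊖ var 0))
      where open Sets (X ∷ Y ∷ [])

  independent-⊆ : ∀ {X Y} → Y ⊆ X → X ⊆ E P → ∣ X ∣ ≤ r P X → r P Y ≡ ∣ Y ∣
  independent-⊆ {X} {Y} Y⊆X X⊆E h = ℕ.≤-antisym (r-bounded P Y (⊆-trans Y⊆X X⊆E))
    (ℕ.+-cancelʳ-≤ ∣ X ─ Y ∣ _ _ (begin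
      ∣ Y ∣ + ∣ X ─ Y ∣      ≡⟨ ∣∣-split Y⊆X ⟩
      ∣ X ∣                  ≤⟨ h ⟩
      r P X                  ≤⟨ r-∪-⊆ P (⊆-trans Y⊆X X⊆E) X─Y⊆E (p─∪ Y⊆X) ⟩
      r P Y + r P (X ─ Y)    ≤⟨ ℕ.+-monoʳ-≤ (r P Y) (r-bounded P _ X─Y⊆E) ⟩
      r P Y + ∣ X ─ Y ∣      ∎))
    where
    open ℕ.≤-Reasoning
    X─Y⊆E : X ─ Y ⊆ E P
    X─Y⊆E = ⊆-trans (p─q⊆p X Y) X⊆E

  circuit⁺ : ∀ {C} → C ⊆ E P → r P C < ∣ C ∣ →
             (∀ {c} → c ∈ C → ∣ C ─ ⁅ c ⁆ ∣ ≤ r P (C ─ ⁅ c ⁆)) → Circuit P C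
  circuit⁺ {C} C⊆E C< ind = C⊆E , (λ (_ , eq) → ℕ.<-irrefl eq C<) , λ where
    Y (Y⊆C , c , c∈C , c∉Y) → ⊆-trans Y⊆C C⊆E ,
      independent-⊆ (λ y∈Y → x∈p∧x∉q⇒x∈p─q (Y⊆C y∈Y) λ y∈c → c∉Y (subst (_∈ Y) (x∈⁅y⁆⇒x≡y c y∈c) y∈Y))
                    (⊆-trans (p─q⊆p C ⁅ c ⁆) C⊆E) (ind c∈C)

  circuit-rank : ∀ {C} → Circuit P C → r P C < ∣ C ∣
  circuit-rank {C} (C⊆E , dep , _) = ℕ.≤∧≢⇒< (r-bounded P C C⊆E) λ eq → dep (C⊆E , eq)

  circuit-rank─ : ∀ {C c} → Circuit P C → c ∈ C → r P (C ─ ⁅ c ⁆) ≡ ∣ C ─ ⁅ c ⁆ ∣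
  circuit-rank─ {C} {c} (_ , _ , ind) c∈C = proj₂ (ind _ (p─q⊆p C ⁅ c ⁆ , c , c∈C , λ c∈ → ∉─ c∈ (x∈⁅x⁆ c)))

  loop⁺ : ∀ {e} → e ∈ E P → r P ⁅ e ⁆ < 1 → Loop P e
  loop⁺ {e} e∈E h = circuit⁺ (⁅⁆-⊆ e∈E) (subst (r P ⁅ e ⁆ <_) (sym (∣⁅x⁆∣≡1 e)) h) λ c∈e →
    case x∈⁅y⁆⇒x≡y e c∈e of λ where
      refl → ℕ.≤-trans (ℕ.≤-reflexive (ℕ.suc-injective (trans (∣─⁅⁆∣ c∈e) (∣⁅x⁆∣≡1 e)))) z≤n

  loop⁻ : ∀ {e} → Loop P e → r P ⁅ e ⁆ < 1
  loop⁻ {e} l = subst (r P ⁅ e ⁆ <_) (∣⁅x⁆∣≡1 e) (circuit-rank l)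

  module _ {f e : Fin m} where
    private
      open Sets (⁅ f ⁆ ∷ ⁅ e ⁆ ∷ [])
      pair─f : f ≢ e → (⁅ f ⁆ ∪ ⁅ e ⁆) ─ ⁅ f ⁆ ≡ ⁅ e ⁆
      pair─f f≢e = equal (incl (var 0 ⊓ var 1 ⊑ const false) (⁅⁆-≢ f≢e) ∷ []) ((var 0 ⊔ var 1) ⊖ var 0) (var 1)
      pair─e : f ≢ e → (⁅ f ⁆ ∪ ⁅ e ⁆) ─ ⁅ e ⁆ ≡ ⁅ f ⁆
      pair─e f≢e = equal (incl (var 0 ⊓ var 1 ⊑ const false) (⁅⁆-≢ f≢e) ∷ []) ((var 0 ⊔ var 1) ⊖ var 1) (var 0)

    parallel⁺ : f ∈ E P → e ∈ E P → f ≢ e → 1 ≤ r P ⁅ f ⁆ → 1 ≤ r P ⁅ e ⁆ →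
                r P (⁅ f ⁆ ∪ ⁅ e ⁆) < 2 → Parallel P f e
    parallel⁺ f∈E e∈E f≢e 1≤f 1≤e h = f≢e , circuit⁺ (∪-⊆ (⁅⁆-⊆ f∈E) (⁅⁆-⊆ e∈E))
      (subst (r P (⁅ f ⁆ ∪ ⁅ e ⁆) <_) (sym (∣pair∣ f≢e)) h) λ c∈ → case x∈p∪q⁻ ⁅ f ⁆ ⁅ e ⁆ c∈ of λ where
        (inj₁ c∈f) → case x∈⁅y⁆⇒x≡y f c∈f of λ where
          refl → subst (λ Y → ∣ Y ∣ ≤ r P Y) (sym (pair─f f≢e)) (subst (_≤ r P ⁅ e ⁆) (sym (∣⁅x⁆∣≡1 e)) 1≤e)
        (inj₂ c∈e) → case x∈⁅y⁆⇒x≡y e c∈e of λ where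
          refl → subst (λ Y → ∣ Y ∣ ≤ r P Y) (sym (pair─e f≢e)) (subst (_≤ r P ⁅ f ⁆) (sym (∣⁅x⁆∣≡1 f)) 1≤f)

    parallel⁻ : Parallel P f e → r P (⁅ f ⁆ ∪ ⁅ e ⁆) < 2 × r P ⁅ f ⁆ ≡ 1 × r P ⁅ e ⁆ ≡ 1
    parallel⁻ (f≢e , c) =
      subst (r P (⁅ f ⁆ ∪ ⁅ e ⁆) <_) (∣pair∣ f≢e) (circuit-rank c) ,
      trans (subst (λ Y → r P Y ≡ ∣ Y ∣) (pair─e f≢e) (circuit-rank─ c (x∈p∪q⁺ (inj₂ (x∈⁅x⁆ e))))) (∣⁅x⁆∣≡1 f) ,
      trans (subst (λ Y → r P Y ≡ ∣ Y ∣) (pair─f f≢e) (circuit-rank─ c (x∈p∪q⁺ (inj₁ (x∈⁅x⁆ f))))) (∣⁅x⁆∣≡1 e)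

  redundant : Subset m
  redundant = select (redundant? P)

  si-nonloop : ∀ {e} → e ∈ E (si P) → 1 ≤ r P ⁅ e ⁆
  si-nonloop {e} e∈ with ℕ.≤-<-connex 1 (r P ⁅ e ⁆)
  ... | inj₁ h = h
  ... | inj₂ h = ⊥-elim (∉─ e∈ (∈-select⁺ (redundant? P) (inj₁ (loop⁺ (p─q⊆p (E P) redundant e∈) h))))

  si-simple : ∀ {e f} → e ∈ E (si P) → f ∈ E (si P) → e ≢ f → 2 ≤ r P (⁅ e ⁆ ∪ ⁅ f ⁆)
  si-simple {e} {f} e∈ f∈ e≢f with ℕ.≤-<-connex 2 (r P (⁅ e ⁆ ∪ ⁅ f ⁆))
  ... | inj₁ h = h
  ... | inj₂ h with <-cmp e f
  ...   | tri≈ _ e≡f _ = ⊥-elim (e≢f e≡f)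
  ...   | tri< e<f _ _ = ⊥-elim (∉─ f∈ (∈-select⁺ (redundant? P) (inj₂ (e , e<f ,
            parallel⁺ (p─q⊆p (E P) redundant e∈) (p─q⊆p (E P) redundant f∈) e≢f (si-nonloop e∈) (si-nonloop f∈) h))))
  ...   | tri> _ _ f<e = ⊥-elim (∉─ e∈ (∈-select⁺ (redundant? P) (inj₂ (f , f<e ,
            parallel⁺ (p─q⊆p (E P) redundant f∈) (p─q⊆p (E P) redundant e∈) (λ f≡e → e≢f (sym f≡e))
              (si-nonloop f∈) (si-nonloop e∈) (subst (λ Y → r P Y < 2) (∪-comm ⁅ e ⁆ ⁅ f ⁆) h)))))

module _ {m} (R : RankFunction m) where
  open RankFunction R

  spanned : ∀ S T → (∀ {t} → t ∈ T → rank (S ∪ ⁅ t ⁆) ≤ rank S) → rank (S ∪ T) ≤ rank S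
  spanned S T = go ∣ T ∣ T refl
    where
    go : ∀ k T → ∣ T ∣ ≡ k → (∀ {t} → t ∈ T → rank (S ∪ ⁅ t ⁆) ≤ rank S) → rank (S ∪ T) ≤ rank S
    go k T k≡ cl with nonempty? T
    ... | no  e = rank-mono _ _ λ x∈ → [ (λ x → x) , (λ x∈T → ⊥-elim (e (_ , x∈T))) ]′ (x∈p∪q⁻ S T x∈)
    go ℕ.zero  T k≡ cl | yes (t , t∈T) = ⊥-elim (ℕ.<⇒≱ (∈⇒∣∣≥1 t∈T) (ℕ.≤-reflexive k≡))
    go (suc k) T k≡ cl | yes (t , t∈T) = holds (by-ranks
      (incl (𝐭 ⊑ 𝐓) (⁅⁆-⊆ t∈T) ∷ [])
      (sub (𝐒 ⊔ (𝐓 ⊖ 𝐭)) (𝐒 ⊔ 𝐭) ∷ fact (ρ 𝐒 ⊔ 𝐭 ≼ ρ 𝐒) (cl t∈T) ∷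
       fact (ρ 𝐒 ⊔ (𝐓 ⊖ 𝐭) ≼ ρ 𝐒) (go k (T ─ ⁅ t ⁆) (ℕ.suc-injective (trans (∣─⁅⁆∣ t∈T) k≡))
         (λ x∈ → cl (p─q⊆p T ⁅ t ⁆ x∈))) ∷ []) {ρ 𝐒 ⊔ 𝐓 ≼ ρ 𝐒})
      where
      open Reasoning R (S ∷ T ∷ ⁅ t ⁆ ∷ [])
      𝐒 = var 0
      𝐓 = var 1
      𝐭 = var 2

-- The element e is a loop, parallel to the nonloop s, or equal to it, so it lies in the span of s.
absorb : ∀ {m} (P : Matroid m) → let open RankFunction (total-rank P) in
  ∀ {S s e} → s ∈ S → 1 ≤ rank ⁅ s ⁆ → rank (⁅ s ⁆ ∪ ⁅ e ⁆) ≤ 1 → rank (S ∪ ⁅ e ⁆) ≤ rank S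
absorb P {S} {s} {e} s∈S 1≤s se = holds (by-ranks (incl (var 2 ⊑ var 0) (⁅⁆-⊆ s∈S) ∷ [])
  (sub (var 0) (var 2 ⊔ var 1) ∷ fact (ρ var 2 ⊔ var 1 ≼ # 1) se ∷ fact (# 1 ≼ ρ var 2) 1≤s ∷ [])
  {ρ var 0 ⊔ var 1 ≼ ρ var 0})
  where open Reasoning (total-rank P) (S ∷ ⁅ e ⁆ ∷ ⁅ s ⁆ ∷ [])

module _ {m} (P : Matroid m) where
  open RankFunction (total-rank P)

  total-single : ∀ x → rank ⁅ x ⁆ ≤ 1
  total-single x = ℕ.≤-trans (r-bounded P _ (p∩q⊆q ⁅ x ⁆ (E P)))
    (ℕ.≤-trans (p⊆q⇒∣p∣≤∣q∣ (p∩q⊆p ⁅ x ⁆ (E P))) (ℕ.≤-reflexive (∣⁅x⁆∣≡1 x)))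

  si⊆ : E (si P) ⊆ E P
  si⊆ = p─q⊆p (E P) (redundant P)

  kept-nonloop : ∀ {s} → s ∈ E (si P) → 1 ≤ rank ⁅ s ⁆
  kept-nonloop s∈ = ℕ.≤-trans (si-nonloop P s∈) (ℕ.≤-reflexive (sym (total-rank-⊆ P (⁅⁆-⊆ (si⊆ s∈)))))

  -- The element f that makes e redundant may be redundant itself. It precedes e in `Fin`, so
  -- following such elements ends at one that is kept, and parallelism is transitive through the
  -- nonloop f.
  representative : ∀ {e} → e ∈ E P → rank ⁅ e ⁆ ≤ 0 ⊎ ∃[ s ] s ∈ E (si P) × rank (⁅ s ⁆ ∪ ⁅ e ⁆) ≤ 1
  representative {e} e∈E = go (<-wellFounded e) e∈E
    where
    go : ∀ {e} → Acc _<ᶠ_ e → e ∈ E P → rank ⁅ e ⁆ ≤ 0 ⊎ ∃[ s ] s ∈ E (si P) × rank (⁅ s ⁆ ∪ ⁅ e ⁆) ≤ 1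
    go {e} (acc rec) e∈E with redundant? P e
    ... | yes (inj₁ l) = inj₁ (ℕ.≤-pred (subst (_< 1) (sym (total-rank-⊆ P (⁅⁆-⊆ e∈E))) (loop⁻ P l)))
    ... | no ¬red = inj₂ (e , x∈p∧x∉q⇒x∈p─q e∈E (λ e∈ → ¬red (∈-select⁻ (redundant? P) e∈)) ,
            ℕ.≤-trans (rank-mono _ _ (∪-⊆ ⊆-refl ⊆-refl)) (total-single e))
    ... | yes (inj₂ (f , f<e , p)) with parallel⁻ P p | p∪q⊆ (proj₁ (proj₂ p))
      where
      p∪q⊆ : ⁅ f ⁆ ∪ ⁅ e ⁆ ⊆ E P → f ∈ E P
      p∪q⊆ h = h (x∈p∪q⁺ (inj₁ (x∈⁅x⁆ f)))
    ...   | fe , f≡1 , e≡1 | f∈E with go (rec f<e) f∈E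
    ...     | inj₁ h = ⊥-elim (ℕ.<⇒≱ (ℕ.≤-reflexive (sym (trans (total-rank-⊆ P (⁅⁆-⊆ f∈E)) f≡1))) h)
    ...     | inj₂ (s , s∈ , sf) = inj₂ (s , s∈ , holds (by-ranks []
        (sub (𝐬 ⊔ 𝐟) (𝐟 ⊔ 𝐞) ∷ fact (ρ 𝐬 ⊔ 𝐟 ≼ # 1) sf ∷
         fact (ρ 𝐟 ⊔ 𝐞 ≼ # 1) (ℕ.≤-pred (subst (_< 2) (sym (total-rank-⊆ P (∪-⊆ (⁅⁆-⊆ f∈E) (⁅⁆-⊆ e∈E)))) fe)) ∷
         fact (# 1 ≼ ρ 𝐟) (ℕ.≤-reflexive (sym (trans (total-rank-⊆ P (⁅⁆-⊆ f∈E)) f≡1))) ∷ []) {ρ 𝐬 ⊔ 𝐞 ≼ # 1}))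
      where
      open Reasoning (total-rank P) (⁅ s ⁆ ∷ ⁅ f ⁆ ∷ ⁅ e ⁆ ∷ [])
      𝐬 = var 0
      𝐟 = var 1
      𝐞 = var 2

  -- Removed elements are spanned by their representatives. `A′` takes all of cl(A) except the
  -- elements of B; what is left then lies in cl(B).
  extend : ∀ {A B} → A ⊆ E (si P) → B ⊆ E (si P) → E (si P) ⊆ A ∪ B → A ∩ B ⊆ ⊥ →
    ∃[ A′ ] ∃[ B′ ] A ⊆ A′ × B ⊆ B′ × A′ ⊆ E P × B′ ⊆ E P × E P ⊆ A′ ∪ B′ × A′ ∩ B′ ⊆ ⊥ ×
      rank A′ ≤ rank A × rank B′ ≤ rank B
  extend {A} {B} A⊆ B⊆ cover disjoint = A′ , B′ , A⊆A′ , B⊆B′ ,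
    contained [] 𝐀′ 𝐄 , p─q⊆p (E P) A′ , contained [] 𝐄 (𝐀′ ⊔ (𝐄 ⊖ 𝐀′)) , contained [] (𝐀′ ⊓ (𝐄 ⊖ 𝐀′)) (const false) ,
    ℕ.≤-trans (rank-mono _ _ (q⊆p∪q A A′)) (spanned (total-rank P) A A′ A′-spanned) ,
    ℕ.≤-trans (rank-mono _ _ (q⊆p∪q B B′)) (spanned (total-rank P) B B′ B′-spanned)
    where
    closure? : ∀ e → Dec (rank (A ∪ ⁅ e ⁆) ≤ rank A)
    closure? e = rank (A ∪ ⁅ e ⁆) ℕ.≤? rank A
    clA = select closure?
    A′ B′ : Subset m
    A′ = (clA ∩ E P) ─ B
    B′ = E P ─ A′
    open Sets (clA ∷ E P ∷ A ∷ B ∷ [])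
    𝐜𝐥𝐀 = var 0
    𝐄 = var 1
    𝐀 = var 2
    𝐁 = var 3
    𝐀′ = (𝐜𝐥𝐀 ⊓ 𝐄) ⊖ 𝐁
    A⊆cl : A ⊆ clA
    A⊆cl {e} e∈A = ∈-select⁺ closure? (rank-mono _ _ (∪-⊆ ⊆-refl (⁅⁆-⊆ e∈A)))
    H : SetFacts _
    H = incl (𝐀 ⊑ 𝐜𝐥𝐀) A⊆cl ∷ incl (𝐀 ⊑ 𝐄) (⊆-trans A⊆ si⊆) ∷ incl (𝐁 ⊑ 𝐄) (⊆-trans B⊆ si⊆) ∷
        incl (𝐀 ⊓ 𝐁 ⊑ const false) disjoint ∷ []
    A⊆A′ : A ⊆ A′
    A⊆A′ = contained H 𝐀 𝐀′
    B⊆B′ : B ⊆ B′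
    B⊆B′ = contained H 𝐁 (𝐄 ⊖ 𝐀′)
    A′-spanned : ∀ {e} → e ∈ A′ → rank (A ∪ ⁅ e ⁆) ≤ rank A
    A′-spanned e∈ = ∈-select⁻ closure? (contained H 𝐀′ 𝐜𝐥𝐀 e∈)
    -- An element outside cl(A) has its representative in B.
    B′-spanned : ∀ {e} → e ∈ B′ → rank (B ∪ ⁅ e ⁆) ≤ rank B
    B′-spanned {e} e∈B′ with e ∈? B | representative (p─q⊆p (E P) A′ e∈B′)
    ... | yes e∈B | _ = rank-mono _ _ (∪-⊆ ⊆-refl (⁅⁆-⊆ e∈B))
    ... | no  e∉B | inj₁ h = R.holds (R.by-ranks R.[] (R.sub (var 0) (var 1) R.∷ R.fact (ρ var 1 ≼ # 0) h R.∷ R.[])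
                                       {ρ var 0 ⊔ var 1 ≼ ρ var 0})
      where module R = Reasoning (total-rank P) (B ∷ ⁅ e ⁆ ∷ [])
    ... | no  e∉B | inj₂ (s , s∈ , se) with x∈p∪q⁻ A B (cover s∈)
    ...   | inj₂ s∈B = absorb P s∈B (kept-nonloop s∈) se
    ...   | inj₁ s∈A = ⊥-elim (∉─ e∈B′ (x∈p∧x∉q⇒x∈p─q
              (x∈p∩q⁺ (∈-select⁺ closure? (absorb P s∈A (kept-nonloop s∈) se) , p─q⊆p (E P) A′ e∈B′)) e∉B))

module _ {m n : ℕ} (g : Fin n → Fin m) where

  private
    hit? : ∀ Z e → Dec (∃[ u ] u ∈ Z × g u ≡ e)
    hit? Z e = any? λ u → (u ∈? Z) ×-dec (g u ≟ e)

  image : Subset n → Subset m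
  image Z = select (hit? Z)

  ∈-image⁺ : ∀ {Z u} → u ∈ Z → g u ∈ image Z
  ∈-image⁺ {Z} {u} u∈Z = ∈-select⁺ (hit? Z) (u , u∈Z , refl)

  ∈-image⁻ : ∀ {Z e} → e ∈ image Z → ∃[ u ] u ∈ Z × g u ≡ e
  ∈-image⁻ {Z} = ∈-select⁻ (hit? Z)

  image-mono : ∀ {Y Z} → Y ⊆ Z → image Y ⊆ image Z
  image-mono Y⊆Z e∈ with ∈-image⁻ e∈
  ... | u , u∈Y , refl = ∈-image⁺ (Y⊆Z u∈Y)

  image-⁅⁆ : ∀ u → image ⁅ u ⁆ ≡ ⁅ g u ⁆
  image-⁅⁆ u = ⊆-antisym
    (λ e∈ → case ∈-image⁻ e∈ of λ where (v , v∈ , refl) → subst (λ w → g w ∈ ⁅ g u ⁆) (sym (x∈⁅y⁆⇒x≡y u v∈)) (x∈⁅x⁆ (g u)))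
    (⁅⁆-⊆ (∈-image⁺ (x∈⁅x⁆ u)))

  image-∪ : ∀ Y Z → image (Y ∪ Z) ≡ image Y ∪ image Z
  image-∪ Y Z = ⊆-antisym
    (λ e∈ → case ∈-image⁻ e∈ of λ where
      (v , v∈ , refl) → x∈p∪q⁺ (Sum.map ∈-image⁺ ∈-image⁺ (x∈p∪q⁻ Y Z v∈)))
    (∪-⊆ (image-mono (p⊆p∪q Z)) (image-mono (q⊆p∪q Y Z)))

-- Minors as labelled subsets

-- N is the minor P / C restricted to the image of the labelling g.

record Model {m n} (P : Matroid m) (N : Matroid n) (g : Fin n → Fin m) (C : Subset m) : Set where
  open RankFunction (total-rank P)
  field
    C⊆E   : C ⊆ E P
    maps  : ∀ {u} → u ∈ E N → g u ∈ E P
    ranks : ∀ Z → Z ⊆ E N → r N Z + rank C ≡ rank (image g Z ∪ C)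

  image⊆E : ∀ {Z} → Z ⊆ E N → image g Z ⊆ E P
  image⊆E Z⊆ e∈ with ∈-image⁻ g e∈
  ... | u , u∈Z , refl = maps (Z⊆ u∈Z)

  r-ranks : ∀ Z → Z ⊆ E N → r N Z + r P C ≡ r P (image g Z ∪ C)
  r-ranks Z Z⊆ = trans (cong (r N Z +_) (sym (total-rank-⊆ P C⊆E)))
    (trans (ranks Z Z⊆) (total-rank-⊆ P (∪-⊆ (image⊆E Z⊆) C⊆E)))

module _ {m n} (Q : Matroid m) (N : Matroid n) where

  minor⇒model : 1 ≤ ∣ E N ∣ → HasMinor Q N → ∃[ g ] ∃[ C ] Model Q N g C
  minor⇒model 1≤N (C , D , C⊆E , D⊆E , disjoint , iso) = g , C , record
    { C⊆E = C⊆E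
    ; maps = λ u∈ → p─q⊆p (E Q) C (image⊆ u∈)
    ; ranks = λ Z Z⊆ → trans (cong₂ _+_ (sym (rank-eq Z Z⊆)) (total-rank-⊆ Q C⊆E))
        (trans (contract-rank Q C⊆E (img⊆ Z⊆)) (sym (total-rank-⊆ Q
          (∪-⊆ (⊆-trans (img⊆ Z⊆) (p─q⊆p (E Q) C)) C⊆E)))) }
    where
    open _≅_ iso
    open Inverse bijection using (to; from; strictlyInverseˡ; strictlyInverseʳ)
    -- The labelling has to be total on `Fin n`. Its values outside E N are arbitrary, and a
    -- nonempty E N provides one.
    default : Fin m
    default = proj₁ (from (∣∣≥1⇒∈ 1≤N))
    pick : ∀ u → Dec (u ∈ E N) → Fin m
    pick u (yes u∈) = proj₁ (from (u , u∈))
    pick u (no  _)  = default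
    g : Fin n → Fin m
    g u = pick u (u ∈? E N)
    g≡ : ∀ {u} (u∈ : u ∈ E N) → g u ≡ proj₁ (from (u , u∈))
    g≡ {u} u∈ with u ∈? E N
    ... | yes u∈′ = cong (λ p → proj₁ (from (u , p))) ([]=-irrelevant u∈′ u∈)
    ... | no  u∉  = ⊥-elim (u∉ u∈)
    element-≡ : ∀ {k} {S : Subset k} {a b : ∃[ e ] e ∈ S} → proj₁ a ≡ proj₁ b → a ≡ b
    element-≡ {a = a , p} {.a , q} refl = cong (a ,_) ([]=-irrelevant p q)
    image⊆ : ∀ {u} → u ∈ E N → g u ∈ E Q ─ C
    image⊆ {u} u∈ = p─q⊆p (E Q ─ C) D (subst (_∈ E Q ─ C ─ D) (sym (g≡ u∈)) (proj₂ (from (u , u∈))))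
    img⊆ : ∀ {Z} → Z ⊆ E N → image g Z ⊆ E Q ─ C
    img⊆ Z⊆ e∈ with ∈-image⁻ g e∈
    ... | u , u∈Z , refl = image⊆ (Z⊆ u∈Z)
    img⊆′ : ∀ {Z} → Z ⊆ E N → image g Z ⊆ E Q ─ C ─ D
    img⊆′ Z⊆ e∈ with ∈-image⁻ g e∈
    ... | u , u∈Z , refl = subst (_∈ E Q ─ C ─ D) (sym (g≡ (Z⊆ u∈Z))) (proj₂ (from (u , Z⊆ u∈Z)))
    rank-eq : ∀ Z → Z ⊆ E N → r (Q / C) (image g Z) ≡ r N Z
    rank-eq Z Z⊆ = r-preserving (image g Z) Z (img⊆′ Z⊆) Z⊆ λ e → mk⇔
      (λ e∈ → case ∈-image⁻ g e∈ of λ where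
        (u , u∈Z , gu≡e) → subst (_∈ Z) (cong proj₁ (trans (sym (strictlyInverseˡ (u , Z⊆ u∈Z)))
          (cong to (element-≡ (trans (sym (g≡ (Z⊆ u∈Z))) gu≡e))))) u∈Z)
      (λ te∈ → subst (_∈ image g Z) (trans (g≡ (proj₂ (to e))) (cong proj₁ (strictlyInverseʳ e))) (∈-image⁺ g te∈))

  module _ {g C} (model : Model Q N g C) (N-simple : Simple N) where
    open Model model
    open RankFunction (total-rank Q)

    -- A `Model` requires neither that labels avoid `C` nor that `g` is injective on E N. Both
    -- follow from the rank equation: a label in `C` would be a loop of N, and two equal labels
    -- would be parallel in N.
    image∉C : ∀ {u} → u ∈ E N → g u ∉ C
    image∉C {u} u∈ gu∈C = ℕ.<⇒≱ (Simple.nonloop N-simple u∈) (ℕ.+-cancelʳ-≤ (rank C) _ _ (begin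
      r N ⁅ u ⁆ + rank C          ≡⟨ ranks ⁅ u ⁆ (⁅⁆-⊆ u∈) ⟩
      rank (image g ⁅ u ⁆ ∪ C)    ≤⟨ rank-mono _ _ (∪-⊆ (λ e∈ → ⁅⁆-⊆ gu∈C (subst (_ ∈_) (image-⁅⁆ g u) e∈)) ⊆-refl) ⟩
      rank C                      ∎))
      where open ℕ.≤-Reasoning

    injective : ∀ {u v} → u ∈ E N → v ∈ E N → g u ≡ g v → u ≡ v
    injective {u} {v} u∈ v∈ gu≡gv with u ≟ v
    ... | yes u≡v = u≡v
    ... | no  u≢v = ⊥-elim (ℕ.<⇒≱ (Simple.pair N-simple u∈ v∈ u≢v) (ℕ.+-cancelʳ-≤ (rank C) _ _ (begin
      r N (⁅ u ⁆ ∪ ⁅ v ⁆) + rank C          ≡⟨ ranks _ (∪-⊆ (⁅⁆-⊆ u∈) (⁅⁆-⊆ v∈)) ⟩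
      rank (image g (⁅ u ⁆ ∪ ⁅ v ⁆) ∪ C)    ≡⟨ cong (λ Y → rank (Y ∪ C)) (trans (image-∪ g ⁅ u ⁆ ⁅ v ⁆)
                                                 (cong₂ _∪_ (image-⁅⁆ g u) (trans (image-⁅⁆ g v) (cong ⁅_⁆ (sym gu≡gv))))) ⟩
      rank ((⁅ g u ⁆ ∪ ⁅ g u ⁆) ∪ C)        ≤⟨ holds (by-ranks [] (sub (var 0) (var 1) ∷ fact (ρ var 0 ≼ # 1) (total-single Q (g u)) ∷ [])
                                                        {ρ (var 0 ⊔ var 0) ⊔ var 1 ≼ # 1 ⊕ ρ var 1}) ⟩
      1 + rank C                            ∎)))
      where
      open ℕ.≤-Reasoning
      open Reasoning (total-rank Q) (⁅ g u ⁆ ∷ C ∷ [])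

    private
      F D : Subset m
      F = image g (E N)
      D = E Q ─ C ─ F

      F∩C : F ∩ C ⊆ ⊥
      F∩C e∈ with ∈-image⁻ g (p∩q⊆p F C e∈)
      ... | u , u∈ , refl = ⊥-elim (image∉C u∈ (p∩q⊆q F C e∈))

      rest : E Q ─ C ─ D ≡ F
      rest = equal (incl (var 3 ⊓ var 1 ⊑ const false) F∩C ∷ incl (var 3 ⊑ var 0) (image⊆E ⊆-refl) ∷ [])
        (var 0 ⊖ var 1 ⊖ (var 0 ⊖ var 1 ⊖ var 3)) (var 3)
        where open Sets (E Q ∷ C ∷ D ∷ F ∷ [])

    model⇒minor : HasMinor Q N
    model⇒minor = C , D , C⊆E , ⊆-trans (p─q⊆p (E Q ─ C) F) (p─q⊆p (E Q) C) , C∩D , record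
      { bijection = mk↔ₛ′ to from to∘from from∘to
      ; r-preserving = λ X Y X⊆ Y⊆ rel → ℕ.+-cancelʳ-≡ (r Q C) _ _ (trans
          (contract-rank Q C⊆E (⊆-trans X⊆ (p─q⊆p (E Q ─ C) D)))
          (trans (cong (λ S → r Q (S ∪ C)) (X≡ X⊆ Y⊆ rel)) (sym (r-ranks Y Y⊆)))) }
      where
      C∩D : ∀ {A : Set} → Nonempty (C ∩ D) → A
      C∩D (e , e∈) = ⊥-elim (∉─ (p─q⊆p (E Q ─ C) F (p∩q⊆q C D e∈)) (p∩q⊆p C D e∈))
      R = E Q ─ C ─ D
      to : ∃[ e ] e ∈ R → ∃[ u ] u ∈ E N
      to (e , e∈) with ∈-image⁻ g (subst (e ∈_) rest e∈)
      ... | u , u∈ , _ = u , u∈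
      g-to : ∀ e → g (proj₁ (to e)) ≡ proj₁ e
      g-to (e , e∈) with ∈-image⁻ g (subst (e ∈_) rest e∈)
      ... | u , u∈ , gu≡e = gu≡e
      from : ∃[ u ] u ∈ E N → ∃[ e ] e ∈ R
      from (u , u∈) = g u , subst (g u ∈_) (sym rest) (∈-image⁺ g u∈)
      element-≡ : ∀ {k} {S : Subset k} {a b : ∃[ e ] e ∈ S} → proj₁ a ≡ proj₁ b → a ≡ b
      element-≡ {a = a , p} {.a , q} refl = cong (a ,_) ([]=-irrelevant p q)
      to∘from : ∀ u → to (from u) ≡ u
      to∘from (u , u∈) = element-≡ (injective (proj₂ (to (from (u , u∈)))) u∈ (g-to (from (u , u∈))))
      from∘to : ∀ e → from (to e) ≡ e
      from∘to e = element-≡ (g-to e)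
      X≡ : ∀ {X Y} → X ⊆ R → Y ⊆ E N → (∀ e → proj₁ e ∈ X ⇔ proj₁ (to e) ∈ Y) → X ≡ image g Y
      X≡ {X} {Y} X⊆ Y⊆ rel = ⊆-antisym
        (λ {e} e∈ → subst (_∈ image g Y) (g-to (e , X⊆ e∈)) (∈-image⁺ g (Equivalence.to (rel (e , X⊆ e∈)) e∈)))
        (λ e∈ → case ∈-image⁻ g e∈ of λ where
          (u , u∈Y , refl) → Equivalence.from (rel (from (u , Y⊆ u∈Y)))
            (subst (_∈ Y) (sym (cong proj₁ (to∘from (u , Y⊆ u∈Y)))) u∈Y))

-- Contraction, duality and simplification of models

module _ {m} (P : Matroid m) where
  private
    module T = RankFunction (total-rank P)

  contract-total-rank : ∀ {x} → x ∈ E P → ∀ X →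
    RankFunction.rank (total-rank (P / ⁅ x ⁆)) X + T.rank ⁅ x ⁆ ≡ T.rank (X ∪ ⁅ x ⁆)
  contract-total-rank {x} x∈E X = trans (cong (r (P / ⁅ x ⁆) (X ∩ (E P ─ ⁅ x ⁆)) +_) (total-rank-⊆ P (⁅⁆-⊆ x∈E)))
    (trans (contract-rank P (⁅⁆-⊆ x∈E) (p∩q⊆q X (E P ─ ⁅ x ⁆)))
      (cong (r P) (equal (incl (var 1 ⊑ var 2) (⁅⁆-⊆ x∈E) ∷ [])
        (var 0 ⊓ (var 2 ⊖ var 1) ⊔ var 1) ((var 0 ⊔ var 1) ⊓ var 2))))
    where open Sets (X ∷ ⁅ x ⁆ ∷ E P ∷ [])

  private
    ─── : ∀ {X} → X ⊆ E P → E P ─ (E P ─ X) ≡ X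
    ─── {X} X⊆E = equal (incl (var 0 ⊑ var 1) X⊆E ∷ []) (var 1 ⊖ (var 1 ⊖ var 0)) (var 0)
      where open Sets (X ∷ E P ∷ [])

    r*E : r (P *) (E P) + r P (E P) ≡ ∣ E P ∣
    r*E = trans (dual-rank P ⊆-refl) (trans (cong (∣ E P ∣ +_) none) (ℕ.+-identityʳ _))
      where
      open Sets (E P ∷ [])
      none : r P (E P ─ E P) ≡ 0
      none = trans (cong (r P) (equal [] (var 0 ⊖ var 0) (const false ⊓ var 0))) T.rank-⊥

  dual-dual : ∀ {X} → X ⊆ E P → r (P * *) X ≡ r P X
  dual-dual {X} X⊆E = ℕ.+-cancelʳ-≡ (∣ E P ∣) _ _ (begin
    r (P * *) X + ∣ E P ∣                       ≡⟨ cong (r (P * *) X +_) (sym r*E) ⟩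
    r (P * *) X + (r (P *) (E P) + r P (E P))   ≡⟨ sym (ℕ.+-assoc (r (P * *) X) _ _) ⟩
    r (P * *) X + r (P *) (E P) + r P (E P)     ≡⟨ cong (_+ r P (E P)) (dual-rank (P *) X⊆E) ⟩
    ∣ X ∣ + r (P *) (E P ─ X) + r P (E P)       ≡⟨ ℕ.+-assoc ∣ X ∣ _ _ ⟩
    ∣ X ∣ + (r (P *) (E P ─ X) + r P (E P))     ≡⟨ cong (∣ X ∣ +_) (dual-rank P (p─q⊆p (E P) X)) ⟩
    ∣ X ∣ + (∣ E P ─ X ∣ + r P (E P ─ (E P ─ X))) ≡⟨ sym (ℕ.+-assoc ∣ X ∣ _ _) ⟩
    ∣ X ∣ + ∣ E P ─ X ∣ + r P (E P ─ (E P ─ X)) ≡⟨ cong₂ (λ a Y → a + r P Y) (∣∣-split X⊆E) (─── X⊆E) ⟩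
    ∣ E P ∣ + r P X                             ≡⟨ ℕ.+-comm ∣ E P ∣ _ ⟩
    r P X + ∣ E P ∣                             ∎)
    where
    open ≡-Reasoning

  private
    -- Self-duality of connectivity with the subtractions cleared. Expanding the dual ranks of X and
    -- its complement, the two sizes add up to ∣ E P ∣ = r*(E) + r(E).
    excess-dual : ∀ {X} → X ⊆ E P → r (P *) X + r (P *) (E P ─ X) + r P (E P) ≡
                                    r P X + r P (E P ─ X) + r (P *) (E P)
    excess-dual {X} X⊆E = ℕ.+-cancelʳ-≡ (r P (E P)) _ _ (begin
      r (P *) X + r (P *) Y + R + R       ≡⟨ trans (ℕ.+-assoc (r (P *) X + r (P *) Y) R R) (+-interchange (r (P *) X) _ R R) ⟩
      (r (P *) X + R) + (r (P *) Y + R)   ≡⟨ cong₂ _+_ (dual-rank P X⊆E) (dual-rank P (p─q⊆p (E P) X)) ⟩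
      (∣ X ∣ + r P Y) + (∣ Y ∣ + r P (E P ─ Y)) ≡⟨ +-interchange (∣ X ∣) _ (∣ Y ∣) _ ⟩
      (∣ X ∣ + ∣ Y ∣) + (r P Y + r P (E P ─ Y)) ≡⟨ cong₂ _+_ (∣∣-split X⊆E) (cong (λ Z → r P Y + r P Z) (─── X⊆E)) ⟩
      ∣ E P ∣ + (r P Y + r P X)           ≡⟨ cong₂ _+_ (sym r*E) (ℕ.+-comm (r P Y) (r P X)) ⟩
      (r (P *) (E P) + R) + (r P X + r P Y) ≡⟨ ℕ.+-comm (r (P *) (E P) + R) _ ⟩
      (r P X + r P Y) + (r (P *) (E P) + R) ≡⟨ sym (ℕ.+-assoc (r P X + r P Y) _ R) ⟩
      r P X + r P Y + r (P *) (E P) + R   ∎)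
      where
      open ≡-Reasoning
      Y = E P ─ X
      R = r P (E P)

  connectivity-dual : ∀ {X} → X ⊆ E P → connectivity (P *) X ≡ connectivity P X
  connectivity-dual {X} X⊆E = begin
    a ∸ s              ≡⟨ sym (ℕ.[m+n]∸[m+o]≡n∸o t a s) ⟩
    (t + a) ∸ (t + s)  ≡⟨ cong₂ _∸_ (trans (ℕ.+-comm t a) (trans (excess-dual X⊆E) (ℕ.+-comm b s))) (ℕ.+-comm t s) ⟩
    (s + b) ∸ (s + t)  ≡⟨ ℕ.[m+n]∸[m+o]≡n∸o s b t ⟩
    b ∸ t              ∎
    where
    open ≡-Reasoning
    a b s t : ℕ
    a = r (P *) X + r (P *) (E P ─ X)
    b = r P X + r P (E P ─ X)
    s = r (P *) (E P)
    t = r P (E P)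

  connected-dual : ∀ {k} → Connected k P → Connected k (P *)
  connected-dual conn k 1≤k k<n (X , X⊆E , small , k≤X , k≤Y) =
    conn k 1≤k k<n (X , X⊆E , subst (_< k) (connectivity-dual X⊆E) small , k≤X , k≤Y)

module _ {m n} {P : Matroid m} {N : Matroid n} {g : Fin n → Fin m} {x : Fin m} (x∈E : x ∈ E P) where
  private
    open RankFunction (total-rank P)
    module Q = RankFunction (total-rank (P / ⁅ x ⁆))

  uncontract : ∀ {C} → Model (P / ⁅ x ⁆) N g C → Model P N g (C ∪ ⁅ x ⁆)
  uncontract {C} model = record
    { C⊆E = ∪-⊆ (⊆-trans C⊆E (p─q⊆p (E P) ⁅ x ⁆)) (⁅⁆-⊆ x∈E)
    ; maps = λ u∈ → p─q⊆p (E P) ⁅ x ⁆ (maps u∈)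
    ; ranks = λ Z Z⊆ → begin
        r N Z + rank (C ∪ ⁅ x ⁆)                ≡⟨ cong (r N Z +_) (sym (contract-total-rank P x∈E C)) ⟩
        r N Z + (Q.rank C + rank ⁅ x ⁆)         ≡⟨ sym (ℕ.+-assoc (r N Z) _ _) ⟩
        r N Z + Q.rank C + rank ⁅ x ⁆           ≡⟨ cong (_+ rank ⁅ x ⁆) (ranks Z Z⊆) ⟩
        Q.rank (image g Z ∪ C) + rank ⁅ x ⁆     ≡⟨ contract-total-rank P x∈E _ ⟩
        rank ((image g Z ∪ C) ∪ ⁅ x ⁆)          ≡⟨ cong rank (∪-assoc (image g Z) C ⁅ x ⁆) ⟩
        rank (image g Z ∪ C ∪ ⁅ x ⁆)            ∎ }
    where
    open Model model
    open ≡-Reasoning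

  contract : ∀ {C} → Simple N → Model P N g C → x ∈ C → Model (P / ⁅ x ⁆) N g (C ─ ⁅ x ⁆)
  contract {C} N-simple model x∈C = record
    { C⊆E = λ e∈ → x∈p∧x∉q⇒x∈p─q (C⊆E (p─q⊆p C ⁅ x ⁆ e∈)) (∉─ e∈)
    ; maps = λ u∈ → x∈p∧x∉q⇒x∈p─q (maps u∈) λ gu∈x → image∉C P N model N-simple u∈
                      (subst (_∈ C) (sym (x∈⁅y⁆⇒x≡y x gu∈x)) x∈C)
    ; ranks = λ Z Z⊆ → ℕ.+-cancelʳ-≡ (rank ⁅ x ⁆) _ _ (begin
        r N Z + Q.rank (C ─ ⁅ x ⁆) + rank ⁅ x ⁆       ≡⟨ ℕ.+-assoc (r N Z) _ _ ⟩
        r N Z + (Q.rank (C ─ ⁅ x ⁆) + rank ⁅ x ⁆)     ≡⟨ cong (r N Z +_) (contract-total-rank P x∈E _) ⟩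
        r N Z + rank ((C ─ ⁅ x ⁆) ∪ ⁅ x ⁆)            ≡⟨ cong (λ Y → r N Z + rank Y) (restore ⊥) ⟩
        r N Z + rank C                                ≡⟨ ranks Z Z⊆ ⟩
        rank (image g Z ∪ C)                          ≡⟨ cong rank (sym (restore′ (image g Z))) ⟩
        rank ((image g Z ∪ (C ─ ⁅ x ⁆)) ∪ ⁅ x ⁆)      ≡⟨ sym (contract-total-rank P x∈E _) ⟩
        Q.rank (image g Z ∪ (C ─ ⁅ x ⁆)) + rank ⁅ x ⁆ ∎) }
    where
    open Model model
    open ≡-Reasoning
    module _ (Z : Subset m) where
      open Sets (Z ∷ C ∷ ⁅ x ⁆ ∷ [])
      restore : (C ─ ⁅ x ⁆) ∪ ⁅ x ⁆ ≡ C
      restore = equal (incl (var 2 ⊑ var 1) (⁅⁆-⊆ x∈C) ∷ []) ((var 1 ⊖ var 2) ⊔ var 2) (var 1)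
      restore′ : (Z ∪ (C ─ ⁅ x ⁆)) ∪ ⁅ x ⁆ ≡ Z ∪ C
      restore′ = equal (incl (var 2 ⊑ var 1) (⁅⁆-⊆ x∈C) ∷ []) ((var 0 ⊔ (var 1 ⊖ var 2)) ⊔ var 2) (var 0 ⊔ var 1)

module _ {m n} {Q : Matroid m} {N : Matroid n} {g : Fin n → Fin m} {C : Subset m}
         (N-simple : Simple N) (model : Model Q N g C) where
  open Model model
  open RankFunction (total-rank Q)
  private
    g-nonloop : ∀ {u} → u ∈ E N → 1 ≤ rank ⁅ g u ⁆
    g-nonloop {u} u∈ = ℕ.+-cancelʳ-≤ (rank C) _ _ (begin
      1 + rank C                ≤⟨ ℕ.+-monoˡ-≤ (rank C) (Simple.nonloop N-simple u∈) ⟩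
      r N ⁅ u ⁆ + rank C        ≡⟨ ranks ⁅ u ⁆ (⁅⁆-⊆ u∈) ⟩
      rank (image g ⁅ u ⁆ ∪ C)  ≡⟨ cong (λ Y → rank (Y ∪ C)) (image-⁅⁆ g u) ⟩
      rank (⁅ g u ⁆ ∪ C)        ≤⟨ R.holds (R.by-ranks R.[] (R.sub (var 0) (var 1) R.∷ R.[]) {ρ var 0 ⊔ var 1 ≼ ρ var 0 ⊕ ρ var 1}) ⟩
      rank ⁅ g u ⁆ + rank C     ∎)
      where
      open ℕ.≤-Reasoning
      module R = Reasoning (total-rank Q) (⁅ g u ⁆ ∷ C ∷ [])

    keep : ∀ u → ∃[ s ] (u ∈ E N → s ∈ E (si Q) × rank (⁅ s ⁆ ∪ ⁅ g u ⁆) ≤ 1)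
    keep u with u ∈? E N
    ... | no  u∉ = g u , λ u∈ → ⊥-elim (u∉ u∈)
    ... | yes u∈ with representative Q (maps u∈)
    ...   | inj₁ h = ⊥-elim (ℕ.<⇒≱ (g-nonloop u∈) h)
    ...   | inj₂ (s , h) = s , λ _ → h

    g′ : Fin n → Fin m
    g′ u = proj₁ (keep u)

    g′-kept : ∀ {u} → u ∈ E N → g′ u ∈ E (si Q)
    g′-kept {u} u∈ = proj₁ (proj₂ (keep u) u∈)

    g′-parallel : ∀ {u} → u ∈ E N → rank (⁅ g′ u ⁆ ∪ ⁅ g u ⁆) ≤ 1
    g′-parallel {u} u∈ = proj₂ (proj₂ (keep u) u∈)

    closure? : ∀ e → Dec (rank (C ∪ ⁅ e ⁆) ≤ rank C)
    closure? e = rank (C ∪ ⁅ e ⁆) ℕ.≤? rank C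

    -- Taking every kept element of cl(C), rather than one representative for each element of C,
    -- gives a set with the same span without any choice.
    C′ : Subset m
    C′ = select closure? ∩ E (si Q)

    C′-spanned : ∀ {e} → e ∈ C′ → rank (C ∪ ⁅ e ⁆) ≤ rank C
    C′-spanned e∈ = ∈-select⁻ closure? (p∩q⊆p (select closure?) (E (si Q)) e∈)

    ∪-comm-≤ : ∀ X Y {k} → rank (X ∪ Y) ≤ k → rank (Y ∪ X) ≤ k
    ∪-comm-≤ X Y = subst (λ Z → rank Z ≤ _) (∪-comm X Y)

    C-spanned : ∀ {e} → e ∈ C → rank (C′ ∪ ⁅ e ⁆) ≤ rank C′
    C-spanned {e} e∈C with ℕ.≤-<-connex (rank ⁅ e ⁆) 0 | representative Q (C⊆E e∈C)
    ... | inj₁ h | _ = loop h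
      where
      open Reasoning (total-rank Q) (C′ ∷ ⁅ e ⁆ ∷ [])
      loop : rank ⁅ e ⁆ ≤ 0 → rank (C′ ∪ ⁅ e ⁆) ≤ rank C′
      loop h = holds (by-ranks [] (sub (var 0) (var 1) ∷ fact (ρ var 1 ≼ # 0) h ∷ []) {ρ var 0 ⊔ var 1 ≼ ρ var 0})
    ... | inj₂ h | inj₁ k = ⊥-elim (ℕ.<⇒≱ h k)
    ... | inj₂ h | inj₂ (s , s∈ , se) = absorb Q s∈C′ (kept-nonloop Q s∈) se
      where
      s∈C′ : s ∈ C′
      s∈C′ = x∈p∩q⁺ (∈-select⁺ closure? (absorb Q e∈C h (∪-comm-≤ ⁅ s ⁆ ⁅ e ⁆ se)) , s∈)

    both-≤ : ∀ X Y → (∀ {e} → e ∈ Y → rank (X ∪ ⁅ e ⁆) ≤ rank X) → rank Y ≤ rank X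
    both-≤ X Y h = ℕ.≤-trans (rank-mono _ _ (q⊆p∪q X Y)) (spanned (total-rank Q) X Y h)

    C≡C′ : rank C ≡ rank C′
    C≡C′ = ℕ.≤-antisym (both-≤ C′ C C-spanned) (both-≤ C C′ C′-spanned)

    enlarge : ∀ {X Y : Subset m} {e} → X ⊆ Y → rank (X ∪ ⁅ e ⁆) ≤ rank X → rank (Y ∪ ⁅ e ⁆) ≤ rank Y
    enlarge {X} {Y} {e} X⊆Y h = holds (by-ranks (incl (var 0 ⊑ var 1) X⊆Y ∷ [])
      (sub (var 1) (var 0 ⊔ var 2) ∷ fact (ρ var 0 ⊔ var 2 ≼ ρ var 0) h ∷ []) {ρ var 1 ⊔ var 2 ≼ ρ var 1})
      where open Reasoning (total-rank Q) (X ∷ Y ∷ ⁅ e ⁆ ∷ [])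

    image≡ : ∀ Z → Z ⊆ E N → rank (image g Z ∪ C) ≡ rank (image g′ Z ∪ C′)
    image≡ Z Z⊆ = ℕ.≤-antisym (both-≤ S′ S old) (both-≤ S S′ new)
      where
      S S′ : Subset m
      S  = image g Z ∪ C
      S′ = image g′ Z ∪ C′
      old : ∀ {e} → e ∈ S → rank (S′ ∪ ⁅ e ⁆) ≤ rank S′
      old e∈ with x∈p∪q⁻ (image g Z) C e∈
      ... | inj₂ e∈C = enlarge (q⊆p∪q (image g′ Z) C′) (C-spanned e∈C)
      ... | inj₁ e∈g with ∈-image⁻ g e∈g
      ...   | u , u∈Z , refl = absorb Q (p⊆p∪q C′ (∈-image⁺ g′ u∈Z)) (kept-nonloop Q (g′-kept (Z⊆ u∈Z))) (g′-parallel (Z⊆ u∈Z))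
      new : ∀ {e} → e ∈ S′ → rank (S ∪ ⁅ e ⁆) ≤ rank S
      new e∈ with x∈p∪q⁻ (image g′ Z) C′ e∈
      ... | inj₂ e∈C = enlarge (q⊆p∪q (image g Z) C) (C′-spanned e∈C)
      ... | inj₁ e∈g with ∈-image⁻ g′ e∈g
      ...   | u , u∈Z , refl = absorb Q (p⊆p∪q C (∈-image⁺ g u∈Z)) (g-nonloop (Z⊆ u∈Z))
                                 (∪-comm-≤ ⁅ g′ u ⁆ ⁅ g u ⁆ (g′-parallel (Z⊆ u∈Z)))

    si-rank : ∀ {X} → X ⊆ E (si Q) → RankFunction.rank (total-rank (si Q)) X ≡ rank X
    si-rank X⊆ = trans (total-rank-⊆ (si Q) X⊆) (sym (total-rank-⊆ Q (⊆-trans X⊆ (si⊆ Q))))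

    C′⊆ : C′ ⊆ E (si Q)
    C′⊆ = p∩q⊆q (select closure?) (E (si Q))

  -- N is simple, so every label is a nonloop and can be exchanged for its kept representative. All
  -- sets in the rank equation keep their spans.
  si-model : ∃[ g′ ] ∃[ C′ ] Model (si Q) N g′ C′
  si-model = g′ , C′ , record
    { C⊆E = C′⊆
    ; maps = g′-kept
    ; ranks = λ Z Z⊆ → trans (cong (r N Z +_) (trans (si-rank C′⊆) (sym C≡C′)))
        (trans (ranks Z Z⊆) (trans (image≡ Z Z⊆) (sym (si-rank (∪-⊆ (img⊆ Z⊆) C′⊆))))) }
    where
    img⊆ : ∀ {Z} → Z ⊆ E N → image g′ Z ⊆ E (si Q)
    img⊆ Z⊆ e∈ with ∈-image⁻ g′ e∈
    ... | u , u∈Z , refl = g′-kept (Z⊆ u∈Z)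

∣image∣ : ∀ {m n} (g : Fin n → Fin m) Z → (∀ {u v} → u ∈ Z → v ∈ Z → g u ≡ g v → u ≡ v) → ∣ image g Z ∣ ≡ ∣ Z ∣
∣image∣ {m} {n} g Z inj = go ∣ Z ∣ Z refl inj
  where
  go : ∀ k Z → ∣ Z ∣ ≡ k → (∀ {u v} → u ∈ Z → v ∈ Z → g u ≡ g v → u ≡ v) → ∣ image g Z ∣ ≡ k
  go k Z k≡ inj with nonempty? Z
  ... | no  e = trans (cong ∣_∣ (Empty-unique λ (x , x∈) → e (proj₁ (∈-image⁻ g x∈) , proj₁ (proj₂ (∈-image⁻ g x∈)))))
                      (trans (∣⊥∣≡0 m) (trans (sym (trans (cong ∣_∣ (Empty-unique e)) (∣⊥∣≡0 n))) k≡))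
  go ℕ.zero  Z k≡ inj | yes (u , u∈Z) = ⊥-elim (ℕ.<⇒≱ (∈⇒∣∣≥1 u∈Z) (ℕ.≤-reflexive k≡))
  go (suc k) Z k≡ inj | yes (u , u∈Z) = trans (sym (∣─⁅⁆∣ (∈-image⁺ g u∈Z))) (cong suc (trans
    (cong ∣_∣ removed) (go k (Z ─ ⁅ u ⁆) (ℕ.suc-injective (trans (∣─⁅⁆∣ u∈Z) k≡))
      λ v∈ w∈ → inj (p─q⊆p Z ⁅ u ⁆ v∈) (p─q⊆p Z ⁅ u ⁆ w∈))))
    where
    removed : image g Z ─ ⁅ g u ⁆ ≡ image g (Z ─ ⁅ u ⁆)
    removed = ⊆-antisym
      (λ e∈ → case ∈-image⁻ g (p─q⊆p (image g Z) ⁅ g u ⁆ e∈) of λ where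
        (v , v∈Z , refl) → ∈-image⁺ g (x∈p∧x∉q⇒x∈p─q v∈Z λ v∈u →
          ∉─ e∈ (subst (λ w → g w ∈ ⁅ g u ⁆) (sym (x∈⁅y⁆⇒x≡y u v∈u)) (x∈⁅x⁆ (g u)))))
      (λ e∈ → case ∈-image⁻ g e∈ of λ where
        (v , v∈ , refl) → x∈p∧x∉q⇒x∈p─q (∈-image⁺ g (p─q⊆p Z ⁅ u ⁆ v∈)) λ gv∈ →
          ∉─ v∈ (subst (_∈ ⁅ u ⁆) (sym (inj (p─q⊆p Z ⁅ u ⁆ v∈) u∈Z (x∈⁅y⁆⇒x≡y (g u) gv∈))) (x∈⁅x⁆ u)))

module _ {m n} {Q : Matroid m} {N : Matroid n} {g : Fin n → Fin m} {C : Subset m}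
         (N-simple : Simple N) (model : Model Q N g C) where
  open Model model
  private
    D : Subset m
    D = E Q ─ C ─ image g (E N)

    D⊆E : D ⊆ E Q
    D⊆E = ⊆-trans (p─q⊆p (E Q ─ C) (image g (E N))) (p─q⊆p (E Q) C)

    -- In the dual, deletion and contraction trade places: the set `D` of elements that are neither
    -- labels nor contracted becomes the contracted set. The sizes match because `g` is injective on
    -- E N.
    dual-ranks : ∀ Z → Z ⊆ E N → r (N *) Z + r (Q *) D ≡ r (Q *) (image g Z ∪ D)
    dual-ranks Z Z⊆ = ℕ.+-cancelʳ-≡ (r N (E N) + r Q (E Q)) _ _ (begin
      (r (N *) Z + r (Q *) D) + (r N (E N) + r Q (E Q))
        ≡⟨ +-interchange (r (N *) Z) _ _ _ ⟩
      (r (N *) Z + r N (E N)) + (r (Q *) D + r Q (E Q))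
        ≡⟨ cong₂ _+_ (dual-rank N Z⊆) (dual-rank Q D⊆E) ⟩
      (∣ Z ∣ + r N (E N ─ Z)) + (∣ D ∣ + r Q (E Q ─ D))
        ≡⟨ cong (λ a → (∣ Z ∣ + r N (E N ─ Z)) + (∣ D ∣ + a)) (trans (cong (r Q) E─D) (sym (r-ranks (E N) ⊆-refl))) ⟩
      (∣ Z ∣ + r N (E N ─ Z)) + (∣ D ∣ + (r N (E N) + r Q C))
        ≡⟨ +-interchange (∣ Z ∣) _ _ _ ⟩
      (∣ Z ∣ + ∣ D ∣) + (r N (E N ─ Z) + (r N (E N) + r Q C))
        ≡⟨ cong₂ _+_ (sym card) (+-exchange (r N (E N ─ Z)) (r N (E N)) (r Q C)) ⟩
      ∣ image g Z ∪ D ∣ + (r N (E N) + (r N (E N ─ Z) + r Q C))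
        ≡⟨ +-exchange (∣ image g Z ∪ D ∣) (r N (E N)) _ ⟩
      r N (E N) + (∣ image g Z ∪ D ∣ + (r N (E N ─ Z) + r Q C))
        ≡⟨ cong (λ a → r N (E N) + (∣ image g Z ∪ D ∣ + a)) (trans (r-ranks (E N ─ Z) (p─q⊆p (E N) Z)) (cong (r Q) (sym E─ZD))) ⟩
      r N (E N) + (∣ image g Z ∪ D ∣ + r Q (E Q ─ (image g Z ∪ D)))
        ≡⟨ cong (r N (E N) +_) (sym (dual-rank Q (∪-⊆ (image⊆E Z⊆) D⊆E))) ⟩
      r N (E N) + (r (Q *) (image g Z ∪ D) + r Q (E Q))
        ≡⟨ +-exchange (r N (E N)) (r (Q *) (image g Z ∪ D)) _ ⟩
      r (Q *) (image g Z ∪ D) + (r N (E N) + r Q (E Q)) ∎)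
      where
      open ≡-Reasoning
      F G G′ : Subset m
      F  = image g (E N)
      G  = image g Z
      G′ = image g (E N ─ Z)
      open Sets (E Q ∷ C ∷ F ∷ G ∷ G′ ∷ [])
      F∩C : F ∩ C ⊆ ⊥
      F∩C e∈ with ∈-image⁻ g (p∩q⊆p F C e∈)
      ... | u , u∈ , refl = ⊥-elim (image∉C Q N model N-simple u∈ (p∩q⊆q F C e∈))
      F⊆ : F ⊆ G ∪ G′
      F⊆ e∈ with ∈-image⁻ g e∈
      ... | u , u∈ , refl with u ∈? Z
      ...   | yes u∈Z = x∈p∪q⁺ (inj₁ (∈-image⁺ g u∈Z))
      ...   | no  u∉Z = x∈p∪q⁺ (inj₂ (∈-image⁺ g (x∈p∧x∉q⇒x∈p─q u∈ u∉Z)))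
      G∩G′ : G ∩ G′ ⊆ ⊥
      G∩G′ e∈ with ∈-image⁻ g (p∩q⊆p G G′ e∈) | ∈-image⁻ g (p∩q⊆q G G′ e∈)
      ... | u , u∈Z , refl | v , v∈ , gv≡gu = ⊥-elim (∉─ v∈ (subst (_∈ Z)
        (sym (injective Q N model N-simple (p─q⊆p (E N) Z v∈) (Z⊆ u∈Z) gv≡gu)) u∈Z))
      H : SetFacts _
      H = incl (var 2 ⊓ var 1 ⊑ const false) F∩C ∷ incl (var 2 ⊑ var 3 ⊔ var 4) F⊆ ∷
          incl (var 3 ⊓ var 4 ⊑ const false) G∩G′ ∷ incl (var 3 ⊑ var 2) (image-mono g Z⊆) ∷
          incl (var 4 ⊑ var 2) (image-mono g (p─q⊆p (E N) Z)) ∷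
          incl (var 2 ⊑ var 0) (image⊆E ⊆-refl) ∷ incl (var 1 ⊑ var 0) C⊆E ∷ []
      E─D : E Q ─ D ≡ F ∪ C
      E─D = equal H (var 0 ⊖ (var 0 ⊖ var 1 ⊖ var 2)) (var 2 ⊔ var 1)
      E─ZD : E Q ─ (G ∪ D) ≡ G′ ∪ C
      E─ZD = equal H (var 0 ⊖ (var 3 ⊔ (var 0 ⊖ var 1 ⊖ var 2))) (var 4 ⊔ var 1)
      card : ∣ G ∪ D ∣ ≡ ∣ Z ∣ + ∣ D ∣
      card = trans (sym (∣∣-split {X = G ∪ D} {Y = G} (p⊆p∪q D))) (cong₂ _+_
        (∣image∣ g Z λ u∈ v∈ → injective Q N model N-simple (Z⊆ u∈) (Z⊆ v∈))
        (cong ∣_∣ (equal H ((var 3 ⊔ (var 0 ⊖ var 1 ⊖ var 2)) ⊖ var 3) (var 0 ⊖ var 1 ⊖ var 2))))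

  dual-model : Model (Q *) (N *) g D
  dual-model = record
    { C⊆E = D⊆E
    ; maps = maps
    ; ranks = λ Z Z⊆ → trans (cong (r (N *) Z +_) (total-rank-⊆ (Q *) D⊆E))
        (trans (dual-ranks Z Z⊆) (sym (total-rank-⊆ (Q *) (∪-⊆ (image⊆E Z⊆) D⊆E)))) }

module _ where
  open +-*-Solver using (solve; _:+_; con; _:=_)

  -- An identity k + a = a′ between ranks survives when `a` and `a′` change by the same amount, here
  -- t - p.
  transfer : ∀ {a b a′ b′ p t} k → a + p ≡ b + t → a′ + p ≡ b′ + t → k + a ≡ a′ → k + b ≡ b′
  transfer {a} {b} {a′} {b′} {p} {t} k h h′ eq = ℕ.+-cancelʳ-≡ t _ _ (begin
    k + b + t    ≡⟨ ℕ.+-assoc k b t ⟩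
    k + (b + t)  ≡⟨ cong (k +_) (sym h) ⟩
    k + (a + p)  ≡⟨ sym (ℕ.+-assoc k a p) ⟩
    k + a + p    ≡⟨ cong (_+ p) eq ⟩
    a′ + p       ≡⟨ h′ ⟩
    b′ + t       ∎)
    where open ≡-Reasoning

  -- Here `a` follows the law of a low set and `c` that of a high set with one more element. The
  -- conclusion no longer mentions `t`, the rank of the set contracted: it is a normal form through
  -- which one such set is traded for another.
  transfer-jump : ∀ {a b c d s t} k → a + 1 ≡ b + t → c + s ≡ d + (t + 1) → k + a ≡ c → k + b + s ≡ d + 2
  transfer-jump {a} {b} {c} {d} {s} {t} k h h′ eq = ℕ.+-cancelʳ-≡ t _ _ (begin
    k + b + s + t    ≡⟨ solve 4 (λ k b s t → k :+ b :+ s :+ t := k :+ (b :+ t) :+ s) refl k b s t ⟩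
    k + (b + t) + s  ≡⟨ cong (λ i → k + i + s) (sym h) ⟩
    k + (a + 1) + s  ≡⟨ solve 3 (λ k a s → k :+ (a :+ con 1) :+ s := (k :+ a) :+ s :+ con 1) refl k a s ⟩
    k + a + s + 1    ≡⟨ cong (λ i → i + s + 1) eq ⟩
    c + s + 1        ≡⟨ cong (_+ 1) h′ ⟩
    d + (t + 1) + 1  ≡⟨ solve 2 (λ d t → d :+ (t :+ con 1) :+ con 1 := d :+ con 2 :+ t) refl d t ⟩
    d + 2 + t        ∎)
    where open ≡-Reasoning

  transfer-jump⁻¹ : ∀ {a b c d s t} k → a + 1 ≡ b + t → c + s ≡ d + (t + 1) → k + b + s ≡ d + 2 → k + a ≡ c
  transfer-jump⁻¹ {a} {b} {c} {d} {s} {t} k h h′ eq = ℕ.+-cancelʳ-≡ (s + 1) _ _ (begin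
    k + a + (s + 1)  ≡⟨ solve 3 (λ k a s → k :+ a :+ (s :+ con 1) := k :+ (a :+ con 1) :+ s) refl k a s ⟩
    k + (a + 1) + s  ≡⟨ cong (λ i → k + i + s) h ⟩
    k + (b + t) + s  ≡⟨ solve 4 (λ k b s t → k :+ (b :+ t) :+ s := k :+ b :+ s :+ t) refl k b s t ⟩
    k + b + s + t    ≡⟨ cong (_+ t) eq ⟩
    d + 2 + t        ≡⟨ solve 2 (λ d t → d :+ con 2 :+ t := d :+ (t :+ con 1) :+ con 1) refl d t ⟩
    d + (t + 1) + 1  ≡⟨ cong (_+ 1) (sym h′) ⟩
    c + s + 1        ≡⟨ ℕ.+-assoc c s 1 ⟩
    c + (s + 1)      ∎)
    where open ≡-Reasoning

-- Moving a minor to another contracted element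

module Minors {m n} (P : Matroid m) (N : Matroid n)
         (P-conn : Connected 3 P) (4≤P : 4 ≤ ∣ E P ∣) (N-conn : Connected 3 N) (4≤N : 4 ≤ ∣ E N ∣) where
  private
    M : ThreeConnected m
    M = three-connected P P-conn 4≤P
    module NT = ThreeConnected (three-connected N N-conn 4≤N)

  open RankFunction (total-rank P)

  N-simple : Simple N
  N-simple = connected⇒simple N N-conn 4≤N

  Few : (Fin n → Fin m) → Subset m → Set
  Few g X = ∀ {u v} → u ∈ E N → v ∈ E N → g u ∈ X → g v ∈ X → u ≡ v

  module _ {g C} (model : Model P N g C) where
    open Model model
    private
      model∉C : ∀ {u} → u ∈ E N → g u ∉ C
      model∉C = image∉C P N model N-simple

    preimage? : ∀ X u → Dec (u ∈ E N × g u ∈ X)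
    preimage? X u = (u ∈? E N) ×-dec (g u ∈? X)

    preimage : Subset m → Subset n
    preimage X = select (preimage? X)

    preimage⊆ : ∀ X → preimage X ⊆ E N
    preimage⊆ X u∈ = proj₁ (∈-select⁻ (preimage? X) u∈)

    image-preimage : ∀ X → image g (preimage X) ⊆ X
    image-preimage X e∈ with ∈-image⁻ g e∈
    ... | u , u∈ , refl = proj₂ (∈-select⁻ (preimage? X) u∈)

    few : ∀ {X} → r N (preimage X) ≤ 1 → Few g X
    few {X} h {u} {v} u∈ v∈ gu∈ gv∈ with u ≟ v
    ... | yes u≡v = u≡v
    ... | no  u≢v = ⊥-elim (ℕ.<⇒≱ (Simple.pair N-simple u∈ v∈ u≢v) (ℕ.≤-trans (r-monotone N _ _
      (∪-⊆ (⁅⁆-⊆ (∈-select⁺ (preimage? X) (u∈ , gu∈))) (⁅⁆-⊆ (∈-select⁺ (preimage? X) (v∈ , gv∈)))) (preimage⊆ X)) h))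

    module _ {x X Y} (vX : Vertical M ⁅ x ⁆ X Y) (x∈C : x ∈ C) where

      side : ∀ {u} → u ∈ E N → g u ∈ X ⊎ g u ∈ Y
      side {u} u∈ = side-of M vX (maps u∈) λ gu≡x → model∉C u∈ (subst (_∈ C) (sym gu≡x) x∈C)

      -- With x contracted, and spanned by both sides, (X, Y) has connectivity at most one, and this
      -- cannot grow in the minor N. As N is 3-connected, one of the two parts of E N has rank at
      -- most one.
      few-side : Few g X ⊎ Few g Y
      few-side with ℕ.≤-<-connex (r N (preimage X)) 1 | ℕ.≤-<-connex (r N (preimage Y)) 1
      ... | inj₁ h | _      = inj₁ (few h)
      ... | inj₂ _ | inj₁ h = inj₂ (few h)
      ... | inj₂ h | inj₂ k = absurd H
        (fact (ρ 𝐅 ⊔ 𝐂 ⊕ ρ 𝐂 ⊕ # 2 ≼ ρ 𝐔 ⊔ 𝐂 ⊕ ρ 𝐕 ⊔ 𝐂) N-unseparated ∷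
         sub (𝐅 ⊔ 𝐂) (𝐗 ⊔ 𝐱) ∷ sub (𝐅 ⊔ 𝐂 ⊔ 𝐗) (𝐘 ⊔ 𝐱) ∷ sub (𝐔 ⊔ 𝐂 ⊓ 𝐗 ⊔ 𝐱) 𝐂 ∷
         sub (𝐕 ⊔ 𝐂 ⊓ 𝐘 ⊔ 𝐱) 𝐂 ∷ sub (𝐂 ⊓ 𝐗 ⊔ 𝐱) (𝐂 ⊓ 𝐘 ⊔ 𝐱) ∷ VX.X+Y ∷ VX.x∈clX ∷ VX.x∈clY ∷
         fact (# 1 ≼ ρ 𝐱) (ThreeConnected.rank-nonloop M (Vertical.x⊆E vX (x∈⁅x⁆ x))) ∷ [])
        where
        U V : Subset n
        U = preimage X
        V = preimage Y
        open Reasoning₃ M (X ∷ Y ∷ ⁅ x ⁆ ∷ C ∷ image g (E N) ∷ image g U ∷ image g V ∷ [])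
        𝐗 = var 1
        𝐘 = var 2
        𝐱 = var 3
        𝐂 = var 4
        𝐅 = var 5
        𝐔 = var 6
        𝐕 = var 7
        module VX = VerticalFacts 𝐱 𝐗 𝐘 vX
        EN⊆UV : E N ⊆ U ∪ V
        EN⊆UV u∈ = x∈p∪q⁺ (Sum.map (λ h → ∈-select⁺ (preimage? X) (u∈ , h))
                                              (λ h → ∈-select⁺ (preimage? Y) (u∈ , h)) (side u∈))
        F⊆UV : image g (E N) ⊆ image g U ∪ image g V
        F⊆UV e∈ = subst (_ ∈_) (image-∪ g U V) (image-mono g EN⊆UV e∈)
        H : SetFacts _
        H = incl (𝐔 ⊑ 𝐗) (image-preimage X) ∷ incl (𝐕 ⊑ 𝐘) (image-preimage Y) ∷
            incl (𝐅 ⊑ 𝐔 ⊔ 𝐕) F⊆UV ∷ incl (𝐔 ⊑ 𝐅) (image-mono g (preimage⊆ X)) ∷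
            incl (𝐕 ⊑ 𝐅) (image-mono g (preimage⊆ Y)) ∷ incl (𝐱 ⊑ 𝐂) (⁅⁆-⊆ x∈C) ∷
            incl (𝐂 ⊑ 𝐄) C⊆E ∷ VX.sets
        N-unseparated : rank (image g (E N) ∪ C) + (rank C + 2) ≤ rank (image g U ∪ C) + rank (image g V ∪ C)
        N-unseparated = begin
          rank (image g (E N) ∪ C) + (rank C + 2)    ≡⟨ cong (_+ (rank C + 2)) (sym (ranks (E N) ⊆-refl)) ⟩
          r N (E N) + rank C + (rank C + 2)          ≡⟨ cong (r N (E N) + rank C +_) (ℕ.+-comm (rank C) 2) ⟩
          r N (E N) + rank C + (2 + rank C)          ≡⟨ +-interchange (r N (E N)) (rank C) 2 (rank C) ⟩
          r N (E N) + 2 + (rank C + rank C)          ≤⟨ ℕ.+-monoˡ-≤ _ N₂ ⟩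
          r N U + r N V + (rank C + rank C)          ≡⟨ +-interchange (r N U) (r N V) (rank C) (rank C) ⟩
          r N U + rank C + (r N V + rank C)          ≡⟨ cong₂ _+_ (ranks U (preimage⊆ X)) (ranks V (preimage⊆ Y)) ⟩
          rank (image g U ∪ C) + rank (image g V ∪ C) ∎
          where
          open ℕ.≤-Reasoning
          NU : NT.rank U ≡ r N U
          NU = total-rank-⊆ N (preimage⊆ X)
          NV : NT.rank V ≡ r N V
          NV = total-rank-⊆ N (preimage⊆ Y)
          N₂ : r N (E N) + 2 ≤ r N U + r N V
          N₂ = subst₂ _≤_ (cong (_+ 2) (total-rank-⊆ N ⊆-refl)) (cong₂ _+_ NU NV)
            (NT.connected₂ U V EN⊆UV (subst (2 ≤_) (sym NU) h) (subst (2 ≤_) (sym NV) k))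

  module Relocate {x X Y} (vX : Vertical M ⁅ x ⁆ X Y) where
    private
      module T = ThreeConnected M
      module V = Vertical vX

    -- A set T with x ∈ T ⊆ X ∪ x meets the span of Y in rank one (low) or two (high), and this alone decides
    -- how contracting T affects Y.
    Low High : Subset m → Set
    Low  T = rank Y + rank T ≤ rank (Y ∪ T) + 1
    High T = rank (Y ∪ T) + 2 ≤ rank Y + rank T

    module _ {T} (x∈T : x ∈ T) (T⊆ : T ⊆ X ∪ ⁅ x ⁆) where
      private
        module B (env : List (Subset m)) where
          open Reasoning₃ M (X ∷ Y ∷ ⁅ x ⁆ ∷ T ∷ env) public
          𝐗 = var 1
          𝐘 = var 2
          𝐱 = var 3
          𝐓 = var 4
          open VerticalFacts 𝐱 𝐗 𝐘 vX public
          H₀ : SetFacts _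
          H₀ = incl (𝐱 ⊑ 𝐓) (⁅⁆-⊆ x∈T) ∷ incl (𝐓 ⊑ 𝐗 ⊔ 𝐱) T⊆ ∷ sets
          1≤x : ⊢ # 1 ≼ ρ 𝐱
          1≤x = fact (# 1 ≼ ρ 𝐱) (T.rank-nonloop (V.x⊆E (x∈⁅x⁆ x)))
          x≤1 : ⊢ ρ 𝐱 ≼ # 1
          x≤1 = fact (ρ 𝐱 ≼ # 1) (T.rank-single x)

      -- A low T meets the span of Y in no more than the point x. Seen from subsets of Y,
      -- contracting T is the same as contracting x.
      low-rank : Low T → ∀ {Q} → Q ⊆ Y → rank (Q ∪ T) + 1 ≡ rank (Q ∪ ⁅ x ⁆) + rank T
      low-rank low {Q} Q⊆ = ℕ.≤-antisym
        (holds (by-ranks H (sub (𝐐 ⊔ 𝐱) 𝐓 ∷ 1≤x ∷ []) {ρ 𝐐 ⊔ 𝐓 ⊕ # 1 ≼ ρ 𝐐 ⊔ 𝐱 ⊕ ρ 𝐓}))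
        (holds (by-ranks H (sub (𝐐 ⊔ 𝐓) (𝐘 ⊔ 𝐱) ∷ x∈clY ∷ fact (ρ 𝐘 ⊕ ρ 𝐓 ≼ ρ 𝐘 ⊔ 𝐓 ⊕ # 1) low ∷ [])
                {ρ 𝐐 ⊔ 𝐱 ⊕ ρ 𝐓 ≼ ρ 𝐐 ⊔ 𝐓 ⊕ # 1}))
        where
        open B (Q ∷ [])
        𝐐 = var 5
        H : SetFacts _
        H = incl (𝐐 ⊑ 𝐘) Q⊆ ∷ H₀

      -- A high T meets the span of Y in rank two, as much as X itself. Seen from subsets of Y,
      -- contracting T is the same as contracting X.
      high-rank : High T → ∀ {Q} → Q ⊆ Y → rank (Q ∪ T) + rank X ≡ rank (Q ∪ X) + rank T
      high-rank high {Q} Q⊆ = ℕ.≤-antisym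
        (holds (by-ranks H (sub (𝐐 ⊔ 𝐗 ⊔ 𝐱) (𝐘 ⊔ 𝐓) ∷ sub (𝐐 ⊔ 𝐗) (𝐗 ⊔ 𝐱) ∷ x∈clX ∷ X+Y ∷
                            fact (ρ 𝐘 ⊔ 𝐓 ⊕ # 2 ≼ ρ 𝐘 ⊕ ρ 𝐓) high ∷ [])
                {ρ 𝐐 ⊔ 𝐓 ⊕ ρ 𝐗 ≼ ρ 𝐐 ⊔ 𝐗 ⊕ ρ 𝐓}))
        (holds (by-ranks H (sub (𝐐 ⊔ 𝐓) (𝐗 ⊔ 𝐱) ∷ x∈clX ∷ []) {ρ 𝐐 ⊔ 𝐗 ⊕ ρ 𝐓 ≼ ρ 𝐐 ⊔ 𝐓 ⊕ ρ 𝐗}))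
        where
        open B (Q ∷ [])
        𝐐 = var 5
        H : SetFacts _
        H = incl (𝐐 ⊑ 𝐘) Q⊆ ∷ H₀

      low-or-high : Low T ⊎ High T
      low-or-high with ℕ.≤-<-connex (rank Y + rank T) (rank (Y ∪ T) + 1)
      ... | inj₁ h = inj₁ h
      ... | inj₂ h = inj₂ (ℕ.≤-trans (ℕ.≤-reflexive (trans (ℕ.+-suc (rank (Y ∪ T)) 1) refl)) h)

      module _ {q} (q∈X : q ∈ X) where
        private
          open B (⁅ q ⁆ ∷ [])
          𝐪 = var 5
          Hq : SetFacts _
          Hq = incl (𝐪 ⊑ 𝐗) (⁅⁆-⊆ q∈X) ∷ H₀
          q≤1 : ⊢ ρ 𝐪 ≼ # 1
          q≤1 = fact (ρ 𝐪 ≼ # 1) (T.rank-single q)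

        -- The number rank Y + rank T - rank (Y ∪ T) is at least one because of x, and at most two
        -- because X has connectivity two. An element that raises rank T but not rank (Y ∪ T) raises
        -- it by one, so from one to two.
        jump : rank T + 1 ≤ rank (T ∪ ⁅ q ⁆) → rank (Y ∪ T ∪ ⁅ q ⁆) ≤ rank (Y ∪ T) →
               Low T × High (T ∪ ⁅ q ⁆)
        jump up flat =
          holds (by-ranks Hq (u ∷ f ∷ d≤2 ∷ []) {ρ 𝐘 ⊕ ρ 𝐓 ≼ ρ 𝐘 ⊔ 𝐓 ⊕ # 1}) ,
          holds (by-ranks Hq (u ∷ f ∷ sub (𝐘 ⊔ 𝐱) 𝐓 ∷ x∈clY ∷ 1≤x ∷ []) {ρ 𝐘 ⊔ 𝐓 ⊔ 𝐪 ⊕ # 2 ≼ ρ 𝐘 ⊕ ρ 𝐓 ⊔ 𝐪})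
          where
          u : ⊢ ρ 𝐓 ⊕ # 1 ≼ ρ 𝐓 ⊔ 𝐪
          u = rank-fact up
          f : ⊢ ρ 𝐘 ⊔ 𝐓 ⊔ 𝐪 ≼ ρ 𝐘 ⊔ 𝐓
          f = rank-fact flat
          d≤2 : ⊢ ρ 𝐘 ⊕ ρ 𝐓 ⊔ 𝐪 ≼ ρ 𝐘 ⊔ 𝐓 ⊔ 𝐪 ⊕ # 2
          d≤2 = by-ranks Hq (sub (𝐘 ⊔ 𝐓 ⊔ 𝐪) (𝐗 ⊔ 𝐱) ∷ x∈clX ∷ X+Y ∷ [])

        jump-rank : Low T → High (T ∪ ⁅ q ⁆) → rank (T ∪ ⁅ q ⁆) ≡ rank T + 1
        jump-rank low high = ℕ.≤-antisym
          (holds (by-ranks [] (sub 𝐓 𝐪 ∷ q≤1 ∷ []) {ρ 𝐓 ⊔ 𝐪 ≼ ρ 𝐓 ⊕ # 1}))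
          (holds (by-ranks [] (fact (ρ 𝐘 ⊕ ρ 𝐓 ≼ ρ 𝐘 ⊔ 𝐓 ⊕ # 1) low ∷
                               fact (ρ 𝐘 ⊔ 𝐓 ⊔ 𝐪 ⊕ # 2 ≼ ρ 𝐘 ⊕ ρ 𝐓 ⊔ 𝐪) high ∷ []) {ρ 𝐓 ⊕ # 1 ≼ ρ 𝐓 ⊔ 𝐪}))

    X-high : High (X ∪ ⁅ x ⁆)
    X-high = holds (by-ranks sets (connect₂ sets (var 1) (var 2 ⊔ var 3) (by-ranks [] (3≤X ∷ [])) (by-ranks [] (3≤Y ∷ [])) ∷ x∈clY ∷ [])
                     {ρ var 2 ⊔ var 1 ⊔ var 3 ⊕ # 2 ≼ ρ var 2 ⊕ ρ var 1 ⊔ var 3})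
      where
      open Reasoning₃ M (X ∷ Y ∷ ⁅ x ⁆ ∷ [])
      open VerticalFacts (var 3) (var 1) (var 2) vX

    -- From a low set, adding elements of X one at a time must pass a jump, since X ∪ x is high.
    record Jump (S : Subset m) : Set where
      field
        {S⁺} : Subset m
        {q}  : Fin m
        S⊆S⁺ : S ⊆ S⁺
        S⁺⊆  : S⁺ ⊆ X ∪ ⁅ x ⁆
        q∈X  : q ∈ X
        low  : Low S⁺
        high : High (S⁺ ∪ ⁅ q ⁆)

    find-jump : ∀ {S} → x ∈ S → S ⊆ X ∪ ⁅ x ⁆ → Low S → Jump S
    find-jump {S} x∈S S⊆ low = go (ℕ.<-wellFounded _) x∈S S⊆ low
      where
      go : ∀ {S} → Acc _<_ ∣ (X ∪ ⁅ x ⁆) ─ S ∣ → x ∈ S → S ⊆ X ∪ ⁅ x ⁆ → Low S → Jump S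
      go {S} (acc rec) x∈S S⊆ low with nonempty? (X ─ S)
      ... | no  e = ⊥-elim (ℕ.<⇒≱ (ℕ.<-≤-trans (ℕ.+-monoʳ-< (rank (Y ∪ S)) (s≤s (s≤s z≤n))) (subst High X≡S X-high)) low)
        where
        open Sets (X ∷ S ∷ ⁅ x ⁆ ∷ [])
        X≡S : X ∪ ⁅ x ⁆ ≡ S
        X≡S = equal (incl (var 0 ⊖ var 1 ⊑ const false) (λ q∈ → ⊥-elim (e (_ , q∈))) ∷
                     incl (var 2 ⊑ var 1) (⁅⁆-⊆ x∈S) ∷ incl (var 1 ⊑ var 0 ⊔ var 2) S⊆ ∷ []) (var 0 ⊔ var 2) (var 1)
      ... | yes (q , q∈) with low-or-high {S ∪ ⁅ q ⁆} (x∈p∪q⁺ (inj₁ x∈S)) Sq⊆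
        where
        Sq⊆ : S ∪ ⁅ q ⁆ ⊆ X ∪ ⁅ x ⁆
        Sq⊆ = ∪-⊆ S⊆ (⁅⁆-⊆ (x∈p∪q⁺ (inj₁ (p─q⊆p X S q∈))))
      ...   | inj₂ high = record { S⊆S⁺ = ⊆-refl ; S⁺⊆ = S⊆ ; q∈X = p─q⊆p X S q∈ ; low = low ; high = high }
      ...   | inj₁ low′ with go (rec shrink) (x∈p∪q⁺ (inj₁ x∈S)) Sq⊆ low′
        where
        Sq⊆ : S ∪ ⁅ q ⁆ ⊆ X ∪ ⁅ x ⁆
        Sq⊆ = ∪-⊆ S⊆ (⁅⁆-⊆ (x∈p∪q⁺ (inj₁ (p─q⊆p X S q∈))))
        open Sets (X ∷ S ∷ ⁅ x ⁆ ∷ ⁅ q ⁆ ∷ [])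
        shrink : ∣ (X ∪ ⁅ x ⁆) ─ (S ∪ ⁅ q ⁆) ∣ < ∣ (X ∪ ⁅ x ⁆) ─ S ∣
        shrink = p⊂q⇒∣p∣<∣q∣ (contained [] ((var 0 ⊔ var 2) ⊖ (var 1 ⊔ var 3)) ((var 0 ⊔ var 2) ⊖ var 1) ,
          q , x∈p∧x∉q⇒x∈p─q (x∈p∪q⁺ (inj₁ (p─q⊆p X S q∈))) (∉─ q∈) , λ h → ∉─ h (x∈p∪q⁺ (inj₂ (x∈⁅x⁆ q))))
      ...     | j = record { S⊆S⁺ = ⊆-trans (p⊆p∪q ⁅ q ⁆) (Jump.S⊆S⁺ j) ; S⁺⊆ = Jump.S⁺⊆ j
                           ; q∈X = Jump.q∈X j ; low = Jump.low j ; high = Jump.high j }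

    module _ {g C} (model : Model P N g C) (x∈C : x ∈ C) (fewX : Few g X)
             {e} (e∈X : e ∈ X) (e∉clY : rank Y + 1 ≤ rank (Y ∪ ⁅ e ⁆)) where
      open Model model
      private
        K A S : Subset m
        K = C ∩ Y
        A = C ∩ (X ∪ ⁅ x ⁆)
        S = ⁅ x ⁆ ∪ ⁅ e ⁆

        K⊆Y : K ⊆ Y
        K⊆Y = p∩q⊆q C Y

        K⊆E : K ⊆ E P
        K⊆E = ⊆-trans K⊆Y V.Y⊆E

        Xx⊆E : X ∪ ⁅ x ⁆ ⊆ E P
        Xx⊆E = ∪-⊆ V.X⊆E V.x⊆E

        x∈A : x ∈ A
        x∈A = x∈p∩q⁺ (x∈C , x∈p∪q⁺ (inj₂ (x∈⁅x⁆ x)))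

        A⊆ : A ⊆ X ∪ ⁅ x ⁆
        A⊆ = p∩q⊆q C (X ∪ ⁅ x ⁆)

        S⊆ : S ⊆ X ∪ ⁅ x ⁆
        S⊆ = ∪-⊆ (q⊆p∪q X ⁅ x ⁆) (⊆-trans (⁅⁆-⊆ e∈X) (p⊆p∪q ⁅ x ⁆))

        x∈S : x ∈ S
        x∈S = x∈p∪q⁺ (inj₁ (x∈⁅x⁆ x))

        S-low : Low S
        S-low = holds (by-ranks [] (sub (var 3) (var 4) ∷ fact (ρ var 3 ≼ # 1) (T.rank-single x) ∷
            fact (ρ var 4 ≼ # 1) (T.rank-single e) ∷ fact (ρ var 2 ⊕ # 1 ≼ ρ var 2 ⊔ var 4) e∉clY ∷ [])
            {ρ var 2 ⊕ ρ var 3 ⊔ var 4 ≼ ρ var 2 ⊔ (var 3 ⊔ var 4) ⊕ # 1})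
          where open Reasoning₃ M (X ∷ Y ∷ ⁅ x ⁆ ∷ ⁅ e ⁆ ∷ [])

        C≡ : C ≡ K ∪ A
        C≡ = equal (incl (var 0 ⊑ var 4) C⊆E ∷ incl (var 4 ⊑ var 1 ⊔ var 2 ⊔ var 3) V.cover ∷ [])
          (var 0) (var 0 ⊓ var 2 ⊔ var 0 ⊓ (var 1 ⊔ var 3))
          where open Sets (C ∷ X ∷ Y ∷ ⁅ x ⁆ ∷ E P ∷ [])

        on-Y : ∀ {Z} → Z ⊆ E N → (∀ {u} → u ∈ Z → g u ∉ X) → image g Z ⊆ Y
        on-Y Z⊆ avoid e∈ with ∈-image⁻ g e∈
        ... | u , u∈Z , refl with side model vX x∈C (Z⊆ u∈Z)
        ...   | inj₁ gu∈X = ⊥-elim (avoid u∈Z gu∈X)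
        ...   | inj₂ gu∈Y = gu∈Y

        ranks′ : ∀ Z → Z ⊆ E N → r N Z + rank (K ∪ A) ≡ rank ((image g Z ∪ K) ∪ A)
        ranks′ Z Z⊆ = subst₂ (λ a b → r N Z + rank a ≡ rank b) C≡
          (trans (cong (image g Z ∪_) C≡) (sym (∪-assoc (image g Z) K A))) (ranks Z Z⊆)

        replace : ∀ {T} → (∀ {u} → u ∈ E N → g u ∉ X) → T ⊆ X ∪ ⁅ x ⁆ →
          (∀ {Q k} → Q ⊆ Y → k + rank (K ∪ A) ≡ rank (Q ∪ A) → k + rank (K ∪ T) ≡ rank (Q ∪ T)) →
          Model P N g (K ∪ T)
        replace {T} avoid T⊆ convert = record
          { C⊆E = ∪-⊆ K⊆E (⊆-trans T⊆ Xx⊆E) ; maps = maps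
          ; ranks = λ Z Z⊆ → trans (convert (∪-⊆ (on-Y Z⊆ λ u∈ → avoid (Z⊆ u∈)) K⊆Y) (ranks′ Z Z⊆))
              (cong rank (∪-assoc (image g Z) K T)) }

        Result : Set
        Result = ∃[ g′ ] ∃[ C′ ] Model P N g′ C′ × x ∈ C′ × e ∈ C′ × Few g′ X

        -- All labels lie in Y, so the contracted part `A` matters only through being low or high. A
        -- low one is replaced by {x, e}, a high one by X ∪ x; both contain x and e.
        avoided : (∀ {u} → u ∈ E N → g u ∉ X) → Result
        avoided avoid with low-or-high x∈A A⊆
        ... | inj₁ low = g , _ , replace avoid S⊆ (λ {Q} {k} Q⊆ eq →
            transfer {rank (K ∪ ⁅ x ⁆)} {rank (K ∪ S)} {rank (Q ∪ ⁅ x ⁆)} {rank (Q ∪ S)} k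
              (sym (low-rank x∈S S⊆ S-low K⊆Y)) (sym (low-rank x∈S S⊆ S-low Q⊆))
              (transfer {rank (K ∪ A)} {rank (K ∪ ⁅ x ⁆)} {rank (Q ∪ A)} {rank (Q ∪ ⁅ x ⁆)} k
                (low-rank x∈A A⊆ low K⊆Y) (low-rank x∈A A⊆ low Q⊆) eq)) ,
          x∈p∪q⁺ (inj₂ x∈S) , x∈p∪q⁺ (inj₂ (x∈p∪q⁺ (inj₂ (x∈⁅x⁆ e)))) , fewX
        ... | inj₂ high = g , _ , replace avoid ⊆-refl (λ {Q} {k} Q⊆ eq →
            transfer {rank (K ∪ X)} {rank (K ∪ X ∪ ⁅ x ⁆)} {rank (Q ∪ X)} {rank (Q ∪ X ∪ ⁅ x ⁆)} k
              (sym (high-rank x∈Xx ⊆-refl X-high K⊆Y)) (sym (high-rank x∈Xx ⊆-refl X-high Q⊆))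
              (transfer {rank (K ∪ A)} {rank (K ∪ X)} {rank (Q ∪ A)} {rank (Q ∪ X)} k
                (high-rank x∈A A⊆ high K⊆Y) (high-rank x∈A A⊆ high Q⊆) eq)) ,
          x∈p∪q⁺ (inj₂ x∈Xx) , x∈p∪q⁺ (inj₂ (x∈p∪q⁺ (inj₁ e∈X))) , fewX
          where
          x∈Xx : x ∈ X ∪ ⁅ x ⁆
          x∈Xx = x∈p∪q⁺ (inj₂ (x∈⁅x⁆ x))


        -- The element of the minor lying in X turns a low set high; any other such element can take its place.
        module _ {u} (u∈N : u ∈ E N) (gu∈X : g u ∈ X) where
          private
            V₀ : Subset n
            V₀ = E N ─ ⁅ u ⁆

            ─-restore : E N ⊆ V₀ ∪ ⁅ u ⁆
            ─-restore = contained [] (var 0) ((var 0 ⊖ var 1) ⊔ var 1)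
              where open Sets (E N ∷ ⁅ u ⁆ ∷ [])

            off-X : ∀ {v} → v ∈ V₀ → g v ∉ X
            off-X v∈ gv∈X = ∉─ v∈ (subst (_∈ ⁅ u ⁆) (fewX u∈N (p─q⊆p (E N) ⁅ u ⁆ v∈) gu∈X gv∈X) (x∈⁅x⁆ u))

            V₀⊆Y : ∀ {Z} → Z ⊆ V₀ → image g Z ⊆ Y
            V₀⊆Y Z⊆ = on-Y (⊆-trans Z⊆ (p─q⊆p (E N) ⁅ u ⁆)) λ v∈ → off-X (Z⊆ v∈)

            ranks-u : ∀ Z → Z ⊆ V₀ → r N (Z ∪ ⁅ u ⁆) + rank (K ∪ A) ≡ rank ((image g Z ∪ K) ∪ A ∪ ⁅ g u ⁆)
            ranks-u Z Z⊆ = trans (ranks′ (Z ∪ ⁅ u ⁆) (∪-⊆ (⊆-trans Z⊆ (p─q⊆p (E N) ⁅ u ⁆)) (⁅⁆-⊆ u∈N)))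
              (cong rank (trans (cong (λ G → (G ∪ K) ∪ A) (trans (image-∪ g Z ⁅ u ⁆) (cong (image g Z ∪_) (image-⁅⁆ g u))))
                (equal [] (((var 0 ⊔ var 1) ⊔ var 2) ⊔ var 3) ((var 0 ⊔ var 2) ⊔ var 3 ⊔ var 1))))
              where open Sets (image g Z ∷ ⁅ g u ⁆ ∷ K ∷ A ∷ [])

            -- `up`: u is not a loop of N, so its label is not spanned by the contracted set.
            -- `level`: u is not a coloop of the connected N, so its label is spanned by the
            -- contracted set and the other labels, which all lie in Y.
            A-jump : Low A × High (A ∪ ⁅ g u ⁆)
            A-jump = jump x∈A A⊆ gu∈X up level
              where
              G = image g V₀
              open Reasoning₃ M (Y ∷ G ∷ K ∷ A ∷ ⁅ g u ⁆ ∷ [])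
              𝐘 = var 1
              𝐆 = var 2
              𝐊 = var 3
              𝐀 = var 4
              𝐪 = var 5
              up₀ : rank (K ∪ A) + 1 ≤ rank (K ∪ A ∪ ⁅ g u ⁆)
              up₀ = begin
                rank (K ∪ A) + 1                  ≡⟨ ℕ.+-comm (rank (K ∪ A)) 1 ⟩
                1 + rank (K ∪ A)                  ≤⟨ ℕ.+-monoˡ-≤ _ (ℕ.≤-trans (Simple.nonloop N-simple u∈N) (r-monotone N _ _ (q⊆p∪q ⊥ ⁅ u ⁆)
                                                       (∪-⊆ (⊆-trans ⊥⊆ (p─q⊆p (E N) ⁅ u ⁆)) (⁅⁆-⊆ u∈N)))) ⟩
                r N (⊥ ∪ ⁅ u ⁆) + rank (K ∪ A)    ≡⟨ ranks-u ⊥ ⊥⊆ ⟩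
                rank ((image g ⊥ ∪ K) ∪ A ∪ ⁅ g u ⁆) ≤⟨ rank-mono _ _ (∪-⊆ (∪-⊆ none (p⊆p∪q (A ∪ ⁅ g u ⁆))) (q⊆p∪q K (A ∪ ⁅ g u ⁆))) ⟩
                rank (K ∪ A ∪ ⁅ g u ⁆)            ∎
                where
                open ℕ.≤-Reasoning
                none : image g ⊥ ⊆ K ∪ A ∪ ⁅ g u ⁆
                none e∈ with ∈-image⁻ g e∈
                ... | v , v∈ , _ = ⊥-elim (∉⊥ v∈)
              level₀ : rank ((G ∪ K) ∪ A ∪ ⁅ g u ⁆) ≤ rank ((G ∪ K) ∪ A)
              level₀ = begin
                rank ((G ∪ K) ∪ A ∪ ⁅ g u ⁆)      ≡⟨ sym (ranks-u V₀ ⊆-refl) ⟩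
                r N (V₀ ∪ ⁅ u ⁆) + rank (K ∪ A)   ≤⟨ ℕ.+-monoˡ-≤ _ no-coloop ⟩
                r N V₀ + rank (K ∪ A)             ≡⟨ ranks′ V₀ (p─q⊆p (E N) ⁅ u ⁆) ⟩
                rank ((G ∪ K) ∪ A)                ∎
                where
                open ℕ.≤-Reasoning
                no-coloop : r N (V₀ ∪ ⁅ u ⁆) ≤ r N V₀
                no-coloop = ℕ.≤-trans (r-monotone N _ _ (∪-⊆ (p─q⊆p (E N) ⁅ u ⁆) (⁅⁆-⊆ u∈N)) ⊆-refl)
                  (subst₂ _≤_ (total-rank-⊆ N ⊆-refl) (total-rank-⊆ N (p─q⊆p (E N) ⁅ u ⁆))
                    (NT.connected₁ V₀ ⁅ u ⁆ (─-restore)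
                      (NT.rank-single u)))
              up : rank A + 1 ≤ rank (A ∪ ⁅ g u ⁆)
              up = holds (by-ranks [] (fact (ρ 𝐊 ⊔ 𝐀 ⊕ # 1 ≼ ρ 𝐊 ⊔ 𝐀 ⊔ 𝐪) up₀ ∷ sub (𝐊 ⊔ 𝐀) (𝐀 ⊔ 𝐪) ∷ [])
                          {ρ 𝐀 ⊕ # 1 ≼ ρ 𝐀 ⊔ 𝐪})
              level : rank (Y ∪ A ∪ ⁅ g u ⁆) ≤ rank (Y ∪ A)
              level = holds (by-ranks (incl (𝐊 ⊑ 𝐘) K⊆Y ∷ incl (𝐆 ⊑ 𝐘) (V₀⊆Y ⊆-refl) ∷ [])
                (fact (ρ (𝐆 ⊔ 𝐊) ⊔ 𝐀 ⊔ 𝐪 ≼ ρ (𝐆 ⊔ 𝐊) ⊔ 𝐀) level₀ ∷ sub (𝐘 ⊔ 𝐀) ((𝐆 ⊔ 𝐊) ⊔ 𝐀 ⊔ 𝐪) ∷ [])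
                {ρ 𝐘 ⊔ 𝐀 ⊔ 𝐪 ≼ ρ 𝐘 ⊔ 𝐀})

            j : Jump S
            j = find-jump x∈S S⊆ S-low

            open Jump j

            x∈S⁺ : x ∈ S⁺
            x∈S⁺ = S⊆S⁺ x∈S

            g′ : Fin n → Fin m
            g′ v = if does (v ≟ u) then q else g v

            g′u : g′ u ≡ q
            g′u = cong (if_then q else g u) (dec-true (u ≟ u) refl)

            g′v : ∀ {v} → v ≢ u → g′ v ≡ g v
            g′v {v} v≢u = cong (if_then q else g v) (dec-false (v ≟ u) v≢u)

            image-g′ : ∀ {Z} → Z ⊆ V₀ → image g′ Z ≡ image g Z
            image-g′ {Z} Z⊆ = ⊆-antisym
              (λ e∈ → case ∈-image⁻ g′ e∈ of λ where
                (v , v∈ , refl) → subst (_∈ image g Z) (sym (g′v (≢u v∈))) (∈-image⁺ g v∈))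
              (λ e∈ → case ∈-image⁻ g e∈ of λ where
                (v , v∈ , refl) → subst (_∈ image g′ Z) (g′v (≢u v∈)) (∈-image⁺ g′ v∈))
              where
              ≢u : ∀ {v} → v ∈ Z → v ≢ u
              ≢u v∈ refl = ∉─ (Z⊆ v∈) (x∈⁅x⁆ u)

            ranks-S⁺ : ∀ Z → Z ⊆ V₀ → r N Z + rank (K ∪ S⁺) ≡ rank (image g′ Z ∪ K ∪ S⁺)
            ranks-S⁺ Z Z⊆ = trans
              (transfer {rank (K ∪ ⁅ x ⁆)} {rank (K ∪ S⁺)} {rank (Q ∪ ⁅ x ⁆)} {rank (Q ∪ S⁺)} (r N Z)
                (sym (low-rank x∈S⁺ S⁺⊆ low K⊆Y)) (sym (low-rank x∈S⁺ S⁺⊆ low Q⊆))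
                (transfer {rank (K ∪ A)} {rank (K ∪ ⁅ x ⁆)} {rank (Q ∪ A)} {rank (Q ∪ ⁅ x ⁆)} (r N Z)
                  (low-rank x∈A A⊆ (proj₁ A-jump) K⊆Y) (low-rank x∈A A⊆ (proj₁ A-jump) Q⊆)
                  (ranks′ Z (⊆-trans Z⊆ (p─q⊆p (E N) ⁅ u ⁆)))))
              (cong rank (trans (cong (λ G → (G ∪ K) ∪ S⁺) (sym (image-g′ Z⊆))) (∪-assoc (image g′ Z) K S⁺)))
              where
              Q = image g Z ∪ K
              Q⊆ : Q ⊆ Y
              Q⊆ = ∪-⊆ (V₀⊆Y Z⊆) K⊆Y

            -- Both models reduce to k + rank (K ∪ x) + rank X = rank (Q ∪ X) + 2, in which neither
            -- (A, g u) nor (S⁺, q) occurs.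
            ranks-S⁺u : ∀ Z → Z ⊆ V₀ → r N (Z ∪ ⁅ u ⁆) + rank (K ∪ S⁺) ≡ rank (image g′ (Z ∪ ⁅ u ⁆) ∪ K ∪ S⁺)
            ranks-S⁺u Z Z⊆ = trans
              (transfer-jump⁻¹ {rank (K ∪ S⁺)} {rank (K ∪ ⁅ x ⁆)} {rank (Q ∪ S⁺ ∪ ⁅ q ⁆)} {rank (Q ∪ X)} {rank X} {rank S⁺} k
                (low-rank x∈S⁺ S⁺⊆ low K⊆Y) (high-jump x∈S⁺ S⁺⊆ q∈X low high)
                (transfer-jump {rank (K ∪ A)} {rank (K ∪ ⁅ x ⁆)} {rank (Q ∪ A ∪ ⁅ g u ⁆)} {rank (Q ∪ X)} {rank X} {rank A} k
                  (low-rank x∈A A⊆ (proj₁ A-jump) K⊆Y) (high-jump x∈A A⊆ gu∈X (proj₁ A-jump) (proj₂ A-jump))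
                  (ranks-u Z Z⊆)))
              (cong rank (trans (equal [] ((var 0 ⊔ var 2) ⊔ var 3 ⊔ var 1) ((var 0 ⊔ var 1) ⊔ var 2 ⊔ var 3))
                (cong (_∪ (K ∪ S⁺)) (sym image-u))))
              where
              Q = image g Z ∪ K
              k = r N (Z ∪ ⁅ u ⁆)
              open Sets (image g Z ∷ ⁅ q ⁆ ∷ K ∷ S⁺ ∷ [])
              Q⊆ : Q ⊆ Y
              Q⊆ = ∪-⊆ (V₀⊆Y Z⊆) K⊆Y
              image-u : image g′ (Z ∪ ⁅ u ⁆) ≡ image g Z ∪ ⁅ q ⁆
              image-u = trans (image-∪ g′ Z ⁅ u ⁆) (cong₂ _∪_ (image-g′ Z⊆) (trans (image-⁅⁆ g′ u) (cong ⁅_⁆ g′u)))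
              high-jump : ∀ {T p} → x ∈ T → T ⊆ X ∪ ⁅ x ⁆ → p ∈ X → Low T → High (T ∪ ⁅ p ⁆) →
                          rank (Q ∪ T ∪ ⁅ p ⁆) + rank X ≡ rank (Q ∪ X) + (rank T + 1)
              high-jump x∈T T⊆ p∈X low high = trans
                (high-rank (x∈p∪q⁺ (inj₁ x∈T)) (∪-⊆ T⊆ (⁅⁆-⊆ (x∈p∪q⁺ (inj₁ p∈X)))) high Q⊆)
                (cong (rank (Q ∪ X) +_) (jump-rank x∈T T⊆ p∈X low high))

          moved : Result
          moved = g′ , K ∪ S⁺ , record
            { C⊆E = ∪-⊆ K⊆E (⊆-trans S⁺⊆ Xx⊆E) ; maps = maps′ ; ranks = all-ranks } ,
            x∈p∪q⁺ (inj₂ x∈S⁺) , x∈p∪q⁺ (inj₂ (S⊆S⁺ (x∈p∪q⁺ (inj₂ (x∈⁅x⁆ e))))) ,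
            λ v∈ w∈ gv∈ gw∈ → trans (only-u v∈ gv∈) (sym (only-u w∈ gw∈))
            where
            maps′ : ∀ {v} → v ∈ E N → g′ v ∈ E P
            maps′ {v} v∈ = case v ≟ u of λ where
              (yes refl) → subst (_∈ E P) (sym g′u) (V.X⊆E q∈X)
              (no  v≢u)  → subst (_∈ E P) (sym (g′v v≢u)) (maps v∈)
            only-u : ∀ {v} → v ∈ E N → g′ v ∈ X → v ≡ u
            only-u {v} v∈ gv∈ = case v ≟ u of λ where
              (yes v≡u) → v≡u
              (no  v≢u) → fewX v∈ u∈N (subst (_∈ X) (g′v v≢u) gv∈) gu∈X
            all-ranks : ∀ Z → Z ⊆ E N → r N Z + rank (K ∪ S⁺) ≡ rank (image g′ Z ∪ K ∪ S⁺)
            all-ranks Z Z⊆ = case u ∈? Z of λ where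
                (no  u∉Z) → ranks-S⁺ Z λ v∈ → x∈p∧x∉q⇒x∈p─q (Z⊆ v∈) λ v∈u →
                              u∉Z (subst (_∈ Z) (x∈⁅y⁆⇒x≡y u v∈u) v∈)
                (yes u∈Z) → subst (λ W → r N W + rank (K ∪ S⁺) ≡ rank (image g′ W ∪ K ∪ S⁺))
                  (equal (incl (var 1 ⊑ var 0) (⁅⁆-⊆ u∈Z) ∷ []) ((var 0 ⊖ var 1) ⊔ var 1) (var 0))
                  (ranks-S⁺u (Z ─ ⁅ u ⁆) (contained (incl (var 0 ⊑ var 2) Z⊆ ∷ []) (var 0 ⊖ var 1) (var 2 ⊖ var 1)))
              where open Sets (Z ∷ ⁅ u ⁆ ∷ E N ∷ [])

      -- Keeping `x` contracted and X nearly free of labels is the point: the same model then gives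
      -- information on the partition at x and on one at e.
      relocate : ∃[ g′ ] ∃[ C′ ] Model P N g′ C′ × x ∈ C′ × e ∈ C′ × Few g′ X
      relocate with any? (preimage? model X)
      ... | no  none = avoided λ u∈ gu∈ → none (_ , u∈ , gu∈)
      ... | yes (u , u∈ , gu∈X) = moved u∈ gu∈X

-- Separations of si (P / x) and co (si (P / x))

separation? : ∀ {m} k (P : Matroid m) → Dec (∃[ X ] Separation k P X)
separation? k P = anySubset? λ X →
  (X ⊆? E P) ×-dec (suc (connectivity P X) ℕ.≤? k) ×-dec (k ℕ.≤? ∣ X ∣) ×-dec (k ℕ.≤? ∣ E P ─ X ∣)

connected-or-separated : ∀ {m} (P : Matroid m) →
  Connected 3 P ⊎ (∃[ X ] Separation 1 P X) ⊎ (∃[ X ] Separation 2 P X)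
connected-or-separated P with separation? 1 P | separation? 2 P
... | yes s | _     = inj₂ (inj₁ s)
... | no  _ | yes s = inj₂ (inj₂ s)
... | no ¬s | no ¬t = inj₁ λ where
  1 _ _ → ¬s
  2 _ _ → ¬t
  (suc (suc (suc _))) _ (s≤s (s≤s (s≤s ())))

small-connectivity : ∀ {m k} (P : Matroid m) {X} → connectivity P X < k → r P X + r P (E P ─ X) < r P (E P) + k
small-connectivity {k = k} P {X} h = ℕ.≤-<-trans (ℕ.m≤n+m∸n (r P X + r P (E P ─ X)) (r P (E P)))
  (ℕ.+-monoʳ-< (r P (E P)) h)

-- S stands for si (P / ⁅ x ⁆).

module _ {m} (P : Matroid m) (x : Fin m) (S : Matroid m) where
  open RankFunction (total-rank P)

  -- A bipartition of S spread over all of E - x without gaining rank in P / x. Together with x,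
  -- each part has in P one more than its rank in S.
  record Lift (A B : Subset m) : Set where
    field
      {A⁺ B⁺}  : Subset m
      A⊆A⁺     : A ⊆ A⁺
      B⊆B⁺     : B ⊆ B⁺
      A⁺⊆      : A⁺ ⊆ E P ─ ⁅ x ⁆
      B⁺⊆      : B⁺ ⊆ E P ─ ⁅ x ⁆
      covered  : E P ─ ⁅ x ⁆ ⊆ A⁺ ∪ B⁺
      disjoint : A⁺ ∩ B⁺ ⊆ ⊥
      A-rank   : rank (A⁺ ∪ ⁅ x ⁆) ≡ r S A + 1
      B-rank   : rank (B⁺ ∪ ⁅ x ⁆) ≡ r S B + 1

  record Simplified : Set where
    field
      S⊆     : E S ⊆ E P ─ ⁅ x ⁆
      S-rank : ∀ {X} → X ⊆ E S → rank (X ∪ ⁅ x ⁆) ≡ r S X + 1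
      simple : ∀ {s t} → s ∈ E S → t ∈ E S → s ≢ t → 2 ≤ r S (⁅ s ⁆ ∪ ⁅ t ⁆)
      lift   : ∀ {A} → A ⊆ E S → Lift A (E S ─ A)

module _ {m} (P : Matroid m) {x : Fin m} (x∈E : x ∈ E P) (x≡1 : RankFunction.rank (total-rank P) ⁅ x ⁆ ≡ 1) where
  open RankFunction (total-rank P)

  module _ (Q : Matroid m) (EQ : E Q ≡ E P ─ ⁅ x ⁆)
           (Q-rank : ∀ X → RankFunction.rank (total-rank Q) X + 1 ≡ rank (X ∪ ⁅ x ⁆)) where
    private
      module Q = RankFunction (total-rank Q)

      same : ∀ {X X⁺} → X ⊆ E (si Q) → X ⊆ X⁺ → Q.rank X⁺ ≤ Q.rank X → rank (X⁺ ∪ ⁅ x ⁆) ≡ r Q X + 1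
      same {X} {X⁺} X⊆ X⊆X⁺ h = trans (sym (Q-rank X⁺))
        (cong (_+ 1) (trans (ℕ.≤-antisym h (Q.rank-mono _ _ X⊆X⁺)) (total-rank-⊆ Q (⊆-trans X⊆ (si⊆ Q)))))

      build : ∀ {A B} → A ⊆ E (si Q) → B ⊆ E (si Q) →
        (∃[ A′ ] ∃[ B′ ] A ⊆ A′ × B ⊆ B′ × A′ ⊆ E Q × B′ ⊆ E Q × E Q ⊆ A′ ∪ B′ × A′ ∩ B′ ⊆ ⊥ ×
           Q.rank A′ ≤ Q.rank A × Q.rank B′ ≤ Q.rank B) → Lift P x (si Q) A B
      build A⊆ B⊆ (A⁺ , B⁺ , A⊆A⁺ , B⊆B⁺ , A⁺⊆ , B⁺⊆ , covered , disjoint , A-rank , B-rank) = record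
        { A⊆A⁺ = A⊆A⁺ ; B⊆B⁺ = B⊆B⁺
        ; A⁺⊆ = subst (A⁺ ⊆_) EQ A⁺⊆ ; B⁺⊆ = subst (B⁺ ⊆_) EQ B⁺⊆
        ; covered = subst (_⊆ A⁺ ∪ B⁺) EQ covered ; disjoint = disjoint
        ; A-rank = same A⊆ A⊆A⁺ A-rank ; B-rank = same B⊆ B⊆B⁺ B-rank }

    si-simplified : Simplified P x (si Q)
    si-simplified = record
      { S⊆ = subst (E (si Q) ⊆_) EQ (si⊆ Q)
      ; S-rank = λ {X} X⊆ → same {X} X⊆ ⊆-refl ℕ.≤-refl
      ; simple = si-simple Q
      ; lift = λ {A} A⊆ → build A⊆ (p─q⊆p (E (si Q)) A) (extend Q A⊆ (p─q⊆p (E (si Q)) A) (cover A) (disjoint A)) }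
      where
      cover : ∀ A → E (si Q) ⊆ A ∪ (E (si Q) ─ A)
      cover A = contained [] (var 1) (var 0 ⊔ (var 1 ⊖ var 0))
        where open Sets (A ∷ E (si Q) ∷ [])
      disjoint : ∀ A → A ∩ (E (si Q) ─ A) ⊆ ⊥
      disjoint A = contained [] (var 0 ⊓ (var 1 ⊖ var 0)) (const false)
        where open Sets (A ∷ E (si Q) ∷ [])

  si-contraction-simplified : Simplified P x (si (P / ⁅ x ⁆))
  si-contraction-simplified = si-simplified (P / ⁅ x ⁆) refl
    λ X → trans (cong (RankFunction.rank (total-rank (P / ⁅ x ⁆)) X +_) (sym x≡1)) (contract-total-rank P x∈E X)

module _ {m} (P : Matroid m) (P-conn : Connected 3 P) (4≤P : 4 ≤ ∣ E P ∣) {x : Fin m} (x∈E : x ∈ E P)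
         (S : Matroid m) (simplified : Simplified P x S) where
  private
    M : ThreeConnected m
    M = three-connected P P-conn 4≤P
    module T = ThreeConnected M
  open RankFunction (total-rank P)
  open Simplified simplified

  private
    empty-difference : E S ─ E S ≡ ⊥ ∩ E S
    empty-difference = equal [] (var 0 ⊖ var 0) (const false ⊓ var 0)
      where open Sets (E S ∷ [])

    module Whole = Lift (lift ⊆-refl)

  -- Apply `lift` to the partition of E S into itself and the empty set. The second part has rank
  -- one together with x, so it adds nothing to the first.
  S-spans : r S (E S) + 1 ≡ rank (E P)
  S-spans = ℕ.≤-antisym
    (ℕ.≤-trans (ℕ.≤-reflexive (sym Whole.A-rank))
      (rank-mono _ _ (∪-⊆ (⊆-trans Whole.A⁺⊆ (p─q⊆p (E P) ⁅ x ⁆)) (⁅⁆-⊆ x∈E))))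
    (ℕ.+-cancelʳ-≤ 1 _ _ (begin
      rank (E P) + 1                                       ≤⟨ holds (by-ranks (incl (var 0 ⊑ (var 1 ⊔ var 2) ⊔ var 3) cover ∷ [])
                                                                (sub (var 1 ⊔ var 3) (var 2 ⊔ var 3) ∷
                                                                 fact (# 1 ≼ ρ var 3) (T.rank-nonloop x∈E) ∷ [])
                                                                {ρ var 0 ⊕ # 1 ≼ ρ var 1 ⊔ var 3 ⊕ ρ var 2 ⊔ var 3}) ⟩
      rank (Whole.A⁺ ∪ ⁅ x ⁆) + rank (Whole.B⁺ ∪ ⁅ x ⁆)    ≡⟨ cong₂ _+_ Whole.A-rank Whole.B-rank ⟩
      r S (E S) + 1 + (r S (E S ─ E S) + 1)                ≡⟨ cong (λ k → r S (E S) + 1 + (k + 1)) none ⟩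
      r S (E S) + 1 + 1                                    ∎))
    where
    open ℕ.≤-Reasoning
    open Reasoning (total-rank P) (E P ∷ Whole.A⁺ ∷ Whole.B⁺ ∷ ⁅ x ⁆ ∷ [])
    cover : E P ⊆ (Whole.A⁺ ∪ Whole.B⁺) ∪ ⁅ x ⁆
    cover {e} e∈ with e ∈? ⁅ x ⁆
    ... | yes e∈x = x∈p∪q⁺ (inj₂ e∈x)
    ... | no  e∉x = x∈p∪q⁺ (inj₁ (Whole.covered (x∈p∧x∉q⇒x∈p─q e∈ e∉x)))
    none : r S (E S ─ E S) ≡ 0
    none = trans (cong (r S) empty-difference) (RankFunction.rank-⊥ (total-rank S))

  module _ {A} (A⊆ : A ⊆ E S) where
    private
      B = E S ─ A
      module L = Lift (lift A⊆)
      open Reasoning₃ M (L.A⁺ ∷ L.B⁺ ∷ ⁅ x ⁆ ∷ [])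
      𝐀 = var 1
      𝐁 = var 2
      𝐱 = var 3
      H : SetFacts _
      H = incl (𝐄 ⊖ 𝐱 ⊑ 𝐀 ⊔ 𝐁) L.covered ∷ incl (𝐀 ⊑ 𝐄 ⊖ 𝐱) L.A⁺⊆ ∷ incl (𝐁 ⊑ 𝐄 ⊖ 𝐱) L.B⁺⊆ ∷
          incl (𝐀 ⊓ 𝐁 ⊑ ∅) L.disjoint ∷ incl (𝐱 ⊑ 𝐄) (⁅⁆-⊆ x∈E) ∷ []

      -- Adding x costs one on each side but only one on the whole; the strict inequality pays for
      -- the other.
      lifted-sum : ∀ k → r S A + r S B < r S (E S) + k → rank (L.A⁺ ∪ ⁅ x ⁆) + rank (L.B⁺ ∪ ⁅ x ⁆) ≤ rank (E P) + k
      lifted-sum k h = begin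
        rank (L.A⁺ ∪ ⁅ x ⁆) + rank (L.B⁺ ∪ ⁅ x ⁆)  ≡⟨ cong₂ _+_ L.A-rank L.B-rank ⟩
        r S A + 1 + (r S B + 1)                    ≡⟨ +-interchange (r S A) 1 (r S B) 1 ⟩
        r S A + r S B + 2                          ≡⟨ ℕ.+-comm (r S A + r S B) 2 ⟩
        suc (suc (r S A + r S B))                  ≤⟨ s≤s h ⟩
        suc (r S (E S) + k)                        ≡⟨ cong (_+ k) (trans (ℕ.+-comm 1 (r S (E S))) S-spans) ⟩
        rank (E P) + k                             ∎
        where open ℕ.≤-Reasoning

      nonempty-rank : ∀ {X X⁺ e} → X⁺ ⊆ E P ─ ⁅ x ⁆ → X ⊆ X⁺ → e ∈ X → 2 ≤ rank (X⁺ ∪ ⁅ x ⁆)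
      nonempty-rank {X} {X⁺} {e} X⁺⊆ X⊆ e∈ = ℕ.≤-trans
        (T.rank-pair (p─q⊆p (E P) ⁅ x ⁆ (X⁺⊆ (X⊆ e∈))) x∈E λ { refl → ∉─ (X⁺⊆ (X⊆ e∈)) (x∈⁅x⁆ e) })
        (rank-mono _ _ (∪-⊆ (⊆-trans (⁅⁆-⊆ (X⊆ e∈)) (p⊆p∪q ⁅ x ⁆)) (q⊆p∪q X⁺ ⁅ x ⁆)))

      S-thick : ∀ {X} → X ⊆ E S → 2 ≤ ∣ X ∣ → 2 ≤ r S X
      S-thick X⊆ 2≤X with ∣∣≥2⇒≢ 2≤X
      ... | s , t , s∈ , t∈ , s≢t = ℕ.≤-trans (simple (X⊆ s∈) (X⊆ t∈) s≢t)
              (r-monotone S _ _ (∪-⊆ (⁅⁆-⊆ s∈) (⁅⁆-⊆ t∈)) X⊆)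

    no-1-separation : connectivity S A < 1 → 1 ≤ ∣ A ∣ → 1 ≤ ∣ B ∣ → False
    no-1-separation small 1≤A 1≤B with ∣∣≥1⇒∈ 1≤A | ∣∣≥1⇒∈ 1≤B
    ... | a , a∈ | b , b∈ = absurd H
      (connect₂ H (𝐀 ⊔ 𝐱) (𝐁 ⊔ 𝐱) (rank-fact (nonempty-rank L.A⁺⊆ L.A⊆A⁺ a∈)) (rank-fact (nonempty-rank L.B⁺⊆ L.B⊆B⁺ b∈)) ∷
       fact (ρ 𝐀 ⊔ 𝐱 ⊕ ρ 𝐁 ⊔ 𝐱 ≼ ρ 𝐄 ⊕ # 1) (lifted-sum 1 (small-connectivity S small)) ∷ [])

    -- Simplicity of S turns two elements into rank two, hence rank three together with x. This is
    -- the rank bound that `vertical` asks for.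
    lift-2-separation : connectivity S A < 2 → 2 ≤ ∣ A ∣ → 2 ≤ ∣ B ∣ →
      ∃[ Z ] ∃[ W ] Vertical M ⁅ x ⁆ Z W × A ⊆ Z × B ⊆ W ×
        r S A + 1 ≡ rank (Z ∪ ⁅ x ⁆) × r S B + 1 ≡ rank (W ∪ ⁅ x ⁆)
    lift-2-separation small 2≤A 2≤B = L.A⁺ , L.B⁺ ,
      vertical M (included (by-sets H {𝐀 ⊑ 𝐄})) (included (by-sets H {𝐁 ⊑ 𝐄})) (⁅⁆-⊆ x∈E)
        (included (by-sets H {𝐄 ⊑ 𝐀 ⊔ 𝐁 ⊔ 𝐱})) L.disjoint
        (included (by-sets H {𝐀 ⊓ 𝐱 ⊑ ∅})) (included (by-sets H {𝐁 ⊓ 𝐱 ⊑ ∅})) (T.rank-single x)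
        (three L.A-rank (S-thick A⊆ 2≤A)) (three L.B-rank (S-thick (p─q⊆p (E S) A) 2≤B))
        (lifted-sum 2 (small-connectivity S small)) ,
      L.A⊆A⁺ , L.B⊆B⁺ , sym L.A-rank , sym L.B-rank
      where
      three : ∀ {a b} → a ≡ b + 1 → 2 ≤ b → 3 ≤ a
      three refl 2≤b = ℕ.+-monoˡ-≤ 1 2≤b

  si-connected-or-vertical : Connected 3 S ⊎ ∃[ Z ] ∃[ W ] Vertical M ⁅ x ⁆ Z W
  si-connected-or-vertical with connected-or-separated S
  ... | inj₁ c = inj₁ c
  ... | inj₂ (inj₁ (A , A⊆ , small , 1≤A , 1≤B)) = ⊥-elim (no-1-separation A⊆ small 1≤A 1≤B)
  ... | inj₂ (inj₂ (A , A⊆ , small , 2≤A , 2≤B)) with lift-2-separation A⊆ small 2≤A 2≤B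
  ...   | Z , W , v , _ = inj₂ (Z , W , v)

  -- The small side is a series pair of S, so cosimplification destroys the 2-separation.
  co-connected : (∀ {Z W} → Vertical M ⁅ x ⁆ Z W → ∣ Z ∩ E S ∣ ≤ 2 ⊎ ∣ W ∩ E S ∣ ≤ 2) → Connected 3 (co S)
  co-connected small = connected-dual (si (S *)) (go (connected-or-separated (si (S *))))
    where
    module S* = RankFunction (total-rank (S *))

    record Extension (k : ℕ) : Set where
      field
        {A}    : Subset m
        A⊆     : A ⊆ E S
        A-card : k ≤ ∣ A ∣
        B-card : k ≤ ∣ E S ─ A ∣
        λ<k    : connectivity S A < k
        corank : 2 ≤ k → 2 ≤ r (S *) A × 2 ≤ r (S *) (E S ─ A)

    T-thick : ∀ {X X⁺} → X ⊆ E (si (S *)) → X ⊆ X⁺ → X⁺ ⊆ E S → 2 ≤ ∣ X ∣ → 2 ≤ r (S *) X⁺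
    T-thick {X} {X⁺} X⊆ X⊆X⁺ X⁺⊆ 2≤X = case ∣∣≥2⇒≢ 2≤X of λ where
      (s , t , s∈ , t∈ , s≢t) → ℕ.≤-trans (si-simple (S *) (X⊆ s∈) (X⊆ t∈) s≢t)
        (r-monotone (S *) _ _ (∪-⊆ (⁅⁆-⊆ (X⊆X⁺ s∈)) (⁅⁆-⊆ (X⊆X⁺ t∈))) X⁺⊆)

    -- Extending the sides from si(S*) to S* raises neither of their ranks, and the rank of the
    -- whole does not drop, so the connectivity does not rise.
    extension : ∀ {k} → 1 ≤ k → ∃[ A ] Separation k (si (S *)) A → Extension k
    extension {k} 1≤k (A , A⊆ , λ<k , k≤A , k≤B) =
      build (extend (S *) A⊆ B⊆ (contained [] (var 1) (var 0 ⊔ (var 1 ⊖ var 0))) (contained [] (var 0 ⊓ (var 1 ⊖ var 0)) (const false)))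
      where
      B : Subset m
      B = E (si (S *)) ─ A
      B⊆ : B ⊆ E (si (S *))
      B⊆ = p─q⊆p (E (si (S *))) A
      open Sets (A ∷ E (si (S *)) ∷ [])
      build : (∃[ A′ ] ∃[ B′ ] A ⊆ A′ × B ⊆ B′ × A′ ⊆ E S × B′ ⊆ E S × E S ⊆ A′ ∪ B′ × A′ ∩ B′ ⊆ ⊥ ×
                 S*.rank A′ ≤ S*.rank A × S*.rank B′ ≤ S*.rank B) → Extension k
      build (A⁺ , B⁺ , A⊆A⁺ , B⊆B⁺ , A⁺⊆ , B⁺⊆ , covered , disjoint , A-rank , B-rank) = record
        { A⊆ = A⁺⊆
        ; A-card = ℕ.≤-trans k≤A (p⊆q⇒∣p∣≤∣q∣ A⊆A⁺)
        ; B-card = subst (λ Y → k ≤ ∣ Y ∣) (sym B≡) (ℕ.≤-trans k≤B (p⊆q⇒∣p∣≤∣q∣ B⊆B⁺))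
        ; λ<k = subst (_< k) (connectivity-dual S A⁺⊆) (ℕ.≤-<-trans below λ<k)
        ; corank = λ 2≤k → T-thick A⊆ A⊆A⁺ A⁺⊆ (ℕ.≤-trans 2≤k k≤A) ,
                          subst (λ Y → 2 ≤ r (S *) Y) (sym B≡) (T-thick B⊆ B⊆B⁺ B⁺⊆ (ℕ.≤-trans 2≤k k≤B)) }
        where
        B≡ : E S ─ A⁺ ≡ B⁺
        B≡ = ⊆-antisym
          (λ e∈ → [ (λ e∈A → ⊥-elim (∉─ e∈ e∈A)) , (λ e∈B → e∈B) ]′ (x∈p∪q⁻ A⁺ B⁺ (covered (p─q⊆p (E S) A⁺ e∈))))
          (λ e∈B → x∈p∧x∉q⇒x∈p─q (B⁺⊆ e∈B) λ e∈A → ∉⊥ (disjoint (x∈p∩q⁺ (e∈A , e∈B))))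
        r≤ : ∀ {X X⁺} → X ⊆ E (si (S *)) → X⁺ ⊆ E S → S*.rank X⁺ ≤ S*.rank X → r (S *) X⁺ ≤ r (S *) X
        r≤ X⊆ X⁺⊆ = subst₂ _≤_ (total-rank-⊆ (S *) X⁺⊆) (total-rank-⊆ (S *) (⊆-trans X⊆ (si⊆ (S *))))
        below : connectivity (S *) A⁺ ≤ connectivity (si (S *)) A
        below = ℕ.∸-mono
          (ℕ.+-mono-≤ (r≤ A⊆ A⁺⊆ A-rank) (subst (λ Y → r (S *) Y ≤ r (S *) B) (sym B≡) (r≤ B⊆ B⁺⊆ B-rank)))
          (r-monotone (S *) _ _ (si⊆ (S *)) ⊆-refl)

    -- A has at most two elements, and its complement does not span S because rank W ≤ rank (E P) -
    -- 1. So the dual rank of A, which is ∣ A ∣ + r (E S ─ A) - r (E S), is at most one.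
    thin-side : ∀ {A Z W} → A ⊆ E S → Vertical M ⁅ x ⁆ Z W → A ⊆ Z → ∣ Z ∩ E S ∣ ≤ 2 →
      r S (E S ─ A) + 1 ≡ rank (W ∪ ⁅ x ⁆) → ¬ (2 ≤ r (S *) A)
    thin-side {A} {Z} {W} A⊆ v A⊆Z Z≤2 W-rank 2≤A = ℕ.<⇒≱ (begin-strict
      r (S *) A + r S (E S)              ≡⟨ dual-rank S A⊆ ⟩
      ∣ A ∣ + r S (E S ─ A)              ≤⟨ ℕ.+-monoˡ-≤ _ (ℕ.≤-trans (p⊆q⇒∣p∣≤∣q∣ (λ e∈ → x∈p∩q⁺ (A⊆Z e∈ , A⊆ e∈))) Z≤2) ⟩
      2 + r S (E S ─ A)                  <⟨ ℕ.+-monoʳ-< 2 B<S ⟩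
      2 + r S (E S)                      ∎) (ℕ.+-monoˡ-≤ (r S (E S)) 2≤A)
      where
      open ℕ.≤-Reasoning
      open Reasoning₃ M (Z ∷ W ∷ ⁅ x ⁆ ∷ [])
      module V = VerticalFacts (var 3) (var 1) (var 2) v
      B<S : r S (E S ─ A) < r S (E S)
      B<S = ℕ.+-cancelʳ-≤ 1 _ _ (begin
        suc (r S (E S ─ A)) + 1   ≡⟨ cong suc W-rank ⟩
        1 + rank (W ∪ ⁅ x ⁆)      ≤⟨ holds (by-ranks [] (V.x∈clY ∷ V.X+Y ∷ V.3≤X ∷ []) {# 1 ⊕ ρ var 2 ⊔ var 3 ≼ ρ 𝐄}) ⟩
        rank (E P)                ≡⟨ sym S-spans ⟩
        r S (E S) + 1             ∎)

    go : Connected 3 (si (S *)) ⊎ (∃[ X ] Separation 1 (si (S *)) X) ⊎ (∃[ X ] Separation 2 (si (S *)) X) →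
         Connected 3 (si (S *))
    go (inj₁ c) = c
    go (inj₂ (inj₁ s)) = ⊥-elim (no-1-separation A⊆ λ<k A-card B-card)
      where open Extension (extension ℕ.≤-refl s)
    go (inj₂ (inj₂ s)) = ⊥-elim (case lift-2-separation A⊆ λ<k A-card B-card of λ where
        (Z , W , v , A⊆Z , B⊆W , Z-rank , W-rank) → case small v of λ where
          (inj₁ Z≤2) → thin-side A⊆ v A⊆Z Z≤2 (W-rank) (proj₁ (corank ℕ.≤-refl))
          (inj₂ W≤2) → thin-side (p─q⊆p (E S) A) (swap M v) B⊆W W≤2
            (trans (cong (λ Y → r S Y + 1) (restore A⊆)) Z-rank) (proj₂ (corank ℕ.≤-refl)))
      where
      open Extension (extension (s≤s z≤n) s)
      restore : ∀ {A} → A ⊆ E S → E S ─ (E S ─ A) ≡ A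
      restore {A} A⊆ = equal (incl (var 0 ⊑ var 1) A⊆ ∷ []) (var 1 ⊖ (var 1 ⊖ var 0)) (var 0)
        where open Sets (A ∷ E S ∷ [])

module _ {m} (M : ThreeConnected m) where
  open ThreeConnected M

  -- Y gains no rank, and 3-connectivity keeps X - e from losing any once `x` is added, so rank
  -- three survives.
  move : ∀ {x e X Y} → Vertical M ⁅ x ⁆ X Y → e ∈ X → rank (Y ∪ ⁅ e ⁆) ≤ rank Y →
         Vertical M ⁅ x ⁆ (X ─ ⁅ e ⁆) (Y ∪ ⁅ e ⁆)
  move {x} {e} {X} {Y} v e∈X e∈clY = vertical M
    (included (by-sets H {𝐗 ⊖ 𝐞 ⊑ 𝐄})) (included (by-sets H {𝐘 ⊔ 𝐞 ⊑ 𝐄})) (Vertical.x⊆E v)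
    (included (by-sets H {𝐄 ⊑ (𝐗 ⊖ 𝐞) ⊔ (𝐘 ⊔ 𝐞) ⊔ 𝐱})) (included (by-sets H {(𝐗 ⊖ 𝐞) ⊓ (𝐘 ⊔ 𝐞) ⊑ ∅}))
    (included (by-sets H {(𝐗 ⊖ 𝐞) ⊓ 𝐱 ⊑ ∅})) (included (by-sets H {(𝐘 ⊔ 𝐞) ⊓ 𝐱 ⊑ ∅})) (rank-single x)
    (holds (by-ranks H (connect₂ H ((𝐗 ⊖ 𝐞) ⊔ 𝐱) (𝐘 ⊔ 𝐞) 2≤X─e (by-ranks [] (V.3≤Y ∷ [])) ∷ h ∷ V.X+Y ∷ V.3≤X ∷ [])
      {# 3 ≼ ρ (𝐗 ⊖ 𝐞) ⊔ 𝐱}))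
    (holds (by-ranks H (V.3≤Y ∷ []) {# 3 ≼ ρ (𝐘 ⊔ 𝐞) ⊔ 𝐱}))
    (holds (by-ranks H (V.x∈clX ∷ V.x∈clY ∷ V.X+Y ∷ h ∷ sub (𝐘 ⊔ 𝐞) (𝐘 ⊔ 𝐱) ∷ [])
      {ρ (𝐗 ⊖ 𝐞) ⊔ 𝐱 ⊕ ρ (𝐘 ⊔ 𝐞) ⊔ 𝐱 ≼ ρ 𝐄 ⊕ # 2}))
    where
    open Reasoning₃ M (X ∷ Y ∷ ⁅ x ⁆ ∷ ⁅ e ⁆ ∷ [])
    𝐗 = var 1
    𝐘 = var 2
    𝐱 = var 3
    𝐞 = var 4
    module V = VerticalFacts 𝐱 𝐗 𝐘 v
    H : SetFacts _
    H = incl (𝐞 ⊑ 𝐗) (⁅⁆-⊆ e∈X) ∷ V.sets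
    h : ⊢ ρ 𝐘 ⊔ 𝐞 ≼ ρ 𝐘
    h = rank-fact e∈clY
    2≤X─e : ⊢ # 2 ≼ ρ (𝐗 ⊖ 𝐞) ⊔ 𝐱
    2≤X─e = by-ranks [] (sub (𝐗 ⊖ 𝐞) 𝐞 ∷ fact (ρ 𝐞 ≼ # 1) (rank-single e) ∷ V.3≤X ∷ [])

-- Cocircuits, and the part of N outside two small sides

module _ {m} (P : Matroid m) {C* : Subset m} (cocircuit : Cocircuit P C*) where
  open RankFunction (total-rank P)

  cocircuit⊆E : C* ⊆ E P
  cocircuit⊆E = proj₁ cocircuit

  -- The complement of C* is a hyperplane.
  cocircuit-avoids : ∀ {S e} → S ⊆ E P → S ∩ C* ⊆ ⊥ → e ∈ C* → rank S + 1 ≤ rank (S ∪ ⁅ e ⁆)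
  cocircuit-avoids {S} {e} S⊆E S∩C* e∈C* = holds (by-ranks H
    (sub (𝐒 ⊔ 𝐞) (𝐄 ⊖ 𝐂) ∷ fact (ρ (𝐄 ⊖ 𝐂) ⊕ # 1 ≼ ρ (𝐄 ⊖ 𝐂) ⊔ 𝐞) (ℕ.≤-trans hyperplane-rank (ℕ.≤-reflexive (sym full))) ∷ [])
    {ρ 𝐒 ⊕ # 1 ≼ ρ 𝐒 ⊔ 𝐞})
    where
    open Reasoning (total-rank P) (E P ∷ S ∷ C* ∷ ⁅ e ⁆ ∷ [])
    𝐄 = var 0
    𝐒 = var 1
    𝐂 = var 2
    𝐞 = var 3
    H : SetFacts _
    H = incl (𝐒 ⊑ 𝐄) S⊆E ∷ incl (𝐒 ⊓ 𝐂 ⊑ const false) S∩C* ∷ incl (𝐞 ⊑ 𝐂) (⁅⁆-⊆ e∈C*) ∷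
        incl (𝐂 ⊑ 𝐄) cocircuit⊆E ∷ []
    hyperplane-rank : rank (E P ─ C*) + 1 ≤ rank (E P)
    hyperplane-rank = subst₂ (λ a b → a + 1 ≤ b) (sym (total-rank-⊆ P (p─q⊆p (E P) C*))) (sym (total-rank-⊆ P ⊆-refl))
      (ℕ.+-cancelˡ-≤ (∣ C* ∣) _ _ (begin
        ∣ C* ∣ + (r P (E P ─ C*) + 1)    ≡⟨ sym (ℕ.+-assoc (∣ C* ∣) _ 1) ⟩
        ∣ C* ∣ + r P (E P ─ C*) + 1      ≡⟨ cong (_+ 1) (sym (dual-rank P cocircuit⊆E)) ⟩
        r (P *) C* + r P (E P) + 1       ≡⟨ ℕ.+-comm _ 1 ⟩
        suc (r (P *) C*) + r P (E P)     ≤⟨ ℕ.+-monoˡ-≤ _ (circuit-rank (P *) cocircuit) ⟩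
        ∣ C* ∣ + r P (E P)               ∎))
      where open ℕ.≤-Reasoning
    full : rank ((E P ─ C*) ∪ ⁅ e ⁆) ≡ rank (E P)
    full = trans (cong rank He≡) (trans (total-rank-⊆ P (p─q⊆p (E P) (C* ─ ⁅ e ⁆))) (trans
      (ℕ.+-cancelˡ-≡ (∣ C* ─ ⁅ e ⁆ ∣) _ _ (trans
        (sym (dual-rank P (⊆-trans (p─q⊆p C* ⁅ e ⁆) cocircuit⊆E)))
        (cong (_+ r P (E P)) (circuit-rank─ (P *) cocircuit e∈C*)))) (sym (total-rank-⊆ P ⊆-refl))))
      where
      He≡ : (E P ─ C*) ∪ ⁅ e ⁆ ≡ E P ─ (C* ─ ⁅ e ⁆)
      He≡ = ⊆-antisym (included (by-sets H {(𝐄 ⊖ 𝐂) ⊔ 𝐞 ⊑ 𝐄 ⊖ (𝐂 ⊖ 𝐞)})) (included (by-sets H {𝐄 ⊖ (𝐂 ⊖ 𝐞) ⊑ (𝐄 ⊖ 𝐂) ⊔ 𝐞}))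

  -- Orthogonality: a set that avoids C* lies in the complementary hyperplane, which spans no
  -- element of C*.
  cocircuit-meets : ∀ {S e} → S ⊆ E P → e ∈ C* → rank (S ∪ ⁅ e ⁆) ≤ rank S → ∃[ s ] s ∈ S × s ∈ C*
  cocircuit-meets {S} {e} S⊆E e∈C* e∈clS with nonempty? (S ∩ C*)
  ... | yes (s , s∈) = s , x∈p∩q⁻ S C* s∈
  ... | no  none = ⊥-elim (ℕ.<⇒≱ (ℕ.≤-trans (ℕ.≤-reflexive (ℕ.+-comm 1 (rank S)))
    (cocircuit-avoids S⊆E (λ s∈ → ⊥-elim (none (_ , s∈))) e∈C*)) e∈clS)

module _ {n : ℕ} where

  subsingleton : ∀ {S : Subset n} → (∀ {u v} → u ∈ S → v ∈ S → u ≡ v) → ∣ S ∣ ≤ 1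
  subsingleton {S} same with ℕ.≤-<-connex (∣ S ∣) 1
  ... | inj₁ h = h
  ... | inj₂ h with ∣∣≥2⇒≢ h
  ...   | s , t , s∈ , t∈ , s≢t = ⊥-elim (s≢t (same s∈ t∈))

module _ {m n} (P : Matroid m) (N : Matroid n)
         (P-conn : Connected 3 P) (4≤P : 4 ≤ ∣ E P ∣) (N-conn : Connected 3 N) (4≤N : 4 ≤ ∣ E N ∣) where
  private
    M : ThreeConnected m
    M = three-connected P P-conn 4≤P
  open RankFunction (total-rank P)
  open Minors P N P-conn 4≤P N-conn 4≤N

  -- X and Z carry at most one element of N each, and N has at least four, so two labels fall into Y
  -- ∩ W. They are independent after contracting C, hence already before.
  big-corner : ∀ {g C x c X Y Z W} → Model P N g C → x ∈ C → c ∈ C →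
    Vertical M ⁅ x ⁆ X Y → Vertical M ⁅ c ⁆ Z W →
    Few g X → Few g Z → 2 ≤ rank (Y ∩ W)
  big-corner {g} {C} {x} {c} {X} {Y} {Z} {W} model x∈C c∈C vX vZ fewX fewZ =
    ℕ.+-cancelʳ-≤ (rank C) _ _ (case ∣∣≥2⇒≢ 2≤V of λ where
      (u , v , u∈ , v∈ , u≢v) → begin
        2 + rank C                            ≤⟨ ℕ.+-monoˡ-≤ _ (r-pair N N-conn 4≤N (pre⊆ (Y ∩ W) u∈) (pre⊆ (Y ∩ W) v∈) u≢v) ⟩
        r N (⁅ u ⁆ ∪ ⁅ v ⁆) + rank C          ≡⟨ ranks _ (∪-⊆ (⁅⁆-⊆ (pre⊆ (Y ∩ W) u∈)) (⁅⁆-⊆ (pre⊆ (Y ∩ W) v∈))) ⟩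
        rank (image g (⁅ u ⁆ ∪ ⁅ v ⁆) ∪ C)    ≤⟨ rank-mono _ _ (∪-⊆ (⊆-trans (image-mono g (∪-⊆ (⁅⁆-⊆ u∈) (⁅⁆-⊆ v∈)))
                                                   (⊆-trans (image-preimage model (Y ∩ W)) (p⊆p∪q C)))
                                                   (q⊆p∪q (Y ∩ W) C)) ⟩
        rank ((Y ∩ W) ∪ C)                    ≤⟨ holds (by-ranks [] (sub (var 0) (var 1) ∷ []) {ρ var 0 ⊔ var 1 ≼ ρ var 0 ⊕ ρ var 1}) ⟩
        rank (Y ∩ W) + rank C                 ∎)
    where
    open ℕ.≤-Reasoning
    open Model model
    open Reasoning (total-rank P) (Y ∩ W ∷ C ∷ [])
    pre : Subset m → Subset n
    pre = preimage model
    pre⊆ : ∀ S → pre S ⊆ E N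
    pre⊆ = preimage⊆ model
    pre? : ∀ S u → Dec (u ∈ E N × g u ∈ S)
    pre? = preimage? model
    few-pre : ∀ {S} → Few g S → ∣ pre S ∣ ≤ 1
    few-pre {S} few = subsingleton λ u∈ v∈ → few (pre⊆ S u∈) (pre⊆ S v∈)
      (proj₂ (∈-select⁻ (pre? S) u∈)) (proj₂ (∈-select⁻ (pre? S) v∈))
    covered : E N ⊆ pre X ∪ pre Z ∪ pre (Y ∩ W)
    covered {u} u∈ = case (side model vX x∈C u∈ , side model vZ c∈C u∈) of λ where
      (inj₁ u∈X , _)        → x∈p∪q⁺ (inj₁ (∈-select⁺ (pre? X) (u∈ , u∈X)))
      (inj₂ u∈Y , inj₁ u∈Z) → x∈p∪q⁺ (inj₂ (x∈p∪q⁺ (inj₁ (∈-select⁺ (pre? Z) (u∈ , u∈Z)))))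
      (inj₂ u∈Y , inj₂ u∈W) → x∈p∪q⁺ (inj₂ (x∈p∪q⁺ (inj₂ (∈-select⁺ (pre? (Y ∩ W)) (u∈ , x∈p∩q⁺ (u∈Y , u∈W))))))
    2≤V : 2 ≤ ∣ pre (Y ∩ W) ∣
    2≤V = ℕ.+-cancelˡ-≤ 2 _ _ (begin
      4                                               ≤⟨ 4≤N ⟩
      ∣ E N ∣                                         ≤⟨ p⊆q⇒∣p∣≤∣q∣ covered ⟩
      ∣ pre X ∪ pre Z ∪ pre (Y ∩ W) ∣                 ≤⟨ ∣∪∣≤ (pre X) _ ⟩
      ∣ pre X ∣ + ∣ pre Z ∪ pre (Y ∩ W) ∣             ≤⟨ ℕ.+-mono-≤ (few-pre fewX) (∣∪∣≤ (pre Z) _) ⟩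
      1 + (∣ pre Z ∣ + ∣ pre (Y ∩ W) ∣)               ≤⟨ s≤s (ℕ.+-monoˡ-≤ _ (few-pre fewZ)) ⟩
      2 + ∣ pre (Y ∩ W) ∣                             ∎)

module _ {m n} {S : Matroid m} {N : Matroid n} (N-conn : Connected 3 N) (4≤N : 4 ≤ ∣ E N ∣) where
  private
    N-simple : Simple N
    N-simple = connected⇒simple N N-conn 4≤N

    N*-simple : Simple (N *)
    N*-simple = connected⇒simple (N *) (connected-dual N N-conn) 4≤N

    undual : ∀ {Q : Matroid m} {g C} → Model Q (N * *) g C → Model Q N g C
    undual {Q} {g} {C} model = record
      { C⊆E = C⊆E ; maps = maps
      ; ranks = λ Z Z⊆ → trans (cong (_+ RankFunction.rank (total-rank Q) C) (sym (dual-dual N Z⊆))) (ranks Z Z⊆) }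
      where open Model model

  si-minor : ∀ {g C} → Model S N g C → HasMinor (si S) N
  si-minor model = finish (si-model N-simple model)
    where
    finish : (∃[ g ] ∃[ C ] Model (si S) N g C) → HasMinor (si S) N
    finish (_ , _ , model′) = model⇒minor (si S) N model′ N-simple

  co-minor : ∀ {g C} → Model S N g C → HasMinor (co S) N
  co-minor model = finish (si-model N*-simple (dual-model N-simple model))
    where
    finish : (∃[ g ] ∃[ C ] Model (si (S *)) (N *) g C) → HasMinor (co S) N
    finish (_ , _ , model′) = model⇒minor (co S) N (undual (dual-model N*-simple model′)) N-simple

-- With at least four elements, 3-connectivity makes all pairs independent. Applied to the dual, the
-- same statement produces the triad.
triple-circuit : ∀ {m} (Q : Matroid m) → Connected 3 Q → 4 ≤ ∣ E Q ∣ → ∀ {p q s} →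
  p ∈ E Q → q ∈ E Q → s ∈ E Q → p ≢ q → p ≢ s → q ≢ s →
  r Q (⁅ p ⁆ ∪ ⁅ q ⁆ ∪ ⁅ s ⁆) ≤ 2 → Circuit Q (⁅ p ⁆ ∪ ⁅ q ⁆ ∪ ⁅ s ⁆)
triple-circuit Q conn 4≤Q {p} {q} {s} p∈ q∈ s∈ p≢q p≢s q≢s h = circuit⁺ Q
  (∪-⊆ (⁅⁆-⊆ p∈) (∪-⊆ (⁅⁆-⊆ q∈) (⁅⁆-⊆ s∈))) (subst (r Q pqs <_) (sym ∣pqs∣) (s≤s h)) λ c∈ → case x∈p∪q⁻ ⁅ p ⁆ _ c∈ of λ where
    (inj₁ c∈p) → case x∈⁅y⁆⇒x≡y p c∈p of λ where
      refl → independent-pair (equal H ((var 0 ⊔ var 1 ⊔ var 2) ⊖ var 0) (var 1 ⊔ var 2)) q∈ s∈ q≢s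
    (inj₂ c∈qs) → case x∈p∪q⁻ ⁅ q ⁆ ⁅ s ⁆ c∈qs of λ where
      (inj₁ c∈q) → case x∈⁅y⁆⇒x≡y q c∈q of λ where
        refl → independent-pair (equal H ((var 0 ⊔ var 1 ⊔ var 2) ⊖ var 1) (var 0 ⊔ var 2)) p∈ s∈ p≢s
      (inj₂ c∈s) → case x∈⁅y⁆⇒x≡y s c∈s of λ where
        refl → independent-pair (equal H ((var 0 ⊔ var 1 ⊔ var 2) ⊖ var 2) (var 0 ⊔ var 1)) p∈ q∈ p≢q
  where
  pqs : Subset _
  pqs = ⁅ p ⁆ ∪ ⁅ q ⁆ ∪ ⁅ s ⁆
  open Sets (⁅ p ⁆ ∷ ⁅ q ⁆ ∷ ⁅ s ⁆ ∷ [])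
  H : SetFacts _
  H = incl (var 0 ⊓ var 1 ⊑ const false) (⁅⁆-≢ p≢q) ∷ incl (var 0 ⊓ var 2 ⊑ const false) (⁅⁆-≢ p≢s) ∷
      incl (var 1 ⊓ var 2 ⊑ const false) (⁅⁆-≢ q≢s) ∷ []
  ∣pqs∣ : ∣ pqs ∣ ≡ 3
  ∣pqs∣ = trans (sym (∣─⁅⁆∣ {S = pqs} {x = p} (x∈p∪q⁺ (inj₁ (x∈⁅x⁆ p)))))
    (cong suc (trans (cong ∣_∣ (equal H ((var 0 ⊔ var 1 ⊔ var 2) ⊖ var 0) (var 1 ⊔ var 2))) (∣pair∣ q≢s)))
  independent-pair : ∀ {X a b} → X ≡ ⁅ a ⁆ ∪ ⁅ b ⁆ → a ∈ E Q → b ∈ E Q → a ≢ b → ∣ X ∣ ≤ r Q X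
  independent-pair refl a∈ b∈ a≢b = ℕ.≤-trans (ℕ.≤-reflexive (∣pair∣ a≢b)) (r-pair Q conn 4≤Q a∈ b∈ a≢b)

-- Small sides of the vertical 3-partitions at c

module _ {m} (P : Matroid m) (P-conn : Connected 3 P) (4≤P : 4 ≤ ∣ E P ∣) where
  private
    M : ThreeConnected m
    M = three-connected P P-conn 4≤P
  open RankFunction (total-rank P)

  module _ {x b : Fin m} {X Y L : Subset m} (vX : Vertical M ⁅ x ⁆ X Y)
    (closed : ∀ {e} → e ∈ X → rank Y + 1 ≤ rank (Y ∪ ⁅ e ⁆))
    (L⊆Xx : L ⊆ X ∪ ⁅ x ⁆) (X⊆Lb : X ⊆ L ∪ ⁅ b ⁆) (x∈L : x ∈ L) (b∈X : b ∈ X) (b∉L : b ∉ L)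
    (L≤2 : rank L ≤ 2) (2≤L : 2 ≤ rank L) where
    private
      module F = Fan M vX closed L⊆Xx X⊆Lb x∈L b∈X b∉L L≤2 2≤L

    module _ {c a : Fin m} (c∈L : c ∈ L) (a∈L : a ∈ L) (c≢x : c ≢ x) (a≢x : a ≢ x) (c≢a : c ≢ a)
             {Z′ W′} (v′ : Vertical M ⁅ a ⁆ Z′ W′) (S : Matroid m) (simplified : Simplified P c S) where
      open Simplified simplified

      private
        x-side : ∀ {l Z W} → Vertical M ⁅ l ⁆ Z W → l ≢ x → x ∈ Z ⊎ x ∈ W
        x-side v l≢x = side-of M v (Vertical.x⊆E vX (x∈⁅x⁆ x)) λ x≡l → l≢x (sym x≡l)

        -- Contracting c leaves L - c with rank one, and two elements of S are never parallel.
        L∩S≤1 : ∣ L ∩ E S ∣ ≤ 1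
        L∩S≤1 = subsingleton λ {s} {t} s∈ t∈ → case s ≟ t of λ where
          (yes s≡t) → s≡t
          (no  s≢t) → ⊥-elim (ℕ.<⇒≱ (ℕ.≤-trans
            (ℕ.≤-trans (ℕ.+-monoˡ-≤ 1 (simple (p∩q⊆q L (E S) s∈) (p∩q⊆q L (E S) t∈) s≢t))
              (ℕ.≤-reflexive (sym (S-rank (∪-⊆ (⁅⁆-⊆ (p∩q⊆q L (E S) s∈)) (⁅⁆-⊆ (p∩q⊆q L (E S) t∈)))))))
            (rank-mono _ L (∪-⊆ (∪-⊆ (⁅⁆-⊆ (p∩q⊆p L (E S) s∈)) (⁅⁆-⊆ (p∩q⊆p L (E S) t∈))) (⁅⁆-⊆ c∈L)))) L≤2)

        -- Since b ∈ W, the side Z consists of points of L, at most one of which survives in S, and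
        -- of elements of Y, at most one by `near-side-thin`. The partition at `a` enters only
        -- there.
        near : ∀ {Z W Z″ W″} → F.Side a Z″ W″ → Vertical M ⁅ c ⁆ Z W → x ∈ Z → ∣ Z ∩ E S ∣ ≤ 2
        near {Z} {W} s′ v x∈Z = begin
          ∣ Z ∩ E S ∣                                       ≤⟨ p⊆q⇒∣p∣≤∣q∣ split ⟩
          ∣ L ∩ E S ∪ ((Z ∪ L) ─ ⁅ c ⁆) ∩ Y ∣               ≤⟨ ∣∪∣≤ (L ∩ E S) _ ⟩
          ∣ L ∩ E S ∣ + ∣ ((Z ∪ L) ─ ⁅ c ⁆) ∩ Y ∣           ≤⟨ ℕ.+-mono-≤ L∩S≤1 (∣thin∣≤1 M thin⊆E
                                                               (F.near-side-thin c∈L a∈L c≢x a≢x c≢a s s′)) ⟩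
          2                                                 ∎
          where
          open ℕ.≤-Reasoning
          s : F.Side c ((Z ∪ L) ─ ⁅ c ⁆) (W ─ L)
          s = F.shift c∈L c≢x v x∈Z
          open F.Base (Z ∷ W ∷ ⁅ c ⁆ ∷ E S ∷ [])
          module V = VerticalFacts (var 8) (var 6) (var 7) v
          H : SetFacts _
          H = incl (var 5 ⊑ var 7) (⁅⁆-⊆ (p─q⊆p W L (F.Side.b∈W s))) ∷ fan ++ˢ V.sets
          split : Z ∩ E S ⊆ L ∩ E S ∪ ((Z ∪ L) ─ ⁅ c ⁆) ∩ Y
          split = included (by-sets H {var 6 ⊓ var 9 ⊑ 𝐋 ⊓ var 9 ⊔ ((var 6 ⊔ 𝐋) ⊖ var 8) ⊓ 𝐘})
          thin⊆E : ((Z ∪ L) ─ ⁅ c ⁆) ∩ Y ⊆ E P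
          thin⊆E e∈ = Vertical.Y⊆E vX (p∩q⊆q ((Z ∪ L) ─ ⁅ c ⁆) Y e∈)

        opposite : ∃[ Z″ ] ∃[ W″ ] F.Side a Z″ W″
        opposite = case x-side v′ a≢x of λ where
          (inj₁ x∈Z) → _ , _ , F.shift a∈L a≢x v′ x∈Z
          (inj₂ x∈W) → _ , _ , F.shift a∈L a≢x (swap M v′) x∈W

      small-side : ∀ {Z W} → Vertical M ⁅ c ⁆ Z W → ∣ Z ∩ E S ∣ ≤ 2 ⊎ ∣ W ∩ E S ∣ ≤ 2
      small-side v = case x-side v c≢x of λ where
        (inj₁ x∈Z) → inj₁ (near (proj₂ (proj₂ opposite)) v x∈Z)
        (inj₂ x∈W) → inj₂ (near (proj₂ (proj₂ opposite)) (swap M v) x∈W)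

-- The induction on the small side of a vertical 3-partition

module Main {m n} (P : Matroid m) (N : Matroid n)
         (P-conn : Connected 3 P) (4≤P : 4 ≤ ∣ E P ∣) (N-conn : Connected 3 N) (4≤N : 4 ≤ ∣ E N ∣)
         {C* : Subset m} (cocircuit : Cocircuit P C*) where
  private
    M : ThreeConnected m
    M = three-connected P P-conn 4≤P
    module T = ThreeConnected M
  open RankFunction (total-rank P)
  open Minors P N P-conn 4≤P N-conn 4≤N

  Outcome : Set
  Outcome =
    (∃[ x ] x ∈ C* × Connected 3 (si (P / ⁅ x ⁆)) × HasMinor (si (P / ⁅ x ⁆)) N)
    ⊎ (∃[ x ] x ∈ C* × Connected 3 (co (si (P / ⁅ x ⁆))) × HasMinor (co (si (P / ⁅ x ⁆))) N)
    ⊎ (∃[ x₁ ] ∃[ x₂ ] ∃[ x₃ ] ∃[ x₄ ]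
         x₁ ∈ E P × x₂ ∈ E P × x₃ ∈ E P × x₄ ∈ E P
         × Circuit P (⁅ x₁ ⁆ ∪ ⁅ x₂ ⁆ ∪ ⁅ x₃ ⁆)
         × Cocircuit P (⁅ x₂ ⁆ ∪ ⁅ x₃ ⁆ ∪ ⁅ x₄ ⁆)
         × x₁ ∈ C* × x₃ ∈ C*
         × Connected 3 (si (P / ⁅ x₂ ⁆)) × HasMinor (si (P / ⁅ x₂ ⁆)) N)

  -- N is a minor of P / x.
  ContractsTo : Fin m → Set
  ContractsTo x = ∃[ g ] ∃[ C ] Model P N g C × x ∈ C

  rank-⁅⁆ : ∀ {x} → x ∈ E P → rank ⁅ x ⁆ ≡ 1
  rank-⁅⁆ {x} x∈E = ℕ.≤-antisym (T.rank-single x) (T.rank-nonloop x∈E)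

  contracted-model : ∀ {x g C} → x ∈ E P → Model P N g C → x ∈ C → Model (P / ⁅ x ⁆) N g (C ─ ⁅ x ⁆)
  contracted-model {x} {g} {C} x∈E model x∈C =
    contract {P = P} {N = N} {g = g} {x = x} x∈E {C = C} N-simple model x∈C

  contraction-minor : ∀ {x} → x ∈ E P → ContractsTo x → HasMinor (si (P / ⁅ x ⁆)) N
  contraction-minor {x} x∈E (_ , _ , model , x∈C) =
    si-minor {S = P / ⁅ x ⁆} {N = N} N-conn 4≤N (contracted-model x∈E model x∈C)

  cocontraction-minor : ∀ {x} → x ∈ E P → ContractsTo x → HasMinor (co (si (P / ⁅ x ⁆))) N
  cocontraction-minor {x} x∈E (_ , _ , model , x∈C) = finish (si-model {Q = P / ⁅ x ⁆} {N = N} N-simple (contracted-model x∈E model x∈C))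
    where
    finish : (∃[ g ] ∃[ C ] Model (si (P / ⁅ x ⁆)) N g C) → HasMinor (co (si (P / ⁅ x ⁆))) N
    finish (_ , _ , model′) = co-minor {S = si (P / ⁅ x ⁆)} {N = N} N-conn 4≤N model′

  outcome-i : ∀ {x} → x ∈ C* → ContractsTo x → Connected 3 (si (P / ⁅ x ⁆)) → Outcome
  outcome-i x∈C* x-contracts conn =
    inj₁ (_ , x∈C* , conn , contraction-minor (cocircuit⊆E P cocircuit x∈C*) x-contracts)

  connected-or-vertical : ∀ {x} → x ∈ E P → Connected 3 (si (P / ⁅ x ⁆)) ⊎ ∃[ Z ] ∃[ W ] Vertical M ⁅ x ⁆ Z W
  connected-or-vertical {x} x∈E = si-connected-or-vertical P P-conn 4≤P x∈E (si (P / ⁅ x ⁆))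
    (si-contraction-simplified P x∈E (rank-⁅⁆ x∈E))

  -- Only `X` is an index, since its size drives the induction. The element `x`, the partition and
  -- the model may all change when X shrinks.
  record Candidate (X : Subset m) : Set where
    field
      {x}   : Fin m
      {Y C} : Subset m
      {g}   : Fin n → Fin m
      x∈C*  : x ∈ C*
      vX    : Vertical M ⁅ x ⁆ X Y
      model : Model P N g C
      x∈C   : x ∈ C
      fewX  : Few g X

  module Step {X : Subset m} (candidate : Candidate X)
    (IH : ∀ {X′} → ∣ X′ ∣ < ∣ X ∣ → Candidate X′ → Outcome) where
    open Candidate candidate

    x∈E : x ∈ E P
    x∈E = Vertical.x⊆E vX (x∈⁅x⁆ x)

    X⊆E : X ⊆ E P
    X⊆E = Vertical.X⊆E vX

    module Closed (closed : ∀ {e} → e ∈ X → rank Y + 1 ≤ rank (Y ∪ ⁅ e ⁆)) where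

      relocated : ∀ {e} → e ∈ X → ∃[ g′ ] ∃[ C′ ] Model P N g′ C′ × x ∈ C′ × e ∈ C′ × Few g′ X
      relocated e∈X = Relocate.relocate vX model x∈C fewX e∈X (closed e∈X)

      contracts : ∀ {e} → e ∈ X → ContractsTo e
      contracts e∈X = case relocated e∈X of λ where
        (g′ , C′ , model′ , _ , e∈C′ , _) → g′ , C′ , model′ , e∈C′

      module Split {c : Fin m} (c∈X : c ∈ X) (c∈C* : c ∈ C*) {Z W : Subset m} (v : Vertical M ⁅ c ⁆ Z W) (x∈Z : x ∈ Z)
        (L≤2 : rank ((X ∪ ⁅ x ⁆) ∩ (Z ∪ ⁅ c ⁆)) ≤ 2) where

        L : Subset m
        L = (X ∪ ⁅ x ⁆) ∩ (Z ∪ ⁅ c ⁆)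

        private
          open Reasoning₃ M (X ∷ Y ∷ Z ∷ W ∷ ⁅ x ⁆ ∷ ⁅ c ⁆ ∷ [])
          𝐗 = var 1
          𝐘 = var 2
          𝐙 = var 3
          𝐖 = var 4
          𝐱 = var 5
          𝐜 = var 6
          module V = VerticalFacts 𝐜 𝐙 𝐖 v
          module VX = VerticalFacts 𝐱 𝐗 𝐘 vX
          H : SetFacts _
          H = incl (𝐜 ⊑ 𝐗) (⁅⁆-⊆ c∈X) ∷ incl (𝐱 ⊑ 𝐙) (⁅⁆-⊆ x∈Z) ∷ V.sets ++ˢ VX.sets

        x∉X : x ∉ X
        x∉X x∈X = ∉⊥ (Vertical.X∩x vX (x∈p∩q⁺ (x∈X , x∈⁅x⁆ x)))

        X-≢x : ∀ {e} → e ∈ X → e ≢ x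
        X-≢x e∈X refl = x∉X e∈X

        c∉Z : c ∉ Z
        c∉Z c∈Z = ∉⊥ (Vertical.X∩x v (x∈p∩q⁺ (c∈Z , x∈⁅x⁆ c)))

        c∈L : c ∈ L
        c∈L = x∈p∩q⁺ (x∈p∪q⁺ (inj₁ c∈X) , x∈p∪q⁺ (inj₂ (x∈⁅x⁆ c)))

        x∈L : x ∈ L
        x∈L = x∈p∩q⁺ (x∈p∪q⁺ (inj₂ (x∈⁅x⁆ x)) , x∈p∪q⁺ (inj₁ x∈Z))

        2≤L : 2 ≤ rank L
        2≤L = ℕ.≤-trans (T.rank-pair (X⊆E c∈X) x∈E (X-≢x c∈X)) (rank-mono _ _ (∪-⊆ (⁅⁆-⊆ c∈L) (⁅⁆-⊆ x∈L)))

        X∩Z⊆L : ∀ {a} → a ∈ X ∩ Z → a ∈ L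
        X∩Z⊆L a∈ = x∈p∩q⁺ (x∈p∪q⁺ (inj₁ (p∩q⊆p X Z a∈)) , x∈p∪q⁺ (inj₁ (p∩q⊆q X Z a∈)))

        X∩Z-≢c : ∀ {a} → a ∈ X ∩ Z → a ≢ c
        X∩Z-≢c a∈ refl = c∉Z (p∩q⊆q X Z a∈)

        -- X ∪ x is covered by two lines through c, and the second one meets C* in a second element.
        two-lines-outcome : 2 ≤ rank (X ∩ W) → rank ((X ∪ ⁅ x ⁆) ∩ (W ∪ ⁅ c ⁆)) ≤ 2 → Outcome
        two-lines-outcome 2≤XW K≤2 = case meeting of λ where
            (d , d∈XW , d∈C*) → case connected-or-vertical (X⊆E (p∩q⊆p X W d∈XW)) of λ where
              (inj₁ conn) → outcome-i d∈C* (contracts (p∩q⊆p X W d∈XW)) conn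
              (inj₂ (_ , _ , v′)) → ⊥-elim (blocked d∈XW v′)
          where
          K = (𝐗 ⊔ 𝐱) ⊓ (𝐖 ⊔ 𝐜)
          meeting : ∃[ d ] d ∈ X ∩ W × d ∈ C*
          -- X ∩ W spans c: it has rank at least two and lies with c in a set of rank at most two.
          -- As c is in C*, X ∩ W meets C*.
          meeting = cocircuit-meets P cocircuit (λ e∈ → X⊆E (p∩q⊆p X W e∈)) c∈C*
            (holds (by-ranks H (fact (ρ K ≼ # 2) K≤2 ∷ fact (# 2 ≼ ρ 𝐗 ⊓ 𝐖) 2≤XW ∷ []) {ρ 𝐗 ⊓ 𝐖 ⊔ 𝐜 ≼ ρ 𝐗 ⊓ 𝐖}))
          -- L has the three points x, c and an element a of X ∩ Z, and d lies off L.
          blocked : ∀ {d} → d ∈ X ∩ W → ∀ {Z′ W′} → Vertical M ⁅ d ⁆ Z′ W′ → False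
          blocked {d} d∈ v′ = case Crossing.meets M vX closed c∈X v of λ where
              (a , a∈) → triangle-blocks M vX closed X≤3 (p∩q⊆p X W d∈) (p∩q⊆p (X ∪ ⁅ x ⁆) (Z ∪ ⁅ c ⁆)) L≤2 3≤Ld
                (X∩Z⊆L a∈) c∈L x∈L (X∩Z-≢c a∈) (X-≢x (p∩q⊆p X Z a∈)) (X-≢x c∈X) d∉L v′
            where
            module R = Reasoning₃ M (X ∷ Y ∷ Z ∷ W ∷ ⁅ x ⁆ ∷ ⁅ c ⁆ ∷ ⁅ d ⁆ ∷ [])
            𝐝 = var 7
            𝐋 = (𝐗 ⊔ 𝐱) ⊓ (𝐙 ⊔ 𝐜)
            Hd : R.SetFacts _
            Hd = R.incl (𝐝 ⊑ 𝐗 ⊓ 𝐖) (⁅⁆-⊆ d∈) R.∷ R.incl (𝐜 ⊑ 𝐗) (⁅⁆-⊆ c∈X) R.∷ R.incl (𝐱 ⊑ 𝐙) (⁅⁆-⊆ x∈Z) R.∷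
                 R.VerticalFacts.sets 𝐜 𝐙 𝐖 v R.++ˢ R.VerticalFacts.sets 𝐱 𝐗 𝐘 vX
            d≢c : c ≢ d
            d≢c refl = ∉⊥ (Vertical.Y∩x v (x∈p∩q⁺ (p∩q⊆q X W d∈ , x∈⁅x⁆ d)))
            X≤3 : rank X ≤ 3
            X≤3 = holds (by-ranks H (sub 𝐋 K ∷ fact (ρ 𝐋 ≼ # 2) L≤2 ∷ fact (ρ K ≼ # 2) K≤2 ∷
              fact (# 1 ≼ ρ 𝐜) (T.rank-nonloop (X⊆E c∈X)) ∷ []) {ρ 𝐗 ≼ # 3})
            3≤Ld : 3 ≤ rank (L ∪ ⁅ d ⁆)
            3≤Ld = R.holds (R.by-ranks Hd (R.sub (𝐋 ⊔ 𝐝) K R.∷ R.fact (ρ K ≼ # 2) K≤2 R.∷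
              R.fact (# 2 ≼ ρ 𝐜 ⊔ 𝐝) (T.rank-pair (X⊆E c∈X) (X⊆E (p∩q⊆p X W d∈)) d≢c) R.∷
              R.VerticalFacts.3≤X 𝐱 𝐗 𝐘 vX R.∷ R.[]) {# 3 ≼ ρ 𝐋 ⊔ 𝐝})
            d∉L : d ∉ L
            d∉L d∈L = ∉⊥ (R.included (R.by-sets Hd {𝐋 ⊓ 𝐝 ⊑ ∅}) (x∈p∩q⁺ (d∈L , x∈⁅x⁆ d)))

        module OneLine {b : Fin m} (b∈XW : b ∈ X ∩ W) (XW⊆b : X ∩ W ⊆ ⁅ b ⁆) where
          private
            b∈X : b ∈ X
            b∈X = p∩q⊆p X W b∈XW

            module R = Reasoning₃ M (X ∷ Y ∷ Z ∷ W ∷ ⁅ x ⁆ ∷ ⁅ c ⁆ ∷ ⁅ b ⁆ ∷ [])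
            𝐛 = var 7
            𝐋 = (𝐗 ⊔ 𝐱) ⊓ (𝐙 ⊔ 𝐜)
            Hb : R.SetFacts _
            Hb = R.incl (𝐗 ⊓ 𝐖 ⊑ 𝐛) XW⊆b R.∷ R.incl (𝐛 ⊑ 𝐗 ⊓ 𝐖) (⁅⁆-⊆ b∈XW) R.∷ R.incl (𝐜 ⊑ 𝐗) (⁅⁆-⊆ c∈X) R.∷ R.incl (𝐱 ⊑ 𝐙) (⁅⁆-⊆ x∈Z) R.∷
                 R.VerticalFacts.sets 𝐜 𝐙 𝐖 v R.++ˢ R.VerticalFacts.sets 𝐱 𝐗 𝐘 vX

            L⊆Xx : L ⊆ X ∪ ⁅ x ⁆
            L⊆Xx = p∩q⊆p (X ∪ ⁅ x ⁆) (Z ∪ ⁅ c ⁆)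

            X⊆Lb : X ⊆ L ∪ ⁅ b ⁆
            X⊆Lb = R.included (R.by-sets Hb {𝐗 ⊑ 𝐋 ⊔ 𝐛})

            b∉L : b ∉ L
            b∉L b∈L = ∉⊥ (R.included (R.by-sets Hb {𝐋 ⊓ 𝐛 ⊑ ∅}) (x∈p∩q⁺ (b∈L , x∈⁅x⁆ b)))

            b≢c : b ≢ c
            b≢c refl = b∉L c∈L

          -- The failure at `a` is turned into success at `c`: it confines every vertical
          -- 3-partition at c to one with a side of at most two elements of si(P / c).
          outcome-ii : ∀ {a} → a ∈ X ∩ Z → ∀ {Z′ W′} → Vertical M ⁅ a ⁆ Z′ W′ → Outcome
          outcome-ii {a} a∈ v′ = inj₂ (inj₁ (c , c∈C* , conn , cocontraction-minor (X⊆E c∈X) (contracts c∈X)))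
            where
            simplified : Simplified P c (si (P / ⁅ c ⁆))
            simplified = si-contraction-simplified P (X⊆E c∈X) (rank-⁅⁆ (X⊆E c∈X))
            c≢a : c ≢ a
            c≢a c≡a = X∩Z-≢c a∈ (sym c≡a)
            conn : Connected 3 (co (si (P / ⁅ c ⁆)))
            conn = co-connected P P-conn 4≤P (X⊆E c∈X) (si (P / ⁅ c ⁆)) simplified
              (small-side P P-conn 4≤P vX closed L⊆Xx X⊆Lb x∈L b∈X b∉L L≤2 2≤L
                c∈L (X∩Z⊆L a∈) (X-≢x c∈X) (X-≢x (p∩q⊆p X Z a∈)) c≢a v′ (si (P / ⁅ c ⁆)) simplified)

          -- If X ∩ Z avoids C*, it has only one element, since c is not spanned by elements outside C*.
          outcome-iii : ∀ {a} → a ∈ X ∩ Z → (∀ {e} → e ∈ X ∩ Z → e ∉ C*) → Connected 3 (si (P / ⁅ a ⁆)) → Outcome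
          outcome-iii {a} a∈ avoid conn = inj₂ (inj₂ (x , a , c , b , x∈E , a∈E , c∈E , b∈E ,
              triple-circuit P P-conn 4≤P x∈E a∈E c∈E (λ x≡a → X-≢x a∈X (sym x≡a)) (λ x≡c → X-≢x c∈X (sym x≡c))
                (X∩Z-≢c a∈) triangle ,
              triple-circuit (P *) (connected-dual P P-conn) 4≤P a∈E c∈E b∈E (X∩Z-≢c a∈) a≢b (λ c≡b → b≢c (sym c≡b)) triad ,
              x∈C* , c∈C* , conn , contraction-minor a∈E (contracts a∈X)))
            where
            a∈X : a ∈ X
            a∈X = p∩q⊆p X Z a∈
            a∈E : a ∈ E P
            a∈E = X⊆E a∈X
            c∈E : c ∈ E P
            c∈E = X⊆E c∈X
            b∈E : b ∈ E P
            b∈E = X⊆E b∈X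
            a≢b : a ≢ b
            a≢b refl = b∉L (X∩Z⊆L a∈)
            only-a : X ∩ Z ⊆ ⁅ a ⁆
            only-a {e} e∈ = case e ≟ a of λ where
                (yes refl) → x∈⁅x⁆ e
                (no  e≢a)  → ⊥-elim (ℕ.<⇒≱ (begin-strict
                  2                               ≤⟨ T.rank-pair (X⊆E (p∩q⊆p X Z e∈)) a∈E e≢a ⟩
                  rank (⁅ e ⁆ ∪ ⁅ a ⁆)            <⟨ ℕ.≤-reflexive (ℕ.+-comm 1 _) ⟩
                  rank (⁅ e ⁆ ∪ ⁅ a ⁆) + 1        ≤⟨ cocircuit-avoids P cocircuit
                                                      (∪-⊆ (⁅⁆-⊆ (X⊆E (p∩q⊆p X Z e∈))) (⁅⁆-⊆ a∈E)) outside-C* c∈C* ⟩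
                  rank ((⁅ e ⁆ ∪ ⁅ a ⁆) ∪ ⁅ c ⁆)  ≤⟨ rank-mono _ _ (∪-⊆ (∪-⊆ (⁅⁆-⊆ (X∩Z⊆L e∈)) (⁅⁆-⊆ (X∩Z⊆L a∈))) (⁅⁆-⊆ c∈L)) ⟩
                  rank L                          ∎) L≤2)
              where
              open ℕ.≤-Reasoning
              outside-C* : (⁅ e ⁆ ∪ ⁅ a ⁆) ∩ C* ⊆ ⊥
              outside-C* f∈ = case x∈p∪q⁻ ⁅ e ⁆ ⁅ a ⁆ (p∩q⊆p _ C* f∈) of λ where
                (inj₁ f∈e) → ⊥-elim (avoid e∈ (subst (_∈ C*) (x∈⁅y⁆⇒x≡y e f∈e) (p∩q⊆q (⁅ e ⁆ ∪ ⁅ a ⁆) C* f∈)))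
                (inj₂ f∈a) → ⊥-elim (avoid a∈ (subst (_∈ C*) (x∈⁅y⁆⇒x≡y a f∈a) (p∩q⊆q (⁅ e ⁆ ∪ ⁅ a ⁆) C* f∈)))
            triangle : r P (⁅ x ⁆ ∪ ⁅ a ⁆ ∪ ⁅ c ⁆) ≤ 2
            triangle = ℕ.≤-trans (ℕ.≤-reflexive (sym (total-rank-⊆ P (∪-⊆ (⁅⁆-⊆ x∈E) (∪-⊆ (⁅⁆-⊆ a∈E) (⁅⁆-⊆ c∈E))))))
              (ℕ.≤-trans (rank-mono _ _ (∪-⊆ (⁅⁆-⊆ x∈L) (∪-⊆ (⁅⁆-⊆ (X∩Z⊆L a∈)) (⁅⁆-⊆ c∈L)))) L≤2)
            -- As X ∩ Z is just a and X ∩ W just b, everything outside {a, c, b} lies in Y ∪ x. That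
            -- set has rank below the rank of P, so the dual rank of the three elements is at most 3
            -- - 1.
            triad : r (P *) (⁅ a ⁆ ∪ ⁅ c ⁆ ∪ ⁅ b ⁆) ≤ 2
            triad = ℕ.+-cancelʳ-≤ (r P (E P)) _ _ (begin
              r (P *) acb + r P (E P)                   ≡⟨ dual-rank P acb⊆E ⟩
              ∣ acb ∣ + r P (E P ─ acb)                 ≤⟨ ℕ.+-mono-≤ ∣acb∣ (r-monotone P _ _ rest⊆ (p∩q⊆q (Y ∪ ⁅ x ⁆) (E P))) ⟩
              3 + rank (Y ∪ ⁅ x ⁆)                      ≤⟨ s≤s (s≤s (holds (by-ranks []
                                                             (VX.x∈clY ∷ VX.X+Y ∷ VX.3≤X ∷ []) {# 1 ⊕ ρ 𝐘 ⊔ 𝐱 ≼ ρ 𝐄}))) ⟩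
              2 + rank (E P)                            ≡⟨ cong (2 +_) (total-rank-⊆ P ⊆-refl) ⟩
              2 + r P (E P)                             ∎)
              where
              open ℕ.≤-Reasoning
              acb : Subset m
              acb = ⁅ a ⁆ ∪ ⁅ c ⁆ ∪ ⁅ b ⁆
              acb⊆E : acb ⊆ E P
              acb⊆E = ∪-⊆ (⁅⁆-⊆ a∈E) (∪-⊆ (⁅⁆-⊆ c∈E) (⁅⁆-⊆ b∈E))
              ∣acb∣ : ∣ acb ∣ ≤ 3
              ∣acb∣ = ℕ.≤-trans (∣∪∣≤ ⁅ a ⁆ _) (ℕ.+-mono-≤ (ℕ.≤-reflexive (∣⁅x⁆∣≡1 a))
                (ℕ.≤-trans (∣∪∣≤ ⁅ c ⁆ ⁅ b ⁆) (ℕ.+-mono-≤ (ℕ.≤-reflexive (∣⁅x⁆∣≡1 c)) (ℕ.≤-reflexive (∣⁅x⁆∣≡1 b)))))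
              rest⊆ : E P ─ acb ⊆ (Y ∪ ⁅ x ⁆) ∩ E P
              rest⊆ = U.included (U.by-sets
                (U.incl (var 1 ⊓ var 3 ⊑ var 8) only-a U.∷ U.incl (var 1 ⊓ var 4 ⊑ var 7) XW⊆b U.∷
                 U.VerticalFacts.sets (var 6) (var 3) (var 4) v U.++ˢ U.VerticalFacts.sets (var 5) (var 1) (var 2) vX)
                {var 0 ⊖ (var 8 ⊔ var 6 ⊔ var 7) ⊑ (var 2 ⊔ var 5) ⊓ var 0})
                where module U = Reasoning₃ M (X ∷ Y ∷ Z ∷ W ∷ ⁅ x ⁆ ∷ ⁅ c ⁆ ∷ ⁅ b ⁆ ∷ ⁅ a ⁆ ∷ [])

          one-line-outcome : Outcome
          one-line-outcome = case (nonempty? ((X ∩ Z) ∩ C*) , Crossing.meets M vX closed c∈X v) of λ where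
            (yes (a , a∈) , _) → case connected-or-vertical (X⊆E (p∩q⊆p X Z (p∩q⊆p (X ∩ Z) C* a∈))) of λ where
              (inj₁ conn) → outcome-i (p∩q⊆q (X ∩ Z) C* a∈) (contracts (p∩q⊆p X Z (p∩q⊆p (X ∩ Z) C* a∈))) conn
              (inj₂ (_ , _ , v′)) → outcome-ii (p∩q⊆p (X ∩ Z) C* a∈) v′
            (no none , a , a∈) → case connected-or-vertical (X⊆E (p∩q⊆p X Z a∈)) of λ where
              (inj₁ conn) → outcome-iii a∈ (λ e∈ e∈C* → none (_ , x∈p∩q⁺ (e∈ , e∈C*))) conn
              (inj₂ (_ , _ , v′)) → outcome-ii a∈ v′

      vertical-outcome : ∀ {c} (c∈X : c ∈ X) (c∈C* : c ∈ C*) {g′ C′} → Model P N g′ C′ → x ∈ C′ → c ∈ C′ → Few g′ X →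
        ∀ {Z W} → Vertical M ⁅ c ⁆ Z W → Few g′ Z → Outcome
      vertical-outcome {c} c∈X c∈C* {g′} model′ x∈C′ c∈C′ fewX′ {Z} {W} v fewZ =
        case crossed M vX closed c∈X v (big-corner P N P-conn 4≤P N-conn 4≤N model′ x∈C′ c∈C′ vX v fewX′ fewZ) of λ where
          (smaller {P′} v₁ P<X within) → IH P<X record
            { x∈C* = c∈C* ; vX = v₁ ; model = model′ ; x∈C = c∈C′ ; fewX = few-within within }
          (two-lines v₁ x∈P 2≤XQ L≤2 K≤2) → Split.two-lines-outcome c∈X c∈C* v₁ x∈P L≤2 2≤XQ K≤2
          (one-line v₁ x∈P b∈ XQ⊆b L≤2) → Split.OneLine.one-line-outcome c∈X c∈C* v₁ x∈P L≤2 b∈ XQ⊆b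
        where
        few-within : ∀ {P′} → P′ ⊆ X ⊎ P′ ⊆ Z → Few g′ P′
        few-within (inj₁ P′⊆X) u∈ v∈ gu∈ gv∈ = fewX′ u∈ v∈ (P′⊆X gu∈) (P′⊆X gv∈)
        few-within (inj₂ P′⊆Z) u∈ v∈ gu∈ gv∈ = fewZ u∈ v∈ (P′⊆Z gu∈) (P′⊆Z gv∈)

      closed-outcome : Outcome
      -- The element x lies in C* and in cl(X), so X has an element in C*.
      closed-outcome = case cocircuit-meets P cocircuit X⊆E x∈C* (Vertical.x∈clX vX) of λ where
        (c , c∈X , c∈C*) → case connected-or-vertical (X⊆E c∈X) of λ where
          (inj₁ conn) → outcome-i c∈C* (contracts c∈X) conn
          (inj₂ (Z , W , v)) → case relocated c∈X of λ where
            (g′ , C′ , model′ , x∈C′ , c∈C′ , fewX′) → case few-side model′ v c∈C′ of λ where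
              (inj₁ fewZ) → vertical-outcome c∈X c∈C* model′ x∈C′ c∈C′ fewX′ v fewZ
              (inj₂ fewW) → vertical-outcome c∈X c∈C* model′ x∈C′ c∈C′ fewX′ (swap M v) fewW

    outcome : Outcome
    outcome = case any? (λ e → (e ∈? X) ×-dec (rank (Y ∪ ⁅ e ⁆) ℕ.≤? rank Y)) of λ where
      (yes (e , e∈X , e∈clY)) → IH (x∈p⇒∣p-x∣<∣p∣ e∈X) record
        { x∈C* = x∈C* ; vX = move M vX e∈X e∈clY ; model = model ; x∈C = x∈C
        ; fewX = λ u∈ v∈ gu∈ gv∈ → fewX u∈ v∈ (p─q⊆p X ⁅ e ⁆ gu∈) (p─q⊆p X ⁅ e ⁆ gv∈) }
      (no none) → Closed.closed-outcome λ {e} e∈X → ℕ.≤-trans (ℕ.≤-reflexive (ℕ.+-comm (rank Y) 1))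
        (ℕ.≰⇒> λ e∈clY → none (e , e∈X , e∈clY))

  candidate-outcome : ∀ {X} → Candidate X → Outcome
  candidate-outcome {X} = go (ℕ.<-wellFounded ∣ X ∣)
    where
    go : ∀ {X} → Acc _<_ ∣ X ∣ → Candidate X → Outcome
    go (acc rec) candidate = Step.outcome candidate λ smaller′ → go (rec smaller′)

  cocircuit-outcome : ∀ {x} → x ∈ C* → ContractsTo x → Outcome
  cocircuit-outcome x∈C* contracts@(g , C , model , x∈C) =
    case connected-or-vertical (cocircuit⊆E P cocircuit x∈C*) of λ where
      (inj₁ conn) → outcome-i x∈C* contracts conn
      (inj₂ (X , Y , v)) → case few-side model v x∈C of λ where
        (inj₁ fewX) → candidate-outcome record { x∈C* = x∈C* ; vX = v ; model = model ; x∈C = x∈C ; fewX = fewX }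
        (inj₂ fewY) → candidate-outcome record { x∈C* = x∈C* ; vX = swap M v ; model = model ; x∈C = x∈C ; fewX = fewY }

-- Labels are distinct because N is simple. The bound `4 ≤ ∣ E N ∣` thus passes to M, whose own
-- simplicity rests on it.
model⇒∣∣≤ : ∀ {m n} {P : Matroid m} {N : Matroid n} {g C} → Connected 3 N → 4 ≤ ∣ E N ∣ → Model P N g C → ∣ E N ∣ ≤ ∣ E P ∣
model⇒∣∣≤ {P = P} {N} {g} N-conn 4≤N model = ℕ.≤-trans
  (ℕ.≤-reflexive (sym (∣image∣ g (E N) (injective P N model (connected⇒simple N N-conn 4≤N)))))
  (p⊆q⇒∣p∣≤∣q∣ (Model.image⊆E model ⊆-refl))

theorem1p1 : ∀ {m n : ℕ} (M : Matroid m) (N : Matroid n) →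
    Connected 3 M → Connected 3 N → 4 ≤ ∣ E N ∣ →
    (C* : Subset m) → Cocircuit M C* →
    (∃[ x₀ ] x₀ ∈ C* × HasMinor (M / ⁅ x₀ ⁆) N) →
    (∃[ x ] x ∈ C* × Connected 3 (si (M / ⁅ x ⁆)) × HasMinor (si (M / ⁅ x ⁆)) N)
    ⊎ (∃[ x ] x ∈ C* × Connected 3 (co (si (M / ⁅ x ⁆))) × HasMinor (co (si (M / ⁅ x ⁆))) N)
    ⊎ (∃[ x₁ ] ∃[ x₂ ] ∃[ x₃ ] ∃[ x₄ ]
    x₁ ∈ E M × x₂ ∈ E M × x₃ ∈ E M × x₄ ∈ E M
    × Circuit M (⁅ x₁ ⁆ ∪ ⁅ x₂ ⁆ ∪ ⁅ x₃ ⁆)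
    × Cocircuit M (⁅ x₂ ⁆ ∪ ⁅ x₃ ⁆ ∪ ⁅ x₄ ⁆)
    × x₁ ∈ C* × x₃ ∈ C*
    × Connected 3 (si (M / ⁅ x₂ ⁆)) × HasMinor (si (M / ⁅ x₂ ⁆)) N)
theorem1p1 M N M-conn N-conn 4≤N C* cocircuit (x₀ , x₀∈C* , minor) =
  start (minor⇒model (M / ⁅ x₀ ⁆) N (ℕ.≤-trans (s≤s z≤n) 4≤N) minor)
  where
  x₀∈E : x₀ ∈ E M
  x₀∈E = cocircuit⊆E M cocircuit x₀∈C*

  start : (∃[ g ] ∃[ C ] Model (M / ⁅ x₀ ⁆) N g C) → _
  start (g , C , model) = Main.cocircuit-outcome M N M-conn 4≤M N-conn 4≤N cocircuit x₀∈C*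
    (g , C ∪ ⁅ x₀ ⁆ , model′ , x∈p∪q⁺ (inj₂ (x∈⁅x⁆ x₀)))
    where
    model′ : Model M N g (C ∪ ⁅ x₀ ⁆)
    model′ = uncontract {P = M} {N = N} {g = g} {x = x₀} x₀∈E model
    4≤M : 4 ≤ ∣ E M ∣
    4≤M = ℕ.≤-trans 4≤N (model⇒∣∣≤ N-conn 4≤N model′)
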